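{- Let $q$ be an odd prime power, let $r\ge 2$ be an integer, and let $a\in\mathrm{GF}(q^2)^*$ and $b\in\mathrm{GF}(q^2)\setminus\mathrm{GF}(q)$ satisfy $4a^{q+1}+(b^q-b)^2=0$. Let $\mathcal{B}(a,b)$ be the set of points $(x_1,\dots,x_r)$ of $\mathrm{AG}(r,q^2)$ satisfying \[x_r^q-x_r+a^q(x_1^{2q}+\dots+x_{r-1}^{2q})-a(x_1^2+\dots+x_{r-1}^2)=(b^q-b)(x_1^{q+1}+\dots+x_{r-1}^{q+1}).\] Then $|\mathcal{B}(a,b)|=q^{2r-1}$, and $\mathcal{B}(a,b)$ is a three-character set with respect to the hyperplanes of $\mathrm{AG}(r,q^2)$, i.e. for every hyperplane $H$ of $\mathrm{AG}(r,q^2)$ the number $|H\cap\mathcal{B}(a,b)|$ lies in the following set of three values: \begin{enumerate} \item if $r\equiv 1\pmod 4$, or $r$ is odd and $q\equiv 1\pmod 4$: $\{q^{2r-3}-q^{(3r-5)/2},\ q^{2r-3},\ q^{2r-3}-q^{(3r-5)/2}+q^{3(r-1)/2}\}$; \item if $r\equiv 3\pmod 4$ and $q\equiv 3\pmod 4$: $\{q^{2r-3}+q^{(3r-5)/2}-q^{3(r-1)/2},\ q^{2r-3},\ q^{2r-3}+q^{(3r-5)/2}\}$; \item if $r$ is even: $\{q^{2r-3}-q^{(3r-4)/2},\ q^{2r-3},\ q^{2r-3}+q^{(3r-4)/2}\}$. \end{enumerate} Furthermore, for $r>2$, $\mathcal{B}(a,b)$ is a minimal intersection set with respect to hyperplanes,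 i.e. a minimal $t$-intersection set where $t$ is the least number of points of $\mathcal{B}(a,b)$ on a hyperplane of $\mathrm{AG}(r,q^2)$.
   Context: A set $S$ of points of $\mathrm{AG}(r,q^2)$ is a $t$-intersection set (with respect to hyperplanes) if every hyperplane contains at least $t>0$ points of $S$. A point $P\in S$ is essential if $S\setminus\{P\}$ is not a $t$-intersection set; $S$ is minimal if all its points are essential. A set is an $m$-character set if its intersection sizes with hyperplanes take only $m$ possible values (the characters). -}

module Defs where

open import Data.Nat as ℕ using (ℕ; zero; suc)
open import Data.Bool using (Bool; true; false; _∧_; not)
open import Data.List using (List; []; _∷_; map; concatMap; filterᵇ; length)
open import Data.List.Membership.Propositional using (_∈_)
open import Data.List.Relation.Unary.Unique.Propositional using (Unique)
open import Data.Vec using (Vec; []; _∷_; lookup; zipWith; foldr; last; init)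
import Data.Vec.Properties as VecP
open import Data.Fin using (Fin)
open import Data.Product using (∃; _×_)
open import Relation.Nullary using (¬_)
open import Relation.Nullary.Decidable using (⌊_⌋)
open import Relation.Binary.PropositionalEquality using (_≡_; _≢_)
open import Relation.Binary.Definitions using (DecidableEquality)
open import Algebra.Structures using (IsCommutativeRing)

record FiniteField : Set₁ where
  infixl 6 _+_
  infixl 7 _*_
  field
    Carrier  : Set
    _+_ _*_  : Carrier → Carrier → Carrier
    -_       : Carrier → Carrier
    0# 1#    : Carrier
    isCommutativeRing : IsCommutativeRing _≡_ _+_ _*_ -_ 0# 1#
    0≢1      : 0# ≢ 1#
    inverse  : ∀ x → x ≢ 0# → ∃ λ y → x * y ≡ 1#
    _≟_      : DecidableEquality Carrier
    elements : List Carrier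
    complete : ∀ x → x ∈ elements
    unique   : Unique elements

  order : ℕ
  order = length elements

module FF (F : FiniteField) where
  open FiniteField F public

  infixl 6 _-_
  infixr 8 _^_

  _-_ : Carrier → Carrier → Carrier
  x - y = x + (- y)

  _^_ : Carrier → ℕ → Carrier
  x ^ zero  = 1#
  x ^ suc n = x * (x ^ n)

  fromℕ : ℕ → Carrier
  fromℕ zero    = 0#
  fromℕ (suc n) = 1# + fromℕ n

  ΣV : ∀ {n} → Vec Carrier n → Carrier
  ΣV = foldr _ _+_ 0#

  Point : ℕ → Set
  Point r = Vec Carrier r

  allPoints : (r : ℕ) → List (Point r)
  allPoints zero    = [] ∷ []
  allPoints (suc r) = concatMap (λ x → map (x ∷_) (allPoints r)) elements

  PointSet : ℕ → Set
  PointSet r = Point r → Bool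

  _∈ₛ_ : ∀ {r} → Point r → PointSet r → Set
  P ∈ₛ S = S P ≡ true

  ∣_∣ : ∀ {r} → PointSet r → ℕ
  ∣_∣ {r} S = length (filterᵇ S (allPoints r))

  _∩_ : ∀ {r} → PointSet r → PointSet r → PointSet r
  (S ∩ T) x = S x ∧ T x

  _∖｛_｝ : ∀ {r} → PointSet r → Point r → PointSet r
  (S ∖｛ P ｝) x = S x ∧ not ⌊ VecP.≡-dec _≟_ x P ⌋

  record Hyperplane (r : ℕ) : Set where
    field
      coeffs  : Vec Carrier r
      nonzero : ∃ λ (i : Fin r) → lookup coeffs i ≢ 0#
      const   : Carrier

  hyp : ∀ {r} → Hyperplane r → PointSet r
  hyp H x = ⌊ ΣV (zipWith _*_ (Hyperplane.coeffs H) x) ≟ Hyperplane.const H ⌋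

  IsTIntersectionSet : ∀ {r} → PointSet r → ℕ → Set
  IsTIntersectionSet {r} S t = (0 ℕ.< t) × (∀ (H : Hyperplane r) → t ℕ.≤ ∣ hyp H ∩ S ∣)

  IsEssential : ∀ {r} → PointSet r → ℕ → Point r → Set
  IsEssential S t P = ¬ IsTIntersectionSet (S ∖｛ P ｝) t

  IsMinimalTIntersectionSet : ∀ {r} → PointSet r → ℕ → Set
  IsMinimalTIntersectionSet S t =
    IsTIntersectionSet S t × (∀ P → P ∈ₛ S → IsEssential S t P)

  B-lhs B-rhs : ∀ {n} → Carrier → Carrier → ℕ → Point (suc n) → Carrier
  B-lhs a b q x =
    let xr = last x ; xs = init x in
    xr ^ q - xr + (a ^ q) * ΣV (Data.Vec.map (λ y → y ^ (2 ℕ.* q)) xs)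
                - a * ΣV (Data.Vec.map (λ y → y ^ 2) xs)
  B-rhs a b q x =
    (b ^ q - b) * ΣV (Data.Vec.map (λ y → y ^ (q ℕ.+ 1)) (init x))

  𝓑 : ∀ {n} → Carrier → Carrier → ℕ → PointSet (suc n)
  𝓑 a b q x = ⌊ B-lhs a b q x ≟ B-rhs a b q x ⌋

{-# OPTIONS --safe #-}
module Submission where

-- Write σ x = x^q and β = b^q - b, so that σ β = - β.  The condition on a and b says that the GF(q)-quadratic form
-- a^q x^{2q} - a x² - β x^{q+1} on GF(q²) has discriminant zero: in coordinates x = w (u + β v) with u, v in GF(q) and
-- a suitable w it becomes β κ v², for some nonzero κ in GF(q).  A hyperplane x_r = d + Σ mᵢ xᵢ adds the linear form
-- β (δᵢ u - τᵢ v) for each i.  If some δᵢ ≠ 0, or if the hyperplane does not involve x_r, the section has q^{2r-3} points.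
-- Otherwise, completing squares, it has q^{r-1} N(s) points, where N(s) is the number of representations of some s in
-- GF(q) as a sum of r - 1 squares.  N satisfies a two-step recursion whose sign is the quadratic character of -1,
-- obtained by counting the points of the conics x² + y² = t.  Minimality holds because for r > 2 the mᵢ can be chosen
-- so that the hyperplane passes through a given point of the set and s is arbitrary, every s being a sum of two squares.

open import Defs
open import Algebra.Bundles using (CommutativeRing; RawRing)
import Algebra.Morphism.RingMonomorphism
open import Algebra.Morphism.Structures using (IsRingMonomorphism)
import Algebra.Properties.CommutativeSemiring.Binomial
import Algebra.Properties.CommutativeSemiring.Exp
import Algebra.Properties.Ring
import Algebra.Properties.Semiring.Mult
import Algebra.Properties.Semiring.Sum
import Algebra.Solver.Ring
open import Algebra.Solver.Ring.AlmostCommutativeRing using (AlmostCommutativeRing; fromCommutativeRing; _-Raw-AlmostCommutative⟶_)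
open import Algebra.Structures using (IsCommutativeRing)
open import Data.Bool using (Bool; true; false; _∧_)
open import Data.Empty using (⊥-elim)
open import Data.Fin using (Fin) renaming (zero to fzero; suc to fsuc)
import Data.Fin as Fin
import Data.Fin.Properties as Finₚ
open import Data.Integer using (ℤ; -[1+_])
import Data.Integer as ℤ
import Data.Integer.Properties as ℤₚ
open import Data.Integer.Tactic.RingSolver using () renaming (solve-∀ to ℤ-solve-∀)
open import Data.List using (List; []; _∷_; _++_; map; concatMap; filterᵇ; length; cartesianProduct; filter; foldr; deduplicate)
open import Data.List.Membership.Propositional using (_∈_; _∉_)
open import Data.List.Membership.Propositional.Properties using (∈-map⁺; ∈-cartesianProduct⁺; ∈-map⁻; ∈-filter⁺; ∈-filter⁻; ∈-deduplicate⁺; ∈-concatMap⁺)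
open import Data.List.Membership.Propositional.Properties.WithK using (unique∧set⇒bag)
open import Data.List.Properties using (map-∘; map-cong; map-++)
open import Data.List.Relation.Binary.BagAndSetEquality using (∼bag⇒↭)
open import Data.List.Relation.Binary.Permutation.Propositional using (_↭_; ↭⇒↭ₛ)
open import Data.List.Relation.Binary.Permutation.Propositional.Properties using (↭-length) renaming (map⁺ to ↭-map⁺)
open import Data.List.Relation.Binary.Permutation.Setoid.Properties using (foldr-commMonoid)
import Data.List.Relation.Unary.All as All
open import Data.List.Relation.Unary.AllPairs using (_∷_; [])
import Data.List.Relation.Unary.Any as ListAny
open import Data.List.Relation.Unary.Any using (here; there)
import Data.List.Relation.Unary.Unique.DecPropositional.Properties as DecUnique
open import Data.List.Relation.Unary.Unique.Propositional using (Unique)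
import Data.List.Relation.Unary.Unique.Propositional.Properties as Unique
open import Data.Maybe using (Maybe; just; nothing)
import Data.Nat as ℕ
open import Data.Nat using (ℕ; zero; suc; z≤n; s≤s; _!; NonZero) renaming (_+_ to _+ℕ_; _*_ to _*ℕ_; _≤_ to _≤ℕ_; _<_ to _<ℕ_; _^_ to _^ℕ_; _∸_ to _∸ℕ_)
open import Data.Nat.Combinatorics using (_C_; nCn≡1; nCk≡n!/k![n-k]!; k![n∸k]!∣n!)
open import Data.Nat.DivMod using (_/_; _%_; m/n*n≡m; m≡m%n+[m/n]*n; [m+kn]%n≡m%n; m*n/n≡m)
open import Data.Nat.Divisibility using (_∣_; divides; m∣m*n; ∣m∣n⇒∣m+n; ∣⇒≤; ∣1⇒≡1; ∣m+n∣m⇒∣n)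
open import Data.Nat.ListAction using (sum)
open import Data.Nat.ListAction.Properties using (sum-++; sum-↭)
open import Data.Nat.Primality using (Prime; euclidsLemma; ¬prime[1]; ¬prime[0])
import Data.Nat.Properties as ℕₚ
open import Data.Nat.Tactic.RingSolver using (solve-∀)
open import Data.Product using (_×_; ∃; _,_; proj₁; proj₂)
open import Data.Sum using (_⊎_; inj₁; inj₂)
import Data.Sum as Sum
import Data.Vec as Vec
open import Data.Vec using (Vec; []; _∷_; replicate; _∷ʳ_; zipWith; lookup; initLast)
import Data.Vec.Properties as VecP
open import Data.Vec.Relation.Unary.All using (All; []; _∷_)
open import Data.Vec.Relation.Unary.Any using (Any; here; there)
open import Function using (_∘_; mk⇔)
open import Level using (0ℓ)
open import Relation.Binary.Definitions using (DecidableEquality; tri<; tri≈; tri>)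
open import Relation.Binary.PropositionalEquality using (_≡_; _≢_; refl; sym; trans; cong; cong₂; subst; module ≡-Reasoning; subst₂)
open import Relation.Binary.PropositionalEquality.WithK using (≡-irrelevant)
open import Relation.Nullary using (¬_; Dec; yes; no)
open import Relation.Nullary.Decidable using (⌊_⌋; ¬?; map′)

-- The quadratic part is anti-invariant under σ, so after division by β the defining equation is a
-- single equation over GF(q); this puts q points of the set over every choice of the first r - 1
-- coordinates. As a quadratic polynomial in σ x / x the form has coefficients σ a, - β, - a, and
-- the hypothesis on a and b gives it the double root c = β / (2 σ a). The same hypothesis makes the
-- norm of c equal to 1, so Hilbert 90 provides the w with σ w = c w; the zeros of the form are the
-- GF(q)-multiples of w. GF(q) is not among the data: it is built as the fixed field of σ, and its
-- order is recovered from that of GF(q²) by coordinates. The proof of minimality never decides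
-- which character is the least. It shows that, for r > 2, every size of a hyperplane section also
-- occurs for some hyperplane through any prescribed point of the set.

-- Finite sums, indicators and bijections.

∑ : {A : Set} → List A → (A → ℕ) → ℕ
∑ xs f = sum (map f xs)

𝟙ᵇ : Bool → ℕ
𝟙ᵇ true  = 1
𝟙ᵇ false = 0

𝟙 : {P : Set} → Dec P → ℕ
𝟙 d = 𝟙ᵇ ⌊ d ⌋

𝟙-true : {P : Set} (d : Dec P) → P → 𝟙 d ≡ 1
𝟙-true (yes _) _ = refl
𝟙-true (no ¬p) p = ⊥-elim (¬p p)

𝟙-false : {P : Set} (d : Dec P) → ¬ P → 𝟙 d ≡ 0
𝟙-false (yes p) ¬p = ⊥-elim (¬p p)
𝟙-false (no _) _ = refl

𝟙-⇔ : {P Q : Set} (d : Dec P) (e : Dec Q) → (P → Q) → (Q → P) → 𝟙 d ≡ 𝟙 e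
𝟙-⇔ (yes p) e to from = sym (𝟙-true e (to p))
𝟙-⇔ (no ¬p) e to from = sym (𝟙-false e (¬p ∘ from))

𝟙ᵇ-∧ : ∀ x y → 𝟙ᵇ (x ∧ y) ≡ 𝟙ᵇ x *ℕ 𝟙ᵇ y
𝟙ᵇ-∧ true  y = sym (ℕₚ.+-identityʳ _)
𝟙ᵇ-∧ false y = refl

module _ {A : Set} where

  ∑-cong : ∀ (xs : List A) {f g} → (∀ x → f x ≡ g x) → ∑ xs f ≡ ∑ xs g
  ∑-cong xs f≗g = cong sum (map-cong f≗g xs)

  ∑-+ : ∀ (xs : List A) f g → ∑ xs (λ x → f x +ℕ g x) ≡ ∑ xs f +ℕ ∑ xs g
  ∑-+ []       f g = refl
  ∑-+ (x ∷ xs) f g rewrite ∑-+ xs f g = lemma (f x) (g x) (∑ xs f) (∑ xs g)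
    where
    lemma : ∀ a b c d → (a +ℕ b) +ℕ (c +ℕ d) ≡ (a +ℕ c) +ℕ (b +ℕ d)
    lemma = solve-∀

  ∑-*ˡ : ∀ (xs : List A) c f → ∑ xs (λ x → c *ℕ f x) ≡ c *ℕ ∑ xs f
  ∑-*ˡ []       c f = sym (ℕₚ.*-zeroʳ c)
  ∑-*ˡ (x ∷ xs) c f rewrite ∑-*ˡ xs c f = sym (ℕₚ.*-distribˡ-+ c (f x) _)

  ∑-*ʳ : ∀ (xs : List A) c f → ∑ xs (λ x → f x *ℕ c) ≡ ∑ xs f *ℕ c
  ∑-*ʳ xs c f = trans (∑-cong xs (λ x → ℕₚ.*-comm (f x) c)) (trans (∑-*ˡ xs c f) (ℕₚ.*-comm c _))

  ∑-const : ∀ (xs : List A) c → ∑ xs (λ _ → c) ≡ length xs *ℕ c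
  ∑-const []       c = refl
  ∑-const (x ∷ xs) c = cong (c +ℕ_) (∑-const xs c)

  ∑-++ : ∀ (xs ys : List A) f → ∑ (xs ++ ys) f ≡ ∑ xs f +ℕ ∑ ys f
  ∑-++ xs ys f = trans (cong sum (map-++ f xs ys)) (sum-++ (map f xs) (map f ys))

  ∑-↭ : ∀ {xs ys : List A} f → xs ↭ ys → ∑ xs f ≡ ∑ ys f
  ∑-↭ f p = sum-↭ (↭-map⁺ f p)

  length-filterᵇ : ∀ S (xs : List A) → length (filterᵇ S xs) ≡ ∑ xs (𝟙ᵇ ∘ S)
  length-filterᵇ S []       = refl
  length-filterᵇ S (x ∷ xs) with S x
  ... | true  = cong suc (length-filterᵇ S xs)
  ... | false = length-filterᵇ S xs

  ∑-mono-≤ : ∀ (xs : List A) {f g} → (∀ x → f x ≤ℕ g x) → ∑ xs f ≤ℕ ∑ xs g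
  ∑-mono-≤ []       f≤g = z≤n
  ∑-mono-≤ (x ∷ xs) f≤g = ℕₚ.+-mono-≤ (f≤g x) (∑-mono-≤ xs f≤g)

  ∑-mono-< : ∀ (xs : List A) {f g x} → (∀ x → f x ≤ℕ g x) → x ∈ xs → f x <ℕ g x → ∑ xs f <ℕ ∑ xs g
  ∑-mono-< (x ∷ xs) f≤g (here refl) fx<gx = ℕₚ.+-mono-<-≤ fx<gx (∑-mono-≤ xs f≤g)
  ∑-mono-< (x ∷ xs) f≤g (there x∈)  fx<gx = ℕₚ.+-mono-≤-< (f≤g x) (∑-mono-< xs f≤g x∈ fx<gx)

  -- A strict inequality at one entry would make the sums differ. This turns an averaging argument
  -- into a pointwise identity.
  ∑-tight : ∀ (xs : List A) {f g x} → (∀ x → f x ≤ℕ g x) → ∑ xs f ≡ ∑ xs g → x ∈ xs → f x ≡ g x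
  ∑-tight xs {x = x} f≤g eq x∈ = ℕₚ.≤-antisym (f≤g x)
    (ℕₚ.≮⇒≥ λ fx<gx → ℕₚ.<-irrefl eq (∑-mono-< xs f≤g x∈ fx<gx))

  ∑-positive : ∀ (xs : List A) {f} → 0 <ℕ ∑ xs f → ∃ λ x → 0 <ℕ f x
  ∑-positive (x ∷ xs) {f} 0<∑ with f x in eq
  ... | suc _ = x , subst (0 <ℕ_) (sym eq) (s≤s z≤n)
  ... | zero  = ∑-positive xs 0<∑

∑-map : ∀ {A B : Set} (φ : A → B) xs f → ∑ (map φ xs) f ≡ ∑ xs (f ∘ φ)
∑-map φ xs f = cong sum (sym (map-∘ xs))

module _ {A B : Set} where

  ∑-concatMap : ∀ (h : A → List B) xs f → ∑ (concatMap h xs) f ≡ ∑ xs (λ x → ∑ (h x) f)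
  ∑-concatMap h []       f = refl
  ∑-concatMap h (x ∷ xs) f =
    trans (∑-++ (h x) (concatMap h xs) f) (cong (∑ (h x) f +ℕ_) (∑-concatMap h xs f))

  ∑-cartesianProduct : ∀ (xs : List A) (ys : List B) f →
    ∑ (cartesianProduct xs ys) f ≡ ∑ xs (λ x → ∑ ys (λ y → f (x , y)))
  ∑-cartesianProduct []       ys f = refl
  ∑-cartesianProduct (x ∷ xs) ys f = trans (∑-++ (map (x ,_) ys) _ f)
    (cong₂ _+ℕ_ (∑-map (x ,_) ys f) (∑-cartesianProduct xs ys f))

  ∑-swap : ∀ (xs : List A) (ys : List B) (f : A → B → ℕ) →
    ∑ xs (λ x → ∑ ys (f x)) ≡ ∑ ys (λ y → ∑ xs (λ x → f x y))
  ∑-swap []       ys f = sym (trans (∑-const ys 0) (ℕₚ.*-zeroʳ (length ys)))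
  ∑-swap (x ∷ xs) ys f = trans (cong (∑ ys (f x) +ℕ_) (∑-swap xs ys f))
    (sym (∑-+ ys (f x) (λ y → ∑ xs (λ x → f x y))))

record Enumeration (A : Set) : Set where
  field
    list          : List A
    list-complete : ∀ x → x ∈ list
    list-unique   : Unique list

open Enumeration

_⊗_ : {A B : Set} → Enumeration A → Enumeration B → Enumeration (A × B)
X ⊗ Y = record
  { list          = cartesianProduct (list X) (list Y)
  ; list-complete = λ (x , y) → ∈-cartesianProduct⁺ (list-complete X x) (list-complete Y y)
  ; list-unique   = Unique.cartesianProduct⁺ (list-unique X) (list-unique Y)
  }

module _ {A B : Set} (X : Enumeration A) (Y : Enumeration B) (φ : A → B) (ψ : B → A)
  (φψ : ∀ y → φ (ψ y) ≡ y) (ψφ : ∀ x → ψ (φ x) ≡ x) where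

  -- Both lists are free of duplicates and contain every element of `B`, so they agree as bags.
  map-bijection-↭ : map φ (list X) ↭ list Y
  map-bijection-↭ = ∼bag⇒↭ (unique∧set⇒bag
    (Unique.map⁺ (λ {x} {y} eq → trans (sym (ψφ x)) (trans (cong ψ eq) (ψφ y))) (list-unique X))
    (list-unique Y)
    (λ {y} → mk⇔ (λ _ → list-complete Y y)
         (λ _ → subst (_∈ map φ (list X)) (φψ y) (∈-map⁺ φ (list-complete X (ψ y))))))

  ∑-bijection : ∀ f → ∑ (list Y) f ≡ ∑ (list X) (f ∘ φ)
  ∑-bijection f = trans (sym (∑-↭ f map-bijection-↭)) (∑-map φ (list X) f)

module _ {A : Set} (_≟_ : DecidableEquality A) where

  private
    ∑-absent : ∀ {c} xs (f : A → ℕ) → c ∉ xs → ∑ xs (λ x → 𝟙 (x ≟ c) *ℕ f x) ≡ 0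
    ∑-absent         []       f c∉ = refl
    ∑-absent {c = c} (x ∷ xs) f c∉
      rewrite 𝟙-false (x ≟ c) (λ x≡c → c∉ (here (sym x≡c))) = ∑-absent xs f (c∉ ∘ there)

    ∑-present : ∀ {c xs} (f : A → ℕ) → Unique xs → c ∈ xs → ∑ xs (λ x → 𝟙 (x ≟ c) *ℕ f x) ≡ f c
    ∑-present {xs = x ∷ xs} f (x∉ ∷ _) (here refl) rewrite 𝟙-true (x ≟ x) refl =
      trans (cong₂ _+ℕ_ (ℕₚ.+-identityʳ (f x)) (∑-absent xs f λ x∈ → All.lookup x∉ x∈ refl))
            (ℕₚ.+-identityʳ (f x))
    ∑-present {c} {x ∷ xs} f (x∉ ∷ u) (there c∈)
      rewrite 𝟙-false (x ≟ c) (All.lookup x∉ c∈) = ∑-present f u c∈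

  -- Used to eliminate a summation variable that an equation determines, and, read backwards, to
  -- introduce one.
  ∑-select : ∀ (X : Enumeration A) c (f : A → ℕ) → ∑ (list X) (λ x → 𝟙 (x ≟ c) *ℕ f x) ≡ f c
  ∑-select X c f = ∑-present f (list-unique X) (list-complete X c)

  ∑-𝟙 : ∀ (X : Enumeration A) c → ∑ (list X) (λ x → 𝟙 (x ≟ c)) ≡ 1
  ∑-𝟙 X c = trans (∑-cong (list X) (λ x → sym (ℕₚ.*-identityʳ _))) (∑-select X c (λ _ → 1))

-- Binomial coefficients modulo a prime.

prime∤! : ∀ {p} → Prime p → ∀ {k} → k <ℕ p → ¬ (p ∣ k !)
prime∤! p-prime {zero}  k<p p∣1 with refl ← ∣1⇒≡1 p∣1 = ¬prime[1] p-prime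
prime∤! p-prime {suc k} k<p p∣k! with euclidsLemma (suc k) (k !) p-prime p∣k!
... | inj₁ p∣1+k = ℕₚ.<⇒≱ k<p (∣⇒≤ p∣1+k)
... | inj₂ p∣k!′ = prime∤! p-prime (ℕₚ.<-trans (ℕₚ.n<1+n k) k<p) p∣k!′

-- The prime divides p! = C(p, k) k! (p - k)!, but neither of the two factorials on the right, both
-- being of numbers below p.
prime∣C : ∀ {p} → Prime p → ∀ {k} → 0 <ℕ k → k <ℕ p → p ∣ p C k
prime∣C {suc p} p-prime {k} 0<k k<p with euclidsLemma (suc p C k) (k ! *ℕ (suc p ∸ℕ k) !) p-prime p∣product
  where
  instance
    k!l!≢0 : NonZero (k ! *ℕ (suc p ∸ℕ k) !)
    k!l!≢0 = ℕₚ.m*n≢0 _ _ {{ℕₚ._!≢0 k}} {{ℕₚ._!≢0 (suc p ∸ℕ k)}}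
  C*k!l!≡p! : (suc p C k) *ℕ (k ! *ℕ (suc p ∸ℕ k) !) ≡ suc p !
  C*k!l!≡p! = trans (cong (_*ℕ (k ! *ℕ (suc p ∸ℕ k) !)) (nCk≡n!/k![n-k]! (ℕₚ.<⇒≤ k<p)))
                    (m/n*n≡m (k![n∸k]!∣n! (ℕₚ.<⇒≤ k<p)))
  p∣product : suc p ∣ (suc p C k) *ℕ (k ! *ℕ (suc p ∸ℕ k) !)
  p∣product = subst (suc p ∣_) (sym C*k!l!≡p!) (m∣m*n (p !))
... | inj₁ p∣C = p∣C
... | inj₂ p∣k!l! with euclidsLemma (k !) ((suc p ∸ℕ k) !) p-prime p∣k!l!
...   | inj₁ p∣k! = ⊥-elim (prime∤! p-prime k<p p∣k!)
...   | inj₂ p∣l! = ⊥-elim (prime∤! p-prime (ℕₚ.∸-monoʳ-< 0<k (ℕₚ.<⇒≤ k<p)) p∣l!)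

unique∧set⇒↭ : {A : Set} {xs ys : List A} → Unique xs → Unique ys →
               (∀ {x} → x ∈ xs → x ∈ ys) → (∀ {x} → x ∈ ys → x ∈ xs) → xs ↭ ys
unique∧set⇒↭ xs! ys! xs⊆ys ys⊆xs = ∼bag⇒↭ (unique∧set⇒bag xs! ys! (mk⇔ xs⊆ys ys⊆xs))

-- Arithmetic of finite fields: polynomial identities, Fermat, Frobenius.

module FieldProperties (F : FiniteField) where
  open FF F
  open IsCommutativeRing isCommutativeRing
    using (+-comm; +-assoc; *-comm; *-assoc; +-identityˡ; +-identityʳ; *-identityˡ; *-identityʳ;
           distribˡ; distribʳ; zeroˡ; zeroʳ; -‿inverseˡ; -‿inverseʳ) public

  commutativeRing : CommutativeRing 0ℓ 0ℓ
  commutativeRing = record { isCommutativeRing = isCommutativeRing }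

  private
    module CR = CommutativeRing commutativeRing
    module RP = Algebra.Properties.Ring CR.ring

  fieldEnumeration : Enumeration Carrier
  fieldEnumeration = record { list = elements ; list-complete = complete ; list-unique = unique }

  fromℕ-+ : ∀ m n → fromℕ (m +ℕ n) ≡ fromℕ m + fromℕ n
  fromℕ-+ zero    n = sym (+-identityˡ _)
  fromℕ-+ (suc m) n = trans (cong (1# +_) (fromℕ-+ m n)) (sym (+-assoc 1# _ _))

  fromℕ-* : ∀ m n → fromℕ (m *ℕ n) ≡ fromℕ m * fromℕ n
  fromℕ-* zero    n = sym (zeroˡ _)
  fromℕ-* (suc m) n = begin
    fromℕ (n +ℕ m *ℕ n)               ≡⟨ fromℕ-+ n (m *ℕ n) ⟩
    fromℕ n + fromℕ (m *ℕ n)          ≡⟨ cong₂ _+_ (sym (*-identityˡ _)) (fromℕ-* m n) ⟩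
    1# * fromℕ n + fromℕ m * fromℕ n  ≡⟨ distribʳ _ _ _ ⟨
    (1# + fromℕ m) * fromℕ n          ∎
    where open ≡-Reasoning

  fromℤ : ℤ → Carrier
  fromℤ (ℤ.+ n)    = fromℕ n
  fromℤ -[1+ n ] = - fromℕ (suc n)

  private
    fromℤ-neg : ∀ i → fromℤ (ℤ.- i) ≡ - fromℤ i
    fromℤ-neg (ℤ.+ zero)  = sym RP.-0#≈0#
    fromℤ-neg (ℤ.+ suc n) = refl
    fromℤ-neg -[1+ n ]  = sym (RP.-‿involutive _)

    fromℤ-⊖ : ∀ m n → fromℤ (m ℤ.⊖ n) ≡ fromℕ m - fromℕ n
    fromℤ-⊖ zero    zero    = sym (trans (+-identityˡ _) RP.-0#≈0#)
    fromℤ-⊖ zero    (suc n) = sym (+-identityˡ _)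
    fromℤ-⊖ (suc m) zero    = sym (trans (cong (fromℕ (suc m) +_) RP.-0#≈0#) (+-identityʳ _))
    fromℤ-⊖ (suc m) (suc n) = begin
      fromℤ (suc m ℤ.⊖ suc n)                      ≡⟨ cong fromℤ (ℤₚ.[1+m]⊖[1+n]≡m⊖n m n) ⟩
      fromℤ (m ℤ.⊖ n)                              ≡⟨ fromℤ-⊖ m n ⟩
      fromℕ m - fromℕ n                            ≡⟨ cong (_- fromℕ n) (+-identityˡ _) ⟨
      0# + fromℕ m - fromℕ n                       ≡⟨ cong (λ z → z + fromℕ m - fromℕ n) (-‿inverseʳ 1#) ⟨
      1# - 1# + fromℕ m - fromℕ n                  ≡⟨ cong (_- fromℕ n) (trans (+-assoc 1# _ _) (trans (cong (1# +_) (+-comm _ _)) (sym (+-assoc 1# _ _)))) ⟩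
      1# + fromℕ m + (- 1#) - fromℕ n              ≡⟨ +-assoc _ _ _ ⟩
      1# + fromℕ m + (- 1# - fromℕ n)              ≡⟨ cong (1# + fromℕ m +_) (RP.-‿+-comm 1# (fromℕ n)) ⟩
      1# + fromℕ m - (1# + fromℕ n)                ∎
      where open ≡-Reasoning

    fromℤ-+ : ∀ i j → fromℤ (i ℤ.+ j) ≡ fromℤ i + fromℤ j
    fromℤ-+ (ℤ.+ m)    (ℤ.+ n)    = fromℕ-+ m n
    fromℤ-+ (ℤ.+ m)    -[1+ n ] = fromℤ-⊖ m (suc n)
    fromℤ-+ -[1+ m ] (ℤ.+ n)    = trans (fromℤ-⊖ n (suc m)) (+-comm _ _)
    fromℤ-+ -[1+ m ] -[1+ n ] = trans
      (cong (λ k → - fromℕ k) (cong suc (sym (ℕₚ.+-suc m n))))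
      (trans (cong -_ (fromℕ-+ (suc m) (suc n))) (sym (RP.-‿+-comm _ _)))

    fromℤ-*-pos : ∀ m j → fromℤ (ℤ.+ m ℤ.* j) ≡ fromℕ m * fromℤ j
    fromℤ-*-pos m (ℤ.+ n) = trans (cong fromℤ (sym (ℤₚ.pos-* m n))) (fromℕ-* m n)
    fromℤ-*-pos m -[1+ n ] = begin
      fromℤ (ℤ.+ m ℤ.* -[1+ n ])       ≡⟨ cong fromℤ (ℤₚ.neg-distribʳ-* (ℤ.+ m) (ℤ.+ suc n)) ⟨
      fromℤ (ℤ.- (ℤ.+ m ℤ.* ℤ.+ suc n))  ≡⟨ fromℤ-neg (ℤ.+ m ℤ.* ℤ.+ suc n) ⟩
      - fromℤ (ℤ.+ m ℤ.* ℤ.+ suc n)      ≡⟨ cong -_ (fromℤ-*-pos m (ℤ.+ suc n)) ⟩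
      - (fromℕ m * fromℕ (suc n))    ≡⟨ RP.-‿distribʳ-* _ _ ⟩
      fromℕ m * - fromℕ (suc n)      ∎
      where open ≡-Reasoning
    fromℤ-* : ∀ i j → fromℤ (i ℤ.* j) ≡ fromℤ i * fromℤ j
    fromℤ-* (ℤ.+ m)  j = fromℤ-*-pos m j
    fromℤ-* -[1+ m ] j = begin
      fromℤ (-[1+ m ] ℤ.* j)         ≡⟨ cong fromℤ (ℤₚ.neg-distribˡ-* (ℤ.+ suc m) j) ⟨
      fromℤ (ℤ.- (ℤ.+ suc m ℤ.* j))    ≡⟨ fromℤ-neg (ℤ.+ suc m ℤ.* j) ⟩
      - fromℤ (ℤ.+ suc m ℤ.* j)        ≡⟨ cong -_ (fromℤ-*-pos (suc m) j) ⟩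
      - (fromℕ (suc m) * fromℤ j)    ≡⟨ RP.-‿distribˡ-* _ _ ⟩
      - fromℕ (suc m) * fromℤ j      ∎
      where open ≡-Reasoning

    -- Integer coefficients let normal forms be compared by computation, whereas the elements of the
    -- field are abstract.
    coefficientRing : RawRing 0ℓ 0ℓ
    coefficientRing = CommutativeRing.rawRing ℤₚ.+-*-commutativeRing

    almostCommutativeRing : AlmostCommutativeRing 0ℓ 0ℓ
    almostCommutativeRing = fromCommutativeRing commutativeRing

    fromℤ-homomorphism : coefficientRing -Raw-AlmostCommutative⟶ almostCommutativeRing
    fromℤ-homomorphism = record
      { ⟦_⟧    = fromℤ
      ; +-homo = fromℤ-+
      ; *-homo = fromℤ-*
      ; -‿homo = fromℤ-neg
      ; 0-homo = refl
      ; 1-homo = +-identityʳ 1#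
      }

    coefficientEquality : ∀ i j → Maybe (fromℤ i ≡ fromℤ j)
    coefficientEquality i j with i ℤ.≟ j
    ... | yes i≡j = just (cong fromℤ i≡j)
    ... | no  _   = nothing

  open Algebra.Solver.Ring coefficientRing almostCommutativeRing fromℤ-homomorphism coefficientEquality public
    using (solve; Polynomial; _:=_; _:+_; _:*_; _:-_; _:^_; :-_; con)

  -- Denotes 1# itself, whereas con (ℤ.+ 1) denotes 1# + 0#.
  :1 : ∀ {n} → Polynomial n
  :1 = con (ℤ.+ 0) :^ 0


  inv : ∀ {x} → x ≢ 0# → Carrier
  inv {x} x≢0 = proj₁ (inverse x x≢0)

  *-invʳ : ∀ {x} (x≢0 : x ≢ 0#) → x * inv x≢0 ≡ 1#
  *-invʳ {x} x≢0 = proj₂ (inverse x x≢0)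

  *-invˡ : ∀ {x} (x≢0 : x ≢ 0#) → inv x≢0 * x ≡ 1#
  *-invˡ x≢0 = trans (*-comm _ _) (*-invʳ x≢0)

  *-cancelˡ : ∀ {x y z} → x ≢ 0# → x * y ≡ x * z → y ≡ z
  *-cancelˡ {x} {y} {z} x≢0 xy≡xz = begin
    y                    ≡⟨ *-identityˡ y ⟨
    1# * y               ≡⟨ cong (_* y) (*-invˡ x≢0) ⟨
    inv x≢0 * x * y      ≡⟨ *-assoc _ _ _ ⟩
    inv x≢0 * (x * y)    ≡⟨ cong (inv x≢0 *_) xy≡xz ⟩
    inv x≢0 * (x * z)    ≡⟨ *-assoc _ _ _ ⟨
    inv x≢0 * x * z      ≡⟨ cong (_* z) (*-invˡ x≢0) ⟩
    1# * z               ≡⟨ *-identityˡ z ⟩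
    z                    ∎
    where open ≡-Reasoning

  *-zero-divisor : ∀ {x y} → x ≢ 0# → x * y ≡ 0# → y ≡ 0#
  *-zero-divisor {x} x≢0 xy≡0 = *-cancelˡ x≢0 (trans xy≡0 (sym (zeroʳ x)))

  *-≢0 : ∀ {x y} → x ≢ 0# → y ≢ 0# → x * y ≢ 0#
  *-≢0 x≢0 y≢0 xy≡0 = y≢0 (*-zero-divisor x≢0 xy≡0)

  +-cancelʳ : ∀ x y z → x + z ≡ y + z → x ≡ y
  +-cancelʳ x y z = RP.+-cancelʳ z x y

  x-y≡0⇒x≡y : ∀ {x y} → x - y ≡ 0# → x ≡ y
  x-y≡0⇒x≡y {x} {y} = RP.x∙y⁻¹≈ε⇒x≈y x y

  x≡y⇒x-y≡0 : ∀ {x y} → x ≡ y → x - y ≡ 0#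
  x≡y⇒x-y≡0 {x} refl = -‿inverseʳ x

  ∑-shift : ∀ c (f : Carrier → ℕ) → ∑ elements f ≡ ∑ elements (λ x → f (x + c))
  ∑-shift c = ∑-bijection fieldEnumeration fieldEnumeration (_+ c) (_- c)
    (λ x → solve 2 (λ x c → x :- c :+ c := x) refl x c)
    (λ x → solve 2 (λ x c → x :+ c :- c := x) refl x c)

  ∑-reflect : ∀ c (f : Carrier → ℕ) → ∑ elements f ≡ ∑ elements (λ x → f (c - x))
  ∑-reflect c = ∑-bijection fieldEnumeration fieldEnumeration (λ x → c - x) (λ x → c - x) c-[c-x]≡x c-[c-x]≡x
    where
    c-[c-x]≡x : ∀ x → c - (c - x) ≡ x
    c-[c-x]≡x x = solve 2 (λ x c → c :- (c :- x) := x) refl x c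

  ∑-affine : ∀ {c} → c ≢ 0# → ∀ d (f : Carrier → ℕ) → ∑ elements f ≡ ∑ elements (λ x → f (c * x + d))
  ∑-affine {c} c≢0 d = ∑-bijection fieldEnumeration fieldEnumeration (λ x → c * x + d) (λ y → inv c≢0 * (y - d))
    (λ y → trans (solve 4 (λ c i y d → c :* (i :* (y :- d)) :+ d := c :* i :* (y :- d) :+ d) refl c (inv c≢0) y d)
           (trans (cong (λ z → z * (y - d) + d) (*-invʳ c≢0))
                  (solve 2 (λ y d → :1 :* (y :- d) :+ d := y) refl y d)))
    (λ x → trans (solve 4 (λ c i x d → i :* (c :* x :+ d :- d) := i :* c :* x) refl c (inv c≢0) x d)
           (trans (cong (_* x) (*-invˡ c≢0)) (*-identityˡ x)))

  private
    module Exp = Algebra.Properties.CommutativeSemiring.Exp CR.commutativeSemiring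

    ^≡Exp : ∀ x n → x ^ n ≡ x Exp.^ n
    ^≡Exp x zero    = refl
    ^≡Exp x (suc n) = cong (x *_) (^≡Exp x n)

  ^-+ : ∀ x m n → x ^ (m +ℕ n) ≡ x ^ m * x ^ n
  ^-+ x m n rewrite ^≡Exp x (m +ℕ n) | ^≡Exp x m | ^≡Exp x n = Exp.^-homo-* x m n

  ^-* : ∀ x m n → x ^ (m *ℕ n) ≡ (x ^ m) ^ n
  ^-* x m n rewrite ^≡Exp x (m *ℕ n) | ^≡Exp x m | ^≡Exp (x Exp.^ m) n = sym (Exp.^-assocʳ x m n)

  *-^ : ∀ x y n → (x * y) ^ n ≡ x ^ n * y ^ n
  *-^ x y n rewrite ^≡Exp (x * y) n | ^≡Exp x n | ^≡Exp y n = Exp.^-distrib-* x y n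

  x^n≡0⇒x≡0 : ∀ x n → x ^ n ≡ 0# → x ≡ 0#
  x^n≡0⇒x≡0 x zero    1≡0 = ⊥-elim (0≢1 (sym 1≡0))
  x^n≡0⇒x≡0 x (suc n) x^n≡0 with x ≟ 0#
  ... | yes x≡0 = x≡0
  ... | no  x≢0 = x^n≡0⇒x≡0 x n (*-zero-divisor x≢0 x^n≡0)

  fromℕ-^ : ∀ m n → fromℕ (m ^ℕ n) ≡ fromℕ m ^ n
  fromℕ-^ m zero    = +-identityʳ 1#
  fromℕ-^ m (suc n) = trans (fromℕ-* m (m ^ℕ n)) (cong (fromℕ m *_) (fromℕ-^ m n))

  private
    sumF productF : List Carrier → Carrier
    sumF     = foldr _+_ 0#
    productF = foldr _*_ 1#

    sumF-↭ : ∀ {xs ys} → xs ↭ ys → sumF xs ≡ sumF ys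
    sumF-↭ p = foldr-commMonoid CR.setoid CR.+-isCommutativeMonoid (↭⇒↭ₛ p)

    productF-↭ : ∀ {xs ys} → xs ↭ ys → productF xs ≡ productF ys
    productF-↭ p = foldr-commMonoid CR.setoid CR.*-isCommutativeMonoid (↭⇒↭ₛ p)

    sumF-translate : ∀ g xs → sumF (map (g +_) xs) ≡ fromℕ (length xs) * g + sumF xs
    sumF-translate g []       = solve 1 (λ g → con (ℤ.+ 0) := con (ℤ.+ 0) :* g :+ con (ℤ.+ 0)) refl g
    sumF-translate g (x ∷ xs) rewrite sumF-translate g xs =
      solve 4 (λ g x n s → (g :+ x) :+ (n :* g :+ s) := (:1 :+ n) :* g :+ (x :+ s)) refl g x (fromℕ (length xs)) (sumF xs)

    productF-scale : ∀ g xs → productF (map (g *_) xs) ≡ g ^ length xs * productF xs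
    productF-scale g []       = sym (*-identityˡ 1#)
    productF-scale g (x ∷ xs) rewrite productF-scale g xs =
      solve 4 (λ g x n s → (g :* x) :* (n :* s) := (g :* n) :* (x :* s)) refl g x (g ^ length xs) (productF xs)

    productF-≢0 : ∀ xs → (∀ {x} → x ∈ xs → x ≢ 0#) → productF xs ≢ 0#
    productF-≢0 []       _     = λ 1≡0 → 0≢1 (sym 1≡0)
    productF-≢0 (x ∷ xs) xs≢0 = *-≢0 (xs≢0 (here refl)) (productF-≢0 xs (xs≢0 ∘ there))

  -- Adding 1 to every element permutes the field, yet changes the sum of all elements by `order`
  -- times 1.
  order·1≡0 : fromℕ order ≡ 0#
  order·1≡0 = +-cancelʳ _ 0# (sumF elements) (begin
    fromℕ order + sumF elements                ≡⟨ cong (_+ sumF elements) (sym (trans (*-comm _ _) (*-identityˡ _))) ⟩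
    fromℕ order * 1# + sumF elements           ≡⟨ sumF-translate 1# elements ⟨
    sumF (map (1# +_) elements)                ≡⟨ sumF-↭ translate-↭ ⟩
    sumF elements                              ≡⟨ +-identityˡ _ ⟨
    0# + sumF elements                         ∎)
    where
    open ≡-Reasoning
    translate-↭ : map (1# +_) elements ↭ elements
    translate-↭ = map-bijection-↭ fieldEnumeration fieldEnumeration (1# +_) (_- 1#)
      (solve 1 (λ x → :1 :+ (x :- :1) := x) refl) (solve 1 (λ x → :1 :+ x :- :1 := x) refl)

  -- Multiplication by a nonzero x permutes the units, so their product is unchanged by the factor x
  -- to the number of units. Writing `order` as one more than that number also covers x = 0.
  x^order≡x : ∀ x → x ^ order ≡ x
  x^order≡x x = trans (cong (x ^_) (↭-length elements-↭)) x^[1+∣units∣]≡x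
    where
    open ≡-Reasoning
    units : List Carrier
    units = filter (λ y → ¬? (y ≟ 0#)) elements

    units-≢0 : ∀ {y} → y ∈ units → y ≢ 0#
    units-≢0 y∈ = proj₂ (∈-filter⁻ (λ y → ¬? (y ≟ 0#)) {xs = elements} y∈)

    ≢0-units : ∀ {y} → y ≢ 0# → y ∈ units
    ≢0-units y≢0 = ∈-filter⁺ (λ y → ¬? (y ≟ 0#)) (complete _) y≢0

    units! : Unique units
    units! = Unique.filter⁺ (λ y → ¬? (y ≟ 0#)) unique

    elements-↭ : elements ↭ 0# ∷ units
    elements-↭ = unique∧set⇒↭ unique (All.tabulate (λ y∈ 0≡y → units-≢0 y∈ (sym 0≡y)) ∷ units!)
      (λ {y} _ → member y) (λ _ → complete _)
      where
      member : ∀ y → y ∈ 0# ∷ units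
      member y with y ≟ 0#
      ... | yes y≡0 = here y≡0
      ... | no  y≢0 = there (≢0-units y≢0)

    x^[1+∣units∣]≡x : x ^ suc (length units) ≡ x
    x^[1+∣units∣]≡x with x ≟ 0#
    ... | yes x≡0 = trans (cong (_* (x ^ length units)) x≡0) (trans (zeroˡ _) (sym x≡0))
    ... | no  x≢0 = trans (cong (x *_) x^∣units∣≡1) (trans (*-comm x 1#) (*-identityˡ x))
      where
      scale-↭ : map (x *_) units ↭ units
      scale-↭ = unique∧set⇒↭ (Unique.map⁺ (*-cancelˡ x≢0) units!) units!
        (λ z∈ → let y , y∈ , z≡xy = ∈-map⁻ (x *_) z∈ in
                subst (_∈ units) (sym z≡xy) (≢0-units (*-≢0 x≢0 (units-≢0 y∈))))
        (λ {z} z∈ → subst (_∈ map (x *_) units) (x*x⁻¹*z z)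
          (∈-map⁺ (x *_) (≢0-units λ x⁻¹z≡0 → units-≢0 z∈
            (trans (sym (x*x⁻¹*z z)) (trans (cong (x *_) x⁻¹z≡0) (zeroʳ x))))))
        where
        x*x⁻¹*z : ∀ z → x * (inv x≢0 * z) ≡ z
        x*x⁻¹*z z = trans (sym (*-assoc _ _ _)) (trans (cong (_* z) (*-invʳ x≢0)) (*-identityˡ z))

      x^∣units∣≡1 : x ^ length units ≡ 1#
      x^∣units∣≡1 = *-cancelˡ (productF-≢0 units units-≢0) (begin
        productF units * x ^ length units  ≡⟨ *-comm _ _ ⟩
        x ^ length units * productF units  ≡⟨ productF-scale x units ⟨
        productF (map (x *_) units)        ≡⟨ productF-↭ scale-↭ ⟩
        productF units                     ≡⟨ *-identityˡ _ ⟨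
        1# * productF units                ≡⟨ *-comm _ _ ⟩
        productF units * 1#                ∎)

  order-positive : 0 <ℕ order
  order-positive with elements | complete 0#
  ... | _ ∷ _ | _ = s≤s z≤n

  -- The power p^m vanishes in the field by `order·1≡0`, and a field has no nonzero nilpotents.
  characteristic : ∀ {p m} → order ≡ p ^ℕ m → fromℕ p ≡ 0#
  characteristic {p} {m} order≡p^m = x^n≡0⇒x≡0 (fromℕ p) m
    (trans (sym (fromℕ-^ p m)) (trans (cong fromℕ (sym order≡p^m)) order·1≡0))

  -- Write p = 1 + 2 (p / 2): if 2 vanished as well, then 1 would be 0.
  odd-characteristic : ∀ {p} → p % 2 ≡ 1 → fromℕ p ≡ 0# → fromℕ 2 ≢ 0#
  odd-characteristic {p} p-odd p≡0 2≡0 = 0≢1 (begin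
    0#                                     ≡⟨ p≡0 ⟨
    fromℕ p                                ≡⟨ cong fromℕ (m≡m%n+[m/n]*n p 2) ⟩
    fromℕ (p % 2 +ℕ p / 2 *ℕ 2)            ≡⟨ cong (λ z → fromℕ (z +ℕ p / 2 *ℕ 2)) p-odd ⟩
    1# + fromℕ (p / 2 *ℕ 2)                ≡⟨ cong (1# +_) (fromℕ-* (p / 2) 2) ⟩
    1# + fromℕ (p / 2) * fromℕ 2           ≡⟨ cong (λ z → 1# + fromℕ (p / 2) * z) 2≡0 ⟩
    1# + fromℕ (p / 2) * 0#                ≡⟨ solve 1 (λ x → :1 :+ x :* con (ℤ.+ 0) := :1) refl (fromℕ (p / 2)) ⟩
    1#                                     ∎)
    where open ≡-Reasoning

  private
    module Mult = Algebra.Properties.Semiring.Mult CR.semiring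
    module FinSum = Algebra.Properties.Semiring.Sum CR.semiring

    ×≡fromℕ* : ∀ n x → n Mult.× x ≡ fromℕ n * x
    ×≡fromℕ* zero    x = sym (zeroˡ x)
    ×≡fromℕ* (suc n) x = begin
      x + n Mult.× x           ≡⟨ cong₂ _+_ (sym (*-identityˡ x)) (×≡fromℕ* n x) ⟩
      1# * x + fromℕ n * x     ≡⟨ distribʳ x 1# (fromℕ n) ⟨
      (1# + fromℕ n) * x       ∎
      where open ≡-Reasoning

    p∣n⇒n×x≡0 : ∀ {p n} → fromℕ p ≡ 0# → ∀ x → p ∣ n → n Mult.× x ≡ 0#
    p∣n⇒n×x≡0 {p} {n} p≡0 x (divides k refl) = begin
      (k *ℕ p) Mult.× x         ≡⟨ ×≡fromℕ* (k *ℕ p) x ⟩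
      fromℕ (k *ℕ p) * x        ≡⟨ cong (_* x) (fromℕ-* k p) ⟩
      fromℕ k * fromℕ p * x     ≡⟨ cong (λ z → fromℕ k * z * x) p≡0 ⟩
      fromℕ k * 0# * x          ≡⟨ solve 2 (λ k x → k :* con (ℤ.+ 0) :* x := con (ℤ.+ 0)) refl (fromℕ k) x ⟩
      0#                        ∎
      where open ≡-Reasoning

  -- All terms of the binomial expansion but the two outer ones have a coefficient divisible by p.
  -- The terms are indexed by the power of x, so the first is y^p and the last is x^p.
  frobenius-+ : ∀ {p} → Prime p → fromℕ p ≡ 0# → ∀ x y → (x + y) ^ p ≡ x ^ p + y ^ p
  frobenius-+ {zero}   0-prime _   x y = ⊥-elim (¬prime[0] 0-prime)
  frobenius-+ {suc p′} p-prime p≡0 x y = begin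
    (x + y) ^ n                                          ≡⟨ ^≡Exp (x + y) n ⟩
    (x + y) Exp.^ n                                      ≡⟨ Binomial.theorem n x y ⟩
    FinSum.sum t                                            ≡⟨ cong (t fzero +_) (FinSum.sum-init-last (t ∘ fsuc)) ⟩
    t fzero + (FinSum.sum middle + t (fsuc (Fin.fromℕ p′))) ≡⟨ cong₂ _+_ first (cong₂ _+_ middle-vanishes last) ⟩
    y Exp.^ n + (0# + x Exp.^ n)                         ≡⟨ trans (cong (y Exp.^ n +_) (+-identityˡ _)) (+-comm _ _) ⟩
    x Exp.^ n + y Exp.^ n                                ≡⟨ cong₂ _+_ (^≡Exp x n) (^≡Exp y n) ⟨
    x ^ n + y ^ n                                        ∎
    where
    open ≡-Reasoning
    module Binomial = Algebra.Properties.CommutativeSemiring.Binomial CR.commutativeSemiring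
    n = suc p′
    t : Fin (suc n) → Carrier
    t = Binomial.binomialTerm x y n
    middle : Fin p′ → Carrier
    middle i = t (fsuc (Fin.inject₁ i))
    first : t fzero ≡ y Exp.^ n
    first = trans (+-identityʳ _) (*-identityˡ _)
    middle-vanishes : FinSum.sum middle ≡ 0#
    middle-vanishes = trans
      (FinSum.sum-cong-≗ λ i → p∣n⇒n×x≡0 p≡0 _ (prime∣C p-prime (s≤s z≤n)
        (s≤s (subst (_<ℕ p′) (sym (Finₚ.toℕ-inject₁ i)) (Finₚ.toℕ<n i)))))
      (FinSum.sum-replicate-zero p′)
    last : t (fsuc (Fin.fromℕ p′)) ≡ x Exp.^ n
    last rewrite Finₚ.toℕ-fromℕ p′ | nCn≡1 n | ℕₚ.n∸n≡0 p′ =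
      trans (+-identityʳ _) (trans (*-comm _ _) (*-identityˡ _))

  frobenius-iterate-+ : ∀ {p} → Prime p → fromℕ p ≡ 0# → ∀ k x y → (x + y) ^ (p ^ℕ k) ≡ x ^ (p ^ℕ k) + y ^ (p ^ℕ k)
  frobenius-iterate-+ _ _ zero x y = solve 2 (λ x y → (x :+ y) :* :1 := x :* :1 :+ y :* :1) refl x y
  frobenius-iterate-+ {p} p-prime p≡0 (suc k) x y = begin
    (x + y) ^ (p *ℕ p ^ℕ k)                    ≡⟨ ^-* (x + y) p (p ^ℕ k) ⟩
    ((x + y) ^ p) ^ (p ^ℕ k)                   ≡⟨ cong (_^ (p ^ℕ k)) (frobenius-+ p-prime p≡0 x y) ⟩
    (x ^ p + y ^ p) ^ (p ^ℕ k)                 ≡⟨ frobenius-iterate-+ p-prime p≡0 k (x ^ p) (y ^ p) ⟩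
    (x ^ p) ^ (p ^ℕ k) + (y ^ p) ^ (p ^ℕ k)    ≡⟨ cong₂ _+_ (^-* x p (p ^ℕ k)) (^-* y p (p ^ℕ k)) ⟨
    x ^ (p *ℕ p ^ℕ k) + y ^ (p *ℕ p ^ℕ k)      ∎
    where open ≡-Reasoning

-- Sums of squares over a finite field of odd characteristic.

𝟙-positive : {P : Set} (d : Dec P) → 0 <ℕ 𝟙 d → P
𝟙-positive (yes p) _ = p

∑-∣ : {A : Set} (xs : List A) {d : ℕ} {f : A → ℕ} → (∀ x → d ∣ f x) → d ∣ ∑ xs f
∑-∣ []       d∣f = divides 0 refl
∑-∣ (x ∷ xs) d∣f = ∣m∣n⇒∣m+n (d∣f x) (∑-∣ xs d∣f)

-- The counts are proved in ℕ with every subtracted term moved across. This is the passage to ℤ for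
-- ε = 1; the factor 1 is kept to fit the formula with a general sign ε.
shifted-difference : ∀ a b c d → a +ℕ c ≡ d +ℕ b →
  ℤ.+ a ≡ ℤ.+ d ℤ.+ ℤ.1ℤ ℤ.* (ℤ.+ b ℤ.- ℤ.+ c)
shifted-difference a b c d eq = trans (lemma₁ (ℤ.+ a) (ℤ.+ c))
  (trans (cong (ℤ._- ℤ.+ c) (cong ℤ.+_ eq)) (lemma₂ (ℤ.+ d) (ℤ.+ b) (ℤ.+ c)))
  where
  lemma₁ : ∀ a c → a ≡ a ℤ.+ c ℤ.- c
  lemma₁ = ℤ-solve-∀
  lemma₂ : ∀ d b c → d ℤ.+ b ℤ.- c ≡ d ℤ.+ ℤ.1ℤ ℤ.* (b ℤ.- c)
  lemma₂ = ℤ-solve-∀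

-- The same passage for ε = -1, where b and c change sides.
shifted-difference⁻ : ∀ a b c d → a +ℕ b ≡ d +ℕ c →
  ℤ.+ a ≡ ℤ.+ d ℤ.+ ℤ.-1ℤ ℤ.* (ℤ.+ b ℤ.- ℤ.+ c)
shifted-difference⁻ a b c d eq =
  trans (shifted-difference a c b d eq) (lemma (ℤ.+ d) (ℤ.+ b) (ℤ.+ c))
  where
  lemma : ∀ d b c → d ℤ.+ ℤ.1ℤ ℤ.* (c ℤ.- b) ≡ d ℤ.+ ℤ.-1ℤ ℤ.* (b ℤ.- c)
  lemma = ℤ-solve-∀

𝟙≤1 : {P : Set} (d : Dec P) → 𝟙 d ≤ℕ 1
𝟙≤1 (yes _) = s≤s z≤n
𝟙≤1 (no _)  = z≤n

module SumsOfSquares (K : FiniteField) (2≢0 : FF.fromℕ K 2 ≢ FF.0# K) where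
  open FF K
  open FieldProperties K

  -- Groups the x by the value s = φ x. With φ the squaring map, the fibre sizes are the numbers
  -- `sqrts s`.
  ∑-fibres : (φ : Carrier → Carrier) (g : Carrier → ℕ) →
    ∑ elements (λ x → g (φ x)) ≡ ∑ elements (λ s → ∑ elements (λ x → 𝟙 (s ≟ φ x)) *ℕ g s)
  ∑-fibres φ g = begin
    ∑ elements (λ x → g (φ x))
      ≡⟨ ∑-cong elements (λ x → sym (∑-select _≟_ fieldEnumeration (φ x) g)) ⟩
    ∑ elements (λ x → ∑ elements (λ s → 𝟙 (s ≟ φ x) *ℕ g s))
      ≡⟨ ∑-swap elements elements _ ⟩
    ∑ elements (λ s → ∑ elements (λ x → 𝟙 (s ≟ φ x) *ℕ g s))
      ≡⟨ ∑-cong elements (λ s → ∑-*ʳ elements (g s) _) ⟩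
    ∑ elements (λ s → ∑ elements (λ x → 𝟙 (s ≟ φ x)) *ℕ g s) ∎
    where open ≡-Reasoning

  ∑-1 : ∑ elements (λ _ → 1) ≡ order
  ∑-1 = trans (∑-const elements 1) (ℕₚ.*-identityʳ order)

  ∑-𝟙′ : ∀ c → ∑ elements (λ x → 𝟙 (c ≟ x)) ≡ 1
  ∑-𝟙′ c = trans (∑-cong elements (λ x → 𝟙-⇔ (c ≟ x) (x ≟ c) sym sym)) (∑-𝟙 _≟_ fieldEnumeration c)

  sqrts : Carrier → ℕ
  sqrts s = ∑ elements (λ x → 𝟙 (s ≟ (x * x)))

  ∑-sqrts : ∑ elements sqrts ≡ order
  ∑-sqrts = trans (∑-cong elements (λ s → sym (ℕₚ.*-identityʳ _)))
                  (trans (sym (∑-fibres (λ x → x * x) (λ _ → 1))) ∑-1)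

  x²≡y² : ∀ {x y} → x * x ≡ y * y → x ≡ y ⊎ x ≡ - y
  x²≡y² {x} {y} eq with (x - y) ≟ 0#
  ... | yes x-y≡0 = inj₁ (x-y≡0⇒x≡y x-y≡0)
  ... | no  x-y≢0 = inj₂ (x-y≡0⇒x≡y (trans (solve 2 (λ x y → x :- :- y := x :+ y) refl x y)
    (*-zero-divisor x-y≢0 (trans (solve 2 (λ x y → (x :- y) :* (x :+ y) := x :* x :- y :* y) refl x y) (x≡y⇒x-y≡0 eq)))))

  y≢-y : ∀ {y} → y ≢ 0# → y ≢ - y
  y≢-y {y} y≢0 y≡-y = *-≢0 2≢0 y≢0 (trans (solve 1 (λ y → con (ℤ.+ 2) :* y := y :- :- y) refl y) (x≡y⇒x-y≡0 y≡-y))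

  sqrts-0 : sqrts 0# ≡ 1
  sqrts-0 = trans (∑-cong elements (λ x → 𝟙-⇔ (0# ≟ (x * x)) (x ≟ 0#) (root x) (λ x≡0 → sym (trans (cong (_* x) x≡0) (zeroˡ x)))))
                  (∑-𝟙 _≟_ fieldEnumeration 0#)
    where
    root : ∀ x → 0# ≡ x * x → x ≡ 0#
    root x 0≡x² with x ≟ 0#
    ... | yes x≡0 = x≡0
    ... | no  x≢0 = *-zero-divisor x≢0 (sym 0≡x²)

  sqrts-square : ∀ {y} → y ≢ 0# → sqrts (y * y) ≡ 2
  sqrts-square {y} y≢0 = begin
    ∑ elements (λ x → 𝟙 ((y * y) ≟ (x * x)))              ≡⟨ ∑-cong elements two-roots ⟩
    ∑ elements (λ x → 𝟙 (x ≟ y) +ℕ 𝟙 (x ≟ (- y)))            ≡⟨ ∑-+ elements _ _ ⟩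
    ∑ elements (λ x → 𝟙 (x ≟ y)) +ℕ ∑ elements (λ x → 𝟙 (x ≟ (- y)))
      ≡⟨ cong₂ _+ℕ_ (∑-𝟙 _≟_ fieldEnumeration y) (∑-𝟙 _≟_ fieldEnumeration (- y)) ⟩
    2                                                      ∎
    where
    open ≡-Reasoning
    two-roots : ∀ x → 𝟙 ((y * y) ≟ (x * x)) ≡ 𝟙 (x ≟ y) +ℕ 𝟙 (x ≟ (- y))
    two-roots x with x ≟ y | x ≟ (- y)
    ... | yes x≡y  | yes x≡-y = ⊥-elim (y≢-y y≢0 (trans (sym x≡y) x≡-y))
    ... | yes refl | no _     = 𝟙-true ((x * x) ≟ (x * x)) refl
    ... | no _     | yes refl = 𝟙-true ((y * y) ≟ ((- y) * (- y))) (solve 1 (λ y → y :* y := :- y :* :- y) refl y)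
    ... | no x≢y   | no x≢-y  = 𝟙-false ((y * y) ≟ (x * x)) λ y²≡x² → case (x²≡y² (sym y²≡x²))
      where
      case : ¬ (x ≡ y ⊎ x ≡ - y)
      case (inj₁ x≡y)  = x≢y x≡y
      case (inj₂ x≡-y) = x≢-y x≡-y

  -- The three values of the quadratic character χ. Each case records the number 1 + χ(s) of square
  -- roots, and the square case also a root: the counts use the number, the existence arguments the
  -- root.
  data SquareClass (s : Carrier) : Set where
    isZero   : s ≡ 0# → sqrts s ≡ 1 → SquareClass s
    isSquare : ∀ y → y ≢ 0# → s ≡ y * y → sqrts s ≡ 2 → SquareClass s
    isNonsquare : sqrts s ≡ 0 → SquareClass s

  squareClass : ∀ s → SquareClass s
  squareClass s with sqrts s in eq
  ... | zero  = isNonsquare eq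
  ... | suc n with ∑-positive elements (subst (0 <ℕ_) (sym eq) (s≤s z≤n))
  ...   | y , 0<𝟙 with s≡y² ← 𝟙-positive (s ≟ (y * y)) 0<𝟙 | y ≟ 0#
  ...     | yes y≡0 = isZero s≡0 (trans (cong sqrts s≡0) sqrts-0)
    where
    s≡0 : s ≡ 0#
    s≡0 = trans s≡y² (trans (cong (_* y) y≡0) (zeroˡ y))
  ...     | no  y≢0 = isSquare y y≢0 s≡y² (trans (cong sqrts s≡y²) (sqrts-square y≢0))

  hyperbola : Carrier → ℕ
  hyperbola c = ∑ elements (λ x → sqrts (x * x + c))

  -- Factor y² - x² = c as u z = c with u = y - x and z = y + x. Each u ≠ 0 determines z, while u =
  -- 0 contributes the whole line if c = 0 and nothing otherwise. The 1 on the left stands for the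
  -- missing u = 0.
  hyperbola-count : ∀ c → hyperbola c +ℕ 1 ≡ order +ℕ order *ℕ 𝟙 (c ≟ 0#)
  hyperbola-count c = begin
    hyperbola c +ℕ 1
      ≡⟨ cong (_+ℕ 1) hyperbola≡ ⟩
    ∑ elements products +ℕ 1
      ≡⟨ cong (∑ elements products +ℕ_) (∑-𝟙 _≟_ fieldEnumeration 0#) ⟨
    ∑ elements products +ℕ ∑ elements (λ u → 𝟙 (u ≟ 0#))
      ≡⟨ ∑-+ elements _ _ ⟨
    ∑ elements (λ u → products u +ℕ 𝟙 (u ≟ 0#))
      ≡⟨ ∑-cong elements products-count ⟩
    ∑ elements (λ u → 1 +ℕ 𝟙 (u ≟ 0#) *ℕ (order *ℕ 𝟙 (c ≟ 0#)))
      ≡⟨ ∑-+ elements _ _ ⟩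
    ∑ elements (λ _ → 1) +ℕ ∑ elements (λ u → 𝟙 (u ≟ 0#) *ℕ (order *ℕ 𝟙 (c ≟ 0#)))
      ≡⟨ cong₂ _+ℕ_ ∑-1 (∑-select _≟_ fieldEnumeration 0# _) ⟩
    order +ℕ order *ℕ 𝟙 (c ≟ 0#) ∎
    where
    open ≡-Reasoning
    products : Carrier → ℕ
    products u = ∑ elements (λ z → 𝟙 (c ≟ (u * z)))

    hyperbola≡ : hyperbola c ≡ ∑ elements products
    hyperbola≡ = begin
      ∑ elements (λ x → ∑ elements (λ y → 𝟙 ((x * x + c) ≟ (y * y))))
        -- Replaces y by u + x, which makes the other factor y + x equal to 2 x + u.
        ≡⟨ ∑-cong elements (λ x → ∑-shift x _) ⟩
      ∑ elements (λ x → ∑ elements (λ u → 𝟙 ((x * x + c) ≟ ((u + x) * (u + x)))))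
        ≡⟨ ∑-cong elements (λ x → ∑-cong elements (factor x)) ⟩
      ∑ elements (λ x → ∑ elements (λ u → 𝟙 (c ≟ (u * (fromℕ 2 * x + u)))))
        ≡⟨ ∑-swap elements elements _ ⟩
      ∑ elements (λ u → ∑ elements (λ x → 𝟙 (c ≟ (u * (fromℕ 2 * x + u)))))
        -- For fixed u the factor 2 x + u runs once through the field, since 2 is invertible.
        ≡⟨ ∑-cong elements (λ u → ∑-affine 2≢0 u (λ z → 𝟙 (c ≟ (u * z)))) ⟨
      ∑ elements products ∎
      where
      factor : ∀ x u → 𝟙 ((x * x + c) ≟ ((u + x) * (u + x))) ≡ 𝟙 (c ≟ (u * (fromℕ 2 * x + u)))
      factor x u = 𝟙-⇔ ((x * x + c) ≟ ((u + x) * (u + x))) (c ≟ (u * (fromℕ 2 * x + u)))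
        (λ eq → x-y≡0⇒x≡y (trans difference (x≡y⇒x-y≡0 eq)))
        (λ eq → x-y≡0⇒x≡y (trans (sym difference) (x≡y⇒x-y≡0 eq)))
        where
        difference : c - u * (fromℕ 2 * x + u) ≡ x * x + c - (u + x) * (u + x)
        difference = solve 3 (λ c u x → c :- u :* (con (ℤ.+ 2) :* x :+ u) := x :* x :+ c :- (u :+ x) :* (u :+ x)) refl c u x

    products-count : ∀ u → products u +ℕ 𝟙 (u ≟ 0#) ≡ 1 +ℕ 𝟙 (u ≟ 0#) *ℕ (order *ℕ 𝟙 (c ≟ 0#))
    products-count u with u ≟ 0#
    ... | yes refl = trans (ℕₚ.+-comm _ 1) (cong suc (trans
      (trans (∑-cong elements (λ z → cong (λ w → 𝟙 (c ≟ w)) (zeroˡ z))) (∑-const elements _))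
      (sym (ℕₚ.+-identityʳ _))))
    ... | no  u≢0 = trans (ℕₚ.+-identityʳ _) (trans
      (∑-cong elements (λ z → cong (λ w → 𝟙 (c ≟ w)) (sym (+-identityʳ (u * z)))))
      (trans (sym (∑-affine u≢0 0# (λ z → 𝟙 (c ≟ z)))) (∑-𝟙′ c)))

  squareSums : ℕ → Carrier → ℕ
  squareSums zero    s = 𝟙 (s ≟ 0#)
  squareSums (suc n) s = ∑ elements (λ v → squareSums n (s - v * v))

  squareSums-1 : ∀ s → squareSums 1 s ≡ sqrts s
  squareSums-1 s = ∑-cong elements λ v → 𝟙-⇔ ((s - v * v) ≟ 0#) (s ≟ (v * v)) x-y≡0⇒x≡y x≡y⇒x-y≡0

  squareSums-2 : ∀ s → squareSums 2 s ≡ ∑ elements (λ v → sqrts (s - v * v))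
  squareSums-2 s = ∑-cong elements λ v → squareSums-1 (s - v * v)

  -- Every one of the `order ^ n` vectors is counted at exactly one s.
  ∑-squareSums : ∀ n → ∑ elements (squareSums n) ≡ order ^ℕ n
  ∑-squareSums zero    = ∑-𝟙 _≟_ fieldEnumeration 0#
  ∑-squareSums (suc n) = begin
    ∑ elements (λ s → ∑ elements (λ v → squareSums n (s - v * v)))  ≡⟨ ∑-swap elements elements _ ⟩
    ∑ elements (λ v → ∑ elements (λ s → squareSums n (s - v * v)))
      ≡⟨ ∑-cong elements (λ v → ∑-shift (- (v * v)) (squareSums n)) ⟨
    ∑ elements (λ v → ∑ elements (squareSums n))                    ≡⟨ ∑-const elements _ ⟩
    order *ℕ ∑ elements (squareSums n)                              ≡⟨ cong (order *ℕ_) (∑-squareSums n) ⟩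
    order *ℕ order ^ℕ n                                             ∎
    where open ≡-Reasoning

  -- Collects the first two squares in t = x² + z with z = y². It is the source of the two-step
  -- recursion, because `squareSums 2` is almost constant.
  squareSums-convolution : ∀ n s →
    squareSums (2 +ℕ n) s ≡ ∑ elements (λ t → squareSums 2 t *ℕ squareSums n (s - t))
  squareSums-convolution n s = begin
    ∑ elements (λ x → ∑ elements (λ y → squareSums n (s - x * x - y * y)))
      ≡⟨ ∑-cong elements (λ x → ∑-fibres (λ y → y * y) (λ z → squareSums n (s - x * x - z))) ⟩
    ∑ elements (λ x → ∑ elements (λ z → sqrts z *ℕ squareSums n (s - x * x - z)))
      ≡⟨ ∑-cong elements (λ x → ∑-shift (- (x * x)) _) ⟩
    ∑ elements (λ x → ∑ elements (λ t → sqrts (t - x * x) *ℕ squareSums n (s - x * x - (t - x * x))))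
      ≡⟨ ∑-cong elements (λ x → ∑-cong elements (λ t → cong (λ z → sqrts (t - x * x) *ℕ squareSums n z)
           (solve 3 (λ s x t → s :- x :* x :- (t :- x :* x) := s :- t) refl s x t))) ⟩
    ∑ elements (λ x → ∑ elements (λ t → sqrts (t - x * x) *ℕ squareSums n (s - t)))
      ≡⟨ ∑-swap elements elements _ ⟩
    ∑ elements (λ t → ∑ elements (λ x → sqrts (t - x * x) *ℕ squareSums n (s - t)))
      ≡⟨ ∑-cong elements (λ t → trans (∑-*ʳ elements (squareSums n (s - t)) _)
                                      (cong (_*ℕ squareSums n (s - t)) (sym (squareSums-2 t)))) ⟩
    ∑ elements (λ t → squareSums 2 t *ℕ squareSums n (s - t)) ∎
    where open ≡-Reasoning

  1≢0 : 1# ≢ 0#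
  1≢0 = 0≢1 ∘ sym

  2≤order : 2 ≤ℕ order
  2≤order = subst₂ _≤ℕ_ (trans (∑-+ elements _ _)
      (cong₂ _+ℕ_ (∑-𝟙 _≟_ fieldEnumeration 0#) (∑-𝟙 _≟_ fieldEnumeration 1#))) ∑-1
    (∑-mono-≤ elements λ x → distinct x)
    where
    distinct : ∀ x → 𝟙 (x ≟ 0#) +ℕ 𝟙 (x ≟ 1#) ≤ℕ 1
    distinct x with x ≟ 0#
    ... | no  _   = 𝟙≤1 (x ≟ 1#)
    ... | yes x≡0 = ℕₚ.≤-reflexive (cong suc (𝟙-false (x ≟ 1#) λ x≡1 → 0≢1 (trans (sym x≡0) x≡1)))

  -- Among the products `sqrts s * sqrts (1 - s)` all are 0 or 4, except that s = 0 and s = 1 give 2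
  -- each. Adding 2 at both places makes every term divisible by 4 and raises the total by 4. The
  -- result determines the order modulo 4, since this count turns out to be `order` - ε.
  4∣squareSums-2 : 4 ∣ squareSums 2 1#
  4∣squareSums-2 = ∣m+n∣m⇒∣n (subst (4 ∣_) total (∑-∣ elements divisible)) (divides 1 refl)
    where
    open ≡-Reasoning
    term : Carrier → ℕ
    term s = 2 *ℕ 𝟙 (s ≟ 0#) +ℕ 2 *ℕ 𝟙 (s ≟ 1#) +ℕ sqrts s *ℕ sqrts (1# - s)

    total : ∑ elements term ≡ 4 +ℕ squareSums 2 1#
    total = begin
      ∑ elements term
        ≡⟨ trans (∑-+ elements _ _) (cong₂ _+ℕ_ (∑-+ elements _ _) refl) ⟩
      ∑ elements (λ s → 2 *ℕ 𝟙 (s ≟ 0#)) +ℕ ∑ elements (λ s → 2 *ℕ 𝟙 (s ≟ 1#))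
        +ℕ ∑ elements (λ s → sqrts s *ℕ sqrts (1# - s))
        ≡⟨ cong₂ _+ℕ_ (cong₂ _+ℕ_ (twice 0#) (twice 1#))
             (trans (sym (∑-fibres (λ v → v * v) (λ s → sqrts (1# - s)))) (sym (squareSums-2 1#))) ⟩
      4 +ℕ squareSums 2 1# ∎
      where
      twice : ∀ c → ∑ elements (λ s → 2 *ℕ 𝟙 (s ≟ c)) ≡ 2
      twice c = trans (∑-*ˡ elements 2 _) (cong (2 *ℕ_) (∑-𝟙 _≟_ fieldEnumeration c))

    zero-or-two : ∀ {s} → s ≢ 0# → sqrts s ≡ 0 ⊎ sqrts s ≡ 2
    zero-or-two {s} s≢0 with squareClass s
    ... | isZero s≡0 _       = ⊥-elim (s≢0 s≡0)
    ... | isSquare _ _ _ eq  = inj₂ eq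
    ... | isNonsquare eq     = inj₁ eq

    sqrts-1 : sqrts 1# ≡ 2
    sqrts-1 = trans (cong sqrts (sym (*-identityˡ 1#))) (sqrts-square 1≢0)

    divisible : ∀ s → 4 ∣ term s
    divisible s with s ≟ 0# | s ≟ 1#
    ... | yes s≡0  | yes s≡1 = ⊥-elim (0≢1 (trans (sym s≡0) s≡1))
    ... | yes refl | no _
      rewrite sqrts-0 | trans (cong sqrts (solve 0 (:1 :- con (ℤ.+ 0) := :1) refl)) sqrts-1 = divides 1 refl
    ... | no _     | yes refl
      rewrite sqrts-1 | trans (cong sqrts (-‿inverseʳ 1#)) sqrts-0 = divides 1 refl
    ... | no s≢0   | no s≢1 with zero-or-two s≢0 | zero-or-two {1# - s} (s≢1 ∘ sym ∘ x-y≡0⇒x≡y)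
    ...   | inj₁ eq | _        rewrite eq       = divides 0 refl
    ...   | inj₂ eq | inj₁ eq′ rewrite eq | eq′ = divides 0 refl
    ...   | inj₂ eq | inj₂ eq′ rewrite eq | eq′ = divides 1 refl

  -- The sign ε is the quadratic character of -1.
  record SquareSumLaw : Set where
    field
      ε        : ℤ
      ε-cases  : (ε ≡ ℤ.1ℤ × order % 4 ≡ 1) ⊎ (ε ≡ ℤ.-1ℤ × order % 4 ≡ 3)
      positive : ∀ t → 0 <ℕ squareSums 2 t
      pairs    : ∀ t → ℤ.+ squareSums 2 t ≡ ℤ.+ order ℤ.+ ε ℤ.* (ℤ.+ (order *ℕ 𝟙 (t ≟ 0#)) ℤ.- ℤ.1ℤ)
      step     : ∀ n s → ℤ.+ squareSums (2 +ℕ n) s ≡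
                   ℤ.+ (order ^ℕ suc n) ℤ.+ ε ℤ.* (ℤ.+ (order *ℕ squareSums n s) ℤ.- ℤ.+ (order ^ℕ n))

  private
    ∑-squareSums-reflect : ∀ n s → ∑ elements (λ t → squareSums n (s - t)) ≡ order ^ℕ n
    ∑-squareSums-reflect n s = trans (sym (∑-reflect s (squareSums n))) (∑-squareSums n)

    squareSums-at-0 : ∀ n s → ∑ elements (λ t → 𝟙 (t ≟ 0#) *ℕ squareSums n (s - t)) ≡ squareSums n s
    squareSums-at-0 n s = trans (∑-select _≟_ fieldEnumeration 0# _)
      (cong (squareSums n) (solve 1 (λ s → s :- con (ℤ.+ 0) := s) refl s))

    -- As v² - t is a translate of v², this is the hyperbola with constant - t. It differs from the
    -- circle count `squareSums-2` only by the sign inside `sqrts`.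
    hyperbola-2 : ∀ t → ∑ elements (λ v → sqrts (- (t - v * v))) +ℕ 1 ≡ order +ℕ order *ℕ 𝟙 (t ≟ 0#)
    hyperbola-2 t = begin
      ∑ elements (λ v → sqrts (- (t - v * v))) +ℕ 1
        ≡⟨ cong (_+ℕ 1) (∑-cong elements (λ v → cong sqrts (solve 2 (λ t v → :- (t :- v :* v) := v :* v :+ :- t) refl t v))) ⟩
      hyperbola (- t) +ℕ 1
        ≡⟨ hyperbola-count (- t) ⟩
      order +ℕ order *ℕ 𝟙 ((- t) ≟ 0#)
        ≡⟨ cong (λ z → order +ℕ order *ℕ z) (𝟙-⇔ ((- t) ≟ 0#) (t ≟ 0#)
             (λ -t≡0 → trans (solve 1 (λ t → t := :- :- t) refl t) (trans (cong -_ -t≡0) (solve 0 (:- con (ℤ.+ 0) := con (ℤ.+ 0)) refl)))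
             (λ t≡0 → trans (cong -_ t≡0) (solve 0 (:- con (ℤ.+ 0) := con (ℤ.+ 0)) refl))) ⟩
      order +ℕ order *ℕ 𝟙 (t ≟ 0#) ∎
      where open ≡-Reasoning

  -- Multiplying one variable by i turns the conic x² + y² = t into a hyperbola.
  squareSumLaw⁺ : ∀ {i} → i * i ≡ - 1# → SquareSumLaw
  squareSumLaw⁺ {i} i²≡-1 = record
    { ε        = ℤ.1ℤ
    ; ε-cases  = inj₁ (refl , order%4)
    -- The count plus 1 is at least `order`, which is at least 2.
    ; positive = λ t → ℕₚ.+-cancelʳ-≤ 1 1 _ (ℕₚ.≤-trans 2≤order
        (subst (order ≤ℕ_) (sym (pairs t)) (ℕₚ.m≤m+n order _)))
    ; pairs    = λ t → shifted-difference _ (order *ℕ 𝟙 (t ≟ 0#)) 1 order (pairs t)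
    ; step     = λ n s → shifted-difference _ (order *ℕ squareSums n s) (order ^ℕ n) (order ^ℕ suc n) (step n s)
    }
    where
    open ≡-Reasoning
    i≢0 : i ≢ 0#
    i≢0 i≡0 = 1≢0 (begin
      1#              ≡⟨ solve 0 (:1 := :- :- :1) refl ⟩
      - (- 1#)        ≡⟨ cong -_ (trans (sym i²≡-1) (cong (_* i) i≡0)) ⟩
      - (0# * i)      ≡⟨ solve 1 (λ i → :- (con (ℤ.+ 0) :* i) := con (ℤ.+ 0)) refl i ⟩
      0#              ∎)

    -- The map x ↦ i x carries the square roots of z to those of - z.
    sqrts-neg : ∀ z → sqrts (- z) ≡ sqrts z
    sqrts-neg z = trans (∑-affine i≢0 0# _) (∑-cong elements λ x →
      𝟙-⇔ ((- z) ≟ ((i * x + 0#) * (i * x + 0#))) (z ≟ (x * x))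
        (λ eq → begin
          z                                   ≡⟨ solve 1 (λ z → z := :- :- z) refl z ⟩
          - (- z)                             ≡⟨ cong -_ (trans eq (rotate x)) ⟩
          - (- (x * x))                       ≡⟨ solve 1 (λ x → :- :- (x :* x) := x :* x) refl x ⟩
          x * x                               ∎)
        (λ eq → trans (cong -_ eq) (sym (rotate x))))
      where
      rotate : ∀ x → (i * x + 0#) * (i * x + 0#) ≡ - (x * x)
      rotate x = begin
        (i * x + 0#) * (i * x + 0#)
          ≡⟨ solve 2 (λ i x → (i :* x :+ con (ℤ.+ 0)) :* (i :* x :+ con (ℤ.+ 0)) := (i :* i) :* (x :* x)) refl i x ⟩
        i * i * (x * x)       ≡⟨ cong (_* (x * x)) i²≡-1 ⟩
        - 1# * (x * x)        ≡⟨ solve 1 (λ x → :- :1 :* x := :- x) refl (x * x) ⟩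
        - (x * x)             ∎

    pairs : ∀ t → squareSums 2 t +ℕ 1 ≡ order +ℕ order *ℕ 𝟙 (t ≟ 0#)
    pairs t = trans (cong (_+ℕ 1) (trans (squareSums-2 t) (∑-cong elements λ v → sym (sqrts-neg _)))) (hyperbola-2 t)

    -- Insert `pairs` into the convolution: the constant part sums to a power of the order, and the
    -- part at t = 0 picks out `squareSums n s`. The term `order ^ n` on the left absorbs the 1 in
    -- `pairs`.
    step : ∀ n s → squareSums (2 +ℕ n) s +ℕ order ^ℕ n ≡ order ^ℕ suc n +ℕ order *ℕ squareSums n s
    step n s = begin
      squareSums (2 +ℕ n) s +ℕ order ^ℕ n
        ≡⟨ cong₂ _+ℕ_ (squareSums-convolution n s) (sym (∑-squareSums-reflect n s)) ⟩
      ∑ elements (λ t → squareSums 2 t *ℕ g t) +ℕ ∑ elements g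
        ≡⟨ ∑-+ elements _ _ ⟨
      ∑ elements (λ t → squareSums 2 t *ℕ g t +ℕ g t)
        ≡⟨ ∑-cong elements pointwise ⟩
      ∑ elements (λ t → order *ℕ g t +ℕ order *ℕ (𝟙 (t ≟ 0#) *ℕ g t))
        ≡⟨ trans (∑-+ elements _ _) (cong₂ _+ℕ_ (∑-*ˡ elements order _) (∑-*ˡ elements order _)) ⟩
      order *ℕ ∑ elements g +ℕ order *ℕ ∑ elements (λ t → 𝟙 (t ≟ 0#) *ℕ g t)
        ≡⟨ cong₂ (λ x y → order *ℕ x +ℕ order *ℕ y) (∑-squareSums-reflect n s) (squareSums-at-0 n s) ⟩
      order *ℕ order ^ℕ n +ℕ order *ℕ squareSums n s ∎
      where
      g : Carrier → ℕ
      g t = squareSums n (s - t)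
      pointwise : ∀ t → squareSums 2 t *ℕ g t +ℕ g t ≡ order *ℕ g t +ℕ order *ℕ (𝟙 (t ≟ 0#) *ℕ g t)
      pointwise t = trans (lemma₁ (squareSums 2 t) (g t)) (trans (cong (_*ℕ g t) (pairs t)) (lemma₂ order (𝟙 (t ≟ 0#)) (g t)))
        where
        lemma₁ : ∀ m g → m *ℕ g +ℕ g ≡ (m +ℕ 1) *ℕ g
        lemma₁ = solve-∀
        lemma₂ : ∀ q d g → (q +ℕ q *ℕ d) *ℕ g ≡ q *ℕ g +ℕ q *ℕ (d *ℕ g)
        lemma₂ = solve-∀

    order%4 : order % 4 ≡ 1
    order%4 with divides k eq ← 4∣squareSums-2 = begin
      order % 4             ≡⟨ cong (_% 4) order≡ ⟩
      (1 +ℕ k *ℕ 4) % 4     ≡⟨ [m+kn]%n≡m%n 1 k 4 ⟩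
      1                     ∎
      where
      order≡ : order ≡ 1 +ℕ k *ℕ 4
      order≡ = begin
        order                           ≡⟨ ℕₚ.+-identityʳ order ⟨
        order +ℕ 0                      ≡⟨ cong (order +ℕ_) (ℕₚ.*-zeroʳ order) ⟨
        order +ℕ order *ℕ 0             ≡⟨ cong (λ z → order +ℕ order *ℕ z) (𝟙-false (1# ≟ 0#) 1≢0) ⟨
        order +ℕ order *ℕ 𝟙 (1# ≟ 0#)   ≡⟨ pairs 1# ⟨
        squareSums 2 1# +ℕ 1            ≡⟨ cong (_+ℕ 1) eq ⟩
        k *ℕ 4 +ℕ 1                     ≡⟨ ℕₚ.+-comm _ 1 ⟩
        1 +ℕ k *ℕ 4                     ∎

  -- Now z and - z have two square roots in total, so circle and hyperbola counts add up to a known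
  -- number.
  squareSumLaw⁻ : (∀ i → i * i ≢ - 1#) → SquareSumLaw
  squareSumLaw⁻ i²≢-1 = record
    { ε        = ℤ.-1ℤ
    ; ε-cases  = inj₂ (refl , order%4)
    ; positive = positive
    ; pairs    = λ t → shifted-difference⁻ _ (order *ℕ 𝟙 (t ≟ 0#)) 1 order (pairs t)
    ; step     = λ n s → shifted-difference⁻ _ (order *ℕ squareSums n s) (order ^ℕ n) (order ^ℕ suc n) (step n s)
    }
    where
    open ≡-Reasoning

    -- The quotient w / y would be a square root of -1.
    not-both-square : ∀ {z y w} → y ≢ 0# → z ≡ y * y → - z ≢ w * w
    not-both-square {z} {y} {w} y≢0 z≡y² -z≡w² = i²≢-1 (w * inv y≢0) (begin
      w * y⁻¹ * (w * y⁻¹)         ≡⟨ solve 2 (λ w i → w :* i :* (w :* i) := w :* w :* (i :* i)) refl w y⁻¹ ⟩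
      w * w * (y⁻¹ * y⁻¹)         ≡⟨ cong (_* (y⁻¹ * y⁻¹)) (trans (sym -z≡w²) (cong -_ z≡y²)) ⟩
      - (y * y) * (y⁻¹ * y⁻¹)     ≡⟨ solve 2 (λ y i → :- (y :* y) :* (i :* i) := :- (y :* i :* (y :* i))) refl y y⁻¹ ⟩
      - (y * y⁻¹ * (y * y⁻¹))     ≡⟨ cong (λ e → - (e * e)) (*-invʳ y≢0) ⟩
      - (1# * 1#)                 ≡⟨ cong -_ (*-identityˡ 1#) ⟩
      - 1#                        ∎)
      where
      y⁻¹ = inv y≢0

    sqrts≤2 : ∀ z → sqrts z ≤ℕ 2
    sqrts≤2 z with squareClass z
    ... | isZero _ eq       rewrite eq = s≤s z≤n
    ... | isSquare _ _ _ eq rewrite eq = s≤s (s≤s z≤n)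
    ... | isNonsquare eq    rewrite eq = z≤n

    sqrts-neg≤2 : ∀ z → sqrts z +ℕ sqrts (- z) ≤ℕ 2
    sqrts-neg≤2 z with squareClass z
    ... | isNonsquare eq rewrite eq = sqrts≤2 (- z)
    ... | isZero refl eq rewrite eq | trans (cong sqrts (solve 0 (:- con (ℤ.+ 0) := con (ℤ.+ 0)) refl)) sqrts-0 = ℕₚ.≤-refl
    ... | isSquare y y≢0 z≡y² eq rewrite eq with squareClass (- z)
    ...   | isNonsquare eq′        rewrite eq′ = ℕₚ.≤-refl
    ...   | isSquare w _ -z≡w² _ = ⊥-elim (not-both-square y≢0 z≡y² -z≡w²)
    ...   | isZero -z≡0 _        = ⊥-elim (not-both-square y≢0 z≡y² (trans -z≡0 (sym (zeroˡ 0#))))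

    -- At most 2 pointwise, as z and - z are not both nonzero squares. Summed over the field both
    -- sides give twice the order, so the bound is attained everywhere.
    sqrts-neg : ∀ z → sqrts z +ℕ sqrts (- z) ≡ 2
    sqrts-neg z = ∑-tight elements sqrts-neg≤2 total (complete z)
      where
      total : ∑ elements (λ z → sqrts z +ℕ sqrts (- z)) ≡ ∑ elements (λ _ → 2)
      total = begin
        ∑ elements (λ z → sqrts z +ℕ sqrts (- z))             ≡⟨ ∑-+ elements _ _ ⟩
        ∑ elements sqrts +ℕ ∑ elements (λ z → sqrts (- z))
          ≡⟨ cong (∑ elements sqrts +ℕ_) (∑-cong elements (λ z → cong sqrts (sym (+-identityˡ (- z))))) ⟩
        ∑ elements sqrts +ℕ ∑ elements (λ z → sqrts (0# - z))
          ≡⟨ cong (∑ elements sqrts +ℕ_) (∑-reflect 0# sqrts) ⟨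
        ∑ elements sqrts +ℕ ∑ elements sqrts                  ≡⟨ cong₂ _+ℕ_ ∑-sqrts ∑-sqrts ⟩
        order +ℕ order                                        ≡⟨ double order ⟩
        order *ℕ 2                                            ≡⟨ ∑-const elements 2 ⟨
        ∑ elements (λ _ → 2)                                  ∎
        where
        double : ∀ q → q +ℕ q ≡ q *ℕ 2
        double = solve-∀

    -- By `sqrts-neg`, the circle and the hyperbola h have 2 `order` points together; the size of h
    -- is then substituted from `hyperbola-2`.
    pairs : ∀ t → squareSums 2 t +ℕ order *ℕ 𝟙 (t ≟ 0#) ≡ order +ℕ 1
    pairs t = ℕₚ.+-cancelˡ-≡ order _ _ (begin
      order +ℕ (squareSums 2 t +ℕ order *ℕ 𝟙 (t ≟ 0#))    ≡⟨ lemma₁ order (squareSums 2 t) (order *ℕ 𝟙 (t ≟ 0#)) ⟩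
      squareSums 2 t +ℕ (order +ℕ order *ℕ 𝟙 (t ≟ 0#))    ≡⟨ cong (squareSums 2 t +ℕ_) (hyperbola-2 t) ⟨
      squareSums 2 t +ℕ (h +ℕ 1)                          ≡⟨ ℕₚ.+-assoc (squareSums 2 t) h 1 ⟨
      squareSums 2 t +ℕ h +ℕ 1                            ≡⟨ cong (λ z → z +ℕ h +ℕ 1) (squareSums-2 t) ⟩
      ∑ elements (λ v → sqrts (t - v * v)) +ℕ h +ℕ 1      ≡⟨ cong (_+ℕ 1) (∑-+ elements _ _) ⟨
      ∑ elements (λ v → sqrts (t - v * v) +ℕ sqrts (- (t - v * v))) +ℕ 1
        ≡⟨ cong (_+ℕ 1) (trans (∑-cong elements λ v → sqrts-neg (t - v * v)) (∑-const elements 2)) ⟩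
      order *ℕ 2 +ℕ 1                                     ≡⟨ lemma₂ order ⟩
      order +ℕ (order +ℕ 1)                               ∎)
      where
      h = ∑ elements (λ v → sqrts (- (t - v * v)))
      lemma₁ : ∀ a b c → a +ℕ (b +ℕ c) ≡ b +ℕ (a +ℕ c)
      lemma₁ = solve-∀
      lemma₂ : ∀ q → q *ℕ 2 +ℕ 1 ≡ q +ℕ (q +ℕ 1)
      lemma₂ = solve-∀

    -- The indicator in `pairs` is at most 1, which leaves at least one representation.
    positive : ∀ t → 0 <ℕ squareSums 2 t
    positive t = ℕₚ.+-cancelʳ-≤ order 1 _ (subst₂ _≤ℕ_ (trans (pairs t) (ℕₚ.+-comm order 1))
      (cong (squareSums 2 t +ℕ_) (ℕₚ.*-identityʳ order))
      (ℕₚ.+-monoʳ-≤ (squareSums 2 t) (ℕₚ.*-monoʳ-≤ order (𝟙≤1 (t ≟ 0#)))))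

    step : ∀ n s → squareSums (2 +ℕ n) s +ℕ order *ℕ squareSums n s ≡ order ^ℕ suc n +ℕ order ^ℕ n
    step n s = begin
      squareSums (2 +ℕ n) s +ℕ order *ℕ squareSums n s
        ≡⟨ cong₂ _+ℕ_ (squareSums-convolution n s) (cong (order *ℕ_) (sym (squareSums-at-0 n s))) ⟩
      ∑ elements (λ t → squareSums 2 t *ℕ g t) +ℕ order *ℕ ∑ elements (λ t → 𝟙 (t ≟ 0#) *ℕ g t)
        ≡⟨ trans (cong₂ _+ℕ_ refl (sym (∑-*ˡ elements order _))) (sym (∑-+ elements _ _)) ⟩
      ∑ elements (λ t → squareSums 2 t *ℕ g t +ℕ order *ℕ (𝟙 (t ≟ 0#) *ℕ g t))
        ≡⟨ ∑-cong elements pointwise ⟩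
      ∑ elements (λ t → order *ℕ g t +ℕ g t)
        ≡⟨ trans (∑-+ elements _ _) (cong₂ _+ℕ_ (∑-*ˡ elements order _) refl) ⟩
      order *ℕ ∑ elements g +ℕ ∑ elements g
        ≡⟨ cong (λ x → order *ℕ x +ℕ x) (∑-squareSums-reflect n s) ⟩
      order *ℕ order ^ℕ n +ℕ order ^ℕ n ∎
      where
      g : Carrier → ℕ
      g t = squareSums n (s - t)
      pointwise : ∀ t → squareSums 2 t *ℕ g t +ℕ order *ℕ (𝟙 (t ≟ 0#) *ℕ g t) ≡ order *ℕ g t +ℕ g t
      pointwise t = trans (lemma₁ order (squareSums 2 t) (𝟙 (t ≟ 0#)) (g t)) (trans (cong (_*ℕ g t) (pairs t)) (lemma₂ order (g t)))
        where
        lemma₁ : ∀ q m d g → m *ℕ g +ℕ q *ℕ (d *ℕ g) ≡ (m +ℕ q *ℕ d) *ℕ g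
        lemma₁ = solve-∀
        lemma₂ : ∀ q g → (q +ℕ 1) *ℕ g ≡ q *ℕ g +ℕ g
        lemma₂ = solve-∀

    order%4 : order % 4 ≡ 3
    order%4 with 4∣squareSums-2
    -- Excluding the quotient 0 makes the multiple of 4 a successor, so that `order` = 4 (k + 1) - 1
    -- needs no subtraction.
    ... | divides zero    eq = ⊥-elim (ℕₚ.<-irrefl (sym eq) (positive 1#))
    ... | divides (suc k) eq = begin
      order % 4             ≡⟨ cong (_% 4) order≡ ⟩
      (3 +ℕ k *ℕ 4) % 4     ≡⟨ [m+kn]%n≡m%n 3 k 4 ⟩
      3                     ∎
      where
      order≡ : order ≡ 3 +ℕ k *ℕ 4
      order≡ = ℕₚ.+-cancelʳ-≡ 1 _ _ (begin
        order +ℕ 1                                 ≡⟨ pairs 1# ⟨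
        squareSums 2 1# +ℕ order *ℕ 𝟙 (1# ≟ 0#)    ≡⟨ cong₂ _+ℕ_ eq (cong (order *ℕ_) (𝟙-false (1# ≟ 0#) 1≢0)) ⟩
        suc k *ℕ 4 +ℕ order *ℕ 0                   ≡⟨ lemma order k ⟩
        3 +ℕ k *ℕ 4 +ℕ 1                           ∎)
        where
        lemma : ∀ q k → (1 +ℕ k) *ℕ 4 +ℕ q *ℕ 0 ≡ 3 +ℕ k *ℕ 4 +ℕ 1
        lemma = solve-∀

  abstract
    -- Abstract, so that everything later depends on the sign only through the fields of the record.
    squareSumLaw : SquareSumLaw
    squareSumLaw with squareClass (- 1#)
    ... | isSquare i _ -1≡i² _ = squareSumLaw⁺ (sym -1≡i²)
    ... | isZero -1≡0 _        = ⊥-elim (1≢0 (trans (solve 0 (:1 := :- :- :1) refl)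
                                   (trans (cong -_ -1≡0) (solve 0 (:- con (ℤ.+ 0) := con (ℤ.+ 0)) refl))))
    ... | isNonsquare eq       = squareSumLaw⁻ λ i i²≡-1 → ℕₚ.<-irrefl (sym eq)
      (subst (λ z → 0 <ℕ sqrts z) i²≡-1 (∑-<-∈ i))
      where
      ∑-<-∈ : ∀ i → 0 <ℕ sqrts (i * i)
      ∑-<-∈ i = subst (_<ℕ sqrts (i * i)) (trans (∑-const elements 0) (ℕₚ.*-zeroʳ order))
        (∑-mono-< elements (λ _ → z≤n) (complete i) (ℕₚ.≤-reflexive (sym (𝟙-true ((i * i) ≟ (i * i)) refl))))

  two-squares : ∀ s → ∃ λ x → ∃ λ y → s ≡ x * x + y * y
  two-squares s with ∑-positive elements (SquareSumLaw.positive squareSumLaw s)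
  ... | x , 0<N₁ with ∑-positive elements 0<N₁
  ...   | y , 0<N₀ = x , y , (begin
    s                                      ≡⟨ solve 3 (λ s x y → s := (s :- x :* x :- y :* y) :+ (x :* x :+ y :* y)) refl s x y ⟩
    s - x * x - y * y + (x * x + y * y)    ≡⟨ cong (_+ (x * x + y * y)) (𝟙-positive ((s - x * x - y * y) ≟ 0#) 0<N₀) ⟩
    0# + (x * x + y * y)                   ≡⟨ +-identityˡ _ ⟩
    x * x + y * y                          ∎)
    where open ≡-Reasoning

-- Closed forms for the number of representations as a sum of squares.

module ClosedForms (K : FiniteField) (2≢0 : FF.fromℕ K 2 ≢ FF.0# K) where
  open FF K
  open FieldProperties K
  open SumsOfSquares K 2≢0
  open SquareSumLaw squareSumLaw

  -- The main terms cancel in the recursion, so the deviation D from the average is just multiplied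
  -- by ε `order`. This fails for the step from 0 to 2 squares, hence the shifted index.
  two-step : ∀ n s D → ℤ.+ squareSums (suc n) s ≡ ℤ.+ (order ^ℕ n) ℤ.+ D →
    ℤ.+ squareSums (3 +ℕ n) s ≡ ℤ.+ (order ^ℕ (2 +ℕ n)) ℤ.+ ε ℤ.* (ℤ.+ order ℤ.* D)
  two-step n s D eq = trans (step (suc n) s) (cong (λ z → ℤ.+ (order ^ℕ (2 +ℕ n)) ℤ.+ ε ℤ.* z) (begin
    ℤ.+ (order *ℕ squareSums (suc n) s) ℤ.- ℤ.+ (order *ℕ order ^ℕ n)
      ≡⟨ cong₂ ℤ._-_ (trans (ℤₚ.pos-* order _) (cong (λ z → ℤ.+ order ℤ.* z) eq)) (ℤₚ.pos-* order _) ⟩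
    ℤ.+ order ℤ.* (ℤ.+ (order ^ℕ n) ℤ.+ D) ℤ.- ℤ.+ order ℤ.* ℤ.+ (order ^ℕ n)
      ≡⟨ lemma (ℤ.+ order) (ℤ.+ (order ^ℕ n)) D ⟩
    ℤ.+ order ℤ.* D ∎))
    where
    open ≡-Reasoning
    lemma : ∀ q p D → q ℤ.* (p ℤ.+ D) ℤ.- q ℤ.* p ≡ q ℤ.* D
    lemma = ℤ-solve-∀

  Trichotomy : ℤ → Set
  Trichotomy e = e ≡ ℤ.-1ℤ ⊎ e ≡ ℤ.0ℤ ⊎ e ≡ ℤ.1ℤ

  ε*-trichotomy : ∀ {e} → Trichotomy e → Trichotomy (ε ℤ.* e)
  ε*-trichotomy {e} with ε-cases
  ... | inj₁ (ε≡1 , _)  rewrite ε≡1  = subst Trichotomy (sym (ℤₚ.*-identityˡ e))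
  ... | inj₂ (ε≡-1 , _) rewrite ε≡-1 = λ where
    (inj₁ refl)        → inj₂ (inj₂ refl)
    (inj₂ (inj₁ refl)) → inj₂ (inj₁ refl)
    (inj₂ (inj₂ refl)) → inj₁ refl

  -- The factor e is ε^m times the quadratic character of s: the base case says that the number of
  -- square roots is 1 plus the character, and each step multiplies by ε.
  squareSums-odd : ∀ m s → ∃ λ e → Trichotomy e ×
    ℤ.+ squareSums (1 +ℕ m *ℕ 2) s ≡ ℤ.+ (order ^ℕ (m *ℕ 2)) ℤ.+ e ℤ.* ℤ.+ (order ^ℕ m)
  squareSums-odd zero s rewrite squareSums-1 s with squareClass s
  ... | isZero _ eq       = ℤ.0ℤ , inj₂ (inj₁ refl) , cong ℤ.+_ eq
  ... | isSquare _ _ _ eq = ℤ.1ℤ , inj₂ (inj₂ refl) , cong ℤ.+_ eq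
  ... | isNonsquare eq    = ℤ.-1ℤ , inj₁ refl , cong ℤ.+_ eq
  squareSums-odd (suc m) s with squareSums-odd m s
  ... | e , e∈ , eq = ε ℤ.* e , ε*-trichotomy e∈ , trans (two-step (m *ℕ 2) s _ eq)
    (cong (λ z → ℤ.+ (order ^ℕ (suc m *ℕ 2)) ℤ.+ z) (trans (lemma ε (ℤ.+ order) e (ℤ.+ (order ^ℕ m)))
      (cong (λ z → ε ℤ.* e ℤ.* z) (sym (ℤₚ.pos-* order (order ^ℕ m))))))
    where
    lemma : ∀ ε q e p → ε ℤ.* (q ℤ.* (e ℤ.* p)) ≡ ε ℤ.* e ℤ.* (q ℤ.* p)
    lemma = ℤ-solve-∀

  -- The induction starts from the conic count `pairs`; each step contributes one more factor ε and
  -- one more factor `order`.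
  squareSums-even : ∀ m s → ℤ.+ squareSums (2 +ℕ m *ℕ 2) s ≡
    ℤ.+ (order ^ℕ (1 +ℕ m *ℕ 2)) ℤ.+ ε ℤ.^ suc m ℤ.* (ℤ.+ (order *ℕ 𝟙 (s ≟ 0#)) ℤ.- ℤ.1ℤ) ℤ.* ℤ.+ (order ^ℕ m)
  squareSums-even zero s = trans (pairs s) (cong₂ ℤ._+_ (cong ℤ.+_ (sym (ℕₚ.*-identityʳ order)))
    (lemma ε (ℤ.+ (order *ℕ 𝟙 (s ≟ 0#)) ℤ.- ℤ.1ℤ)))
    where
    lemma : ∀ ε d → ε ℤ.* d ≡ ε ℤ.* ℤ.1ℤ ℤ.* d ℤ.* ℤ.1ℤ
    lemma = ℤ-solve-∀
  squareSums-even (suc m) s = trans (two-step (1 +ℕ m *ℕ 2) s _ (squareSums-even m s))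
    (cong (λ z → ℤ.+ (order ^ℕ (1 +ℕ suc m *ℕ 2)) ℤ.+ z)
      (trans (lemma ε (ℤ.+ order) (ε ℤ.^ suc m) (ℤ.+ (order *ℕ 𝟙 (s ≟ 0#)) ℤ.- ℤ.1ℤ) (ℤ.+ (order ^ℕ m)))
        (cong (λ z → ε ℤ.* ε ℤ.^ suc m ℤ.* (ℤ.+ (order *ℕ 𝟙 (s ≟ 0#)) ℤ.- ℤ.1ℤ) ℤ.* z) (sym (ℤₚ.pos-* order (order ^ℕ m))))))
    where
    lemma : ∀ ε q E d p → ε ℤ.* (q ℤ.* (E ℤ.* d ℤ.* p)) ≡ ε ℤ.* E ℤ.* d ℤ.* (q ℤ.* p)
    lemma = ℤ-solve-∀

  sum-of-squares : ∀ {n} → Vec Carrier n → Carrier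
  sum-of-squares []       = 0#
  sum-of-squares (z ∷ zs) = z * z + sum-of-squares zs

  every-element-is-sum-of-squares : ∀ n s → ∃ λ (zs : Vec Carrier (2 +ℕ n)) → sum-of-squares zs ≡ s
  every-element-is-sum-of-squares n s with two-squares s
  ... | x , y , s≡x²+y² = x ∷ y ∷ replicate n 0# ,
    trans (cong (λ z → x * x + (y * y + z)) (zeros n)) (trans (cong (x * x +_) (+-identityʳ _)) (sym s≡x²+y²))
    where
    zeros : ∀ n → sum-of-squares (replicate n 0#) ≡ 0#
    zeros zero    = refl
    zeros (suc n) = trans (cong (0# * 0# +_) (zeros n)) (solve 0 (con (ℤ.+ 0) :* con (ℤ.+ 0) :+ con (ℤ.+ 0) := con (ℤ.+ 0)) refl)

-- Zeros of a diagonal quadratic polynomial that is at most linear in half of its variables.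

-- Counts the zeros of t + Σᵢ (δᵢ uᵢ - τᵢ vᵢ + κ vᵢ²) over (u, v) ∈ Kⁿ × Kⁿ, given the list of pairs (δᵢ , τᵢ).
module QuadraticCounting (K : FiniteField) (2≢0 : FF.fromℕ K 2 ≢ FF.0# K)
                         (κ : FF.Carrier K) (κ≢0 : κ ≢ FF.0# K) where
  open FF K
  open FieldProperties K
  open SumsOfSquares K 2≢0

  value : Carrier × Carrier → Carrier → Carrier → Carrier
  value (δ , τ) u v = δ * u - τ * v + κ * (v * v)

  zeroCount : ∀ {n} → Vec (Carrier × Carrier) n → Carrier → ℕ
  zeroCount []       t = 𝟙 (t ≟ 0#)
  zeroCount (c ∷ cs) t = ∑ elements (λ u → ∑ elements (λ v → zeroCount cs (t + value c u v)))

  -- For every (u, v) exactly one t gives a zero.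
  ∑-zeroCount : ∀ {n} (cs : Vec (Carrier × Carrier) n) → ∑ elements (zeroCount cs) ≡ order ^ℕ (n *ℕ 2)
  ∑-zeroCount []               = ∑-𝟙 _≟_ fieldEnumeration 0#
  ∑-zeroCount {suc n} (c ∷ cs) = begin
    ∑ elements (λ t → ∑ elements (λ u → ∑ elements (λ v → zeroCount cs (t + value c u v))))
      ≡⟨ ∑-swap elements elements _ ⟩
    ∑ elements (λ u → ∑ elements (λ t → ∑ elements (λ v → zeroCount cs (t + value c u v))))
      ≡⟨ ∑-cong elements (λ u → ∑-swap elements elements _) ⟩
    ∑ elements (λ u → ∑ elements (λ v → ∑ elements (λ t → zeroCount cs (t + value c u v))))
      ≡⟨ ∑-cong elements (λ u → ∑-cong elements (λ v →
           trans (sym (∑-shift (value c u v) (zeroCount cs))) (∑-zeroCount cs))) ⟩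
    ∑ elements (λ u → ∑ elements (λ v → order ^ℕ (n *ℕ 2)))
      ≡⟨ trans (∑-cong elements (λ _ → ∑-const elements _)) (∑-const elements _) ⟩
    order *ℕ (order *ℕ order ^ℕ (n *ℕ 2)) ∎
    where open ≡-Reasoning

  -- With δ ≠ 0, the variable u sweeps the constant term of the remaining polynomial once through
  -- the field, so `∑-zeroCount` applies for each v.
  zeroCount-linear : ∀ {n} (cs : Vec (Carrier × Carrier) (suc n)) t →
    Any (λ c → proj₁ c ≢ 0#) cs → zeroCount cs t ≡ order ^ℕ (1 +ℕ n *ℕ 2)
  zeroCount-linear {n} ((δ , τ) ∷ cs) t (here δ≢0) = begin
    ∑ elements (λ u → ∑ elements (λ v → zeroCount cs (t + value (δ , τ) u v)))
      ≡⟨ ∑-swap elements elements _ ⟩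
    ∑ elements (λ v → ∑ elements (λ u → zeroCount cs (t + value (δ , τ) u v)))
      ≡⟨ ∑-cong elements (λ v → ∑-cong elements (λ u → cong (zeroCount cs)
           (solve 6 (λ t δ τ κ u v → t :+ (δ :* u :- τ :* v :+ κ :* (v :* v)) := δ :* u :+ (t :- τ :* v :+ κ :* (v :* v))) refl t δ τ κ u v))) ⟩
    ∑ elements (λ v → ∑ elements (λ u → zeroCount cs (δ * u + (t - τ * v + κ * (v * v)))))
      ≡⟨ ∑-cong elements (λ v → trans (sym (∑-affine δ≢0 _ (zeroCount cs))) (∑-zeroCount cs)) ⟩
    ∑ elements (λ v → order ^ℕ (n *ℕ 2))
      ≡⟨ ∑-const elements _ ⟩
    order *ℕ order ^ℕ (n *ℕ 2) ∎
    where open ≡-Reasoning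
  -- The count for the tail does not depend on its constant term, so the pair (u, v) only
  -- contributes a factor `order` twice.
  zeroCount-linear {suc n} (c ∷ cs) t (there any) =
    trans (∑-cong elements (λ u → trans (∑-cong elements (λ v → zeroCount-linear cs _ any)) (∑-const elements _)))
          (∑-const elements _)

  2κ≢0 : fromℕ 2 * κ ≢ 0#
  2κ≢0 = *-≢0 2≢0 κ≢0

  -- The centre of the completed square: κ v² - τ v = κ ((v - μ)² - μ²).
  μ : Carrier × Carrier → Carrier
  μ (δ , τ) = inv 2κ≢0 * τ

  τ≡2κμ : ∀ c → proj₂ c ≡ fromℕ 2 * κ * μ c
  τ≡2κμ (_ , τ) = sym (trans (sym (*-assoc _ _ _)) (trans (cong (_* τ) (*-invʳ 2κ≢0)) (*-identityˡ τ)))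

  -- If the centre is v + z, then the completed square takes the value κ z² at v, whatever v is.
  -- Through this identity the section through a given point is prescribed.
  value-at-μ : ∀ u v z → value (0# , fromℕ 2 * (κ * (v + z))) u v + κ * ((v + z) * (v + z)) ≡ κ * (z * z)
  value-at-μ = solve 4 (λ κ u v z → con (ℤ.+ 0) :* u :- con (ℤ.+ 2) :* (κ :* (v :+ z)) :* v :+ κ :* (v :* v)
    :+ κ :* ((v :+ z) :* (v :+ z)) := κ :* (z :* z)) refl κ

  ∑μ² : ∀ {n} → Vec (Carrier × Carrier) n → Carrier
  ∑μ² []       = 0#
  ∑μ² (c ∷ cs) = μ c * μ c + ∑μ² cs

  -- All u are free, one factor `order` each, and completing the squares leaves a sum of squares in
  -- the shifted v with prescribed value.
  zeroCount-square : ∀ {n} (cs : Vec (Carrier × Carrier) n) t →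
    All (λ c → proj₁ c ≡ 0#) cs → zeroCount cs t ≡ order ^ℕ n *ℕ squareSums n (∑μ² cs - inv κ≢0 * t)
  zeroCount-square [] t [] = trans
    (𝟙-⇔ (t ≟ 0#) ((0# - inv κ≢0 * t) ≟ 0#)
      (λ t≡0 → trans (cong (λ z → 0# - inv κ≢0 * z) t≡0) (solve 1 (λ i → con (ℤ.+ 0) :- i :* con (ℤ.+ 0) := con (ℤ.+ 0)) refl (inv κ≢0)))
      (λ eq → begin
        t                                ≡⟨ *-identityˡ t ⟨
        1# * t                           ≡⟨ cong (_* t) (*-invʳ κ≢0) ⟨
        κ * inv κ≢0 * t                  ≡⟨ solve 3 (λ κ i t → κ :* i :* t := :- κ :* (con (ℤ.+ 0) :- i :* t)) refl κ (inv κ≢0) t ⟩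
        (- κ) * (0# - inv κ≢0 * t)       ≡⟨ cong ((- κ) *_) eq ⟩
        (- κ) * 0#                       ≡⟨ zeroʳ _ ⟩
        0#                               ∎))
    (sym (ℕₚ.+-identityʳ _))
    where open ≡-Reasoning
  zeroCount-square {suc n} (c@(δ , τ) ∷ cs) t (refl ∷ δs≡0) = begin
    ∑ elements (λ u → ∑ elements (λ v → zeroCount cs (t + value c u v)))
      ≡⟨ ∑-cong elements (λ u → trans (∑-cong elements (λ v →
           trans (zeroCount-square cs _ δs≡0) (cong (λ z → order ^ℕ n *ℕ squareSums n z) (complete-square u v))))
           (∑-*ˡ elements (order ^ℕ n) _)) ⟩
    ∑ elements (λ u → order ^ℕ n *ℕ ∑ elements (λ v → squareSums n (s - (v - μ c) * (v - μ c))))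
      ≡⟨ ∑-const elements _ ⟩
    order *ℕ (order ^ℕ n *ℕ ∑ elements (λ v → squareSums n (s - (v - μ c) * (v - μ c))))
      ≡⟨ ℕₚ.*-assoc order _ _ ⟨
    order *ℕ order ^ℕ n *ℕ ∑ elements (λ v → squareSums n (s - (v - μ c) * (v - μ c)))
      ≡⟨ cong (order *ℕ order ^ℕ n *ℕ_) (∑-shift (- μ c) (λ v → squareSums n (s - v * v))) ⟨
    order *ℕ order ^ℕ n *ℕ squareSums (suc n) s ∎
    where
    open ≡-Reasoning
    s : Carrier
    s = μ c * μ c + ∑μ² cs - inv κ≢0 * t
    complete-square : ∀ u v → ∑μ² cs - inv κ≢0 * (t + value c u v) ≡ s - (v - μ c) * (v - μ c)
    complete-square u v = begin
      ∑μ² cs - i * (t + (0# * u - τ * v + κ * (v * v)))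
        ≡⟨ cong (λ τ → ∑μ² cs - i * (t + (0# * u - τ * v + κ * (v * v)))) (τ≡2κμ c) ⟩
      ∑μ² cs - i * (t + (0# * u - fromℕ 2 * κ * μ c * v + κ * (v * v)))
        ≡⟨ solve 7 (λ S i t u κ m v →
             S :- i :* (t :+ (con (ℤ.+ 0) :* u :- con (ℤ.+ 2) :* κ :* m :* v :+ κ :* (v :* v)))
             := S :- i :* t :- (κ :* i) :* (v :* v :- con (ℤ.+ 2) :* m :* v)) refl (∑μ² cs) i t u κ (μ c) v ⟩
      ∑μ² cs - i * t - κ * i * (v * v - fromℕ 2 * μ c * v)
        ≡⟨ cong (λ e → ∑μ² cs - i * t - e * (v * v - fromℕ 2 * μ c * v)) (*-invʳ κ≢0) ⟩
      ∑μ² cs - i * t - 1# * (v * v - fromℕ 2 * μ c * v)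
        ≡⟨ solve 4 (λ S x m v → S :- x :- :1 :* (v :* v :- con (ℤ.+ 2) :* m :* v) :=
             m :* m :+ S :- x :- (v :- m) :* (v :- m)) refl (∑μ² cs) (i * t) (μ c) v ⟩
      s - (v - μ c) * (v - μ c) ∎
      where i = inv κ≢0

-- An involutive automorphism and its fixed field.

-- What is needed of x ↦ x^q and β = b^q - b. The anti-invariant β plays the part of the square root
-- of a nonsquare of GF(q).
record Conjugation (F : FiniteField) : Set where
  open FF F
  field
    σ      : Carrier → Carrier
    σ-+    : ∀ x y → σ (x + y) ≡ σ x + σ y
    σ-*    : ∀ x y → σ (x * y) ≡ σ x * σ y
    σσ     : ∀ x → σ (σ x) ≡ x
    β      : Carrier
    σβ     : σ β ≡ - β
    β≢0    : β ≢ 0#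
    2≢0    : fromℕ 2 ≢ 0#

module FixedField (F : FiniteField) (conjugation : Conjugation F) where
  open FF F
  open FieldProperties F
  open Conjugation conjugation

  abstract
    σ-0 : σ 0# ≡ 0#
    σ-0 = +-cancelʳ _ _ (σ 0#) (trans (sym (σ-+ 0# 0#)) (trans (cong σ (+-identityˡ 0#)) (sym (+-identityˡ _))))

    σ-neg : ∀ x → σ (- x) ≡ - σ x
    σ-neg x = +-cancelʳ _ _ (σ x) (begin
      σ (- x) + σ x    ≡⟨ σ-+ (- x) x ⟨
      σ (- x + x)      ≡⟨ cong σ (-‿inverseˡ x) ⟩
      σ 0#             ≡⟨ σ-0 ⟩
      0#               ≡⟨ -‿inverseˡ (σ x) ⟨
      - σ x + σ x      ∎)
      where open ≡-Reasoning

    σ-≢0 : ∀ {x} → x ≢ 0# → σ x ≢ 0#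
    σ-≢0 {x} x≢0 σx≡0 = x≢0 (trans (sym (σσ x)) (trans (cong σ σx≡0) σ-0))

    -- The image of 1 is a nonzero idempotent.
    σ-1 : σ 1# ≡ 1#
    σ-1 = *-cancelˡ (σ-≢0 (0≢1 ∘ sym)) (trans (sym (σ-* 1# 1#)) (trans (cong σ (*-identityˡ 1#))
            (trans (sym (*-identityˡ _)) (*-comm _ _))))

    σ-fromℕ : ∀ n → σ (fromℕ n) ≡ fromℕ n
    σ-fromℕ zero    = σ-0
    σ-fromℕ (suc n) = trans (σ-+ 1# (fromℕ n)) (cong₂ _+_ σ-1 (σ-fromℕ n))

    σ-- : ∀ x y → σ (x - y) ≡ σ x - σ y
    σ-- x y = trans (σ-+ x (- y)) (cong (σ x +_) (σ-neg y))

    σ-inv : ∀ {x} (x≢0 : x ≢ 0#) → σ x * σ (inv x≢0) ≡ 1#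
    σ-inv x≢0 = trans (sym (σ-* _ _)) (trans (cong σ (*-invʳ x≢0)) σ-1)

  Fixed : Set
  Fixed = ∃ λ x → σ x ≡ x

  ι : Fixed → Carrier
  ι = proj₁

  abstract
    ι-injective : ∀ {x y} → ι x ≡ ι y → x ≡ y
    ι-injective {x , p} {.x , q} refl = cong (x ,_) (≡-irrelevant p q)

    +-fixed : ∀ {x y} → σ x ≡ x → σ y ≡ y → σ (x + y) ≡ x + y
    +-fixed {x} {y} p q = trans (σ-+ x y) (cong₂ _+_ p q)

    *-fixed : ∀ {x y} → σ x ≡ x → σ y ≡ y → σ (x * y) ≡ x * y
    *-fixed {x} {y} p q = trans (σ-* x y) (cong₂ _*_ p q)

    neg-fixed : ∀ {x} → σ x ≡ x → σ (- x) ≡ - x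
    neg-fixed {x} p = trans (σ-neg x) (cong -_ p)

    inv-fixed : ∀ {x} (x≢0 : x ≢ 0#) → σ x ≡ x → σ (inv x≢0) ≡ inv x≢0
    inv-fixed x≢0 σx≡x = *-cancelˡ x≢0 (trans (cong (_* σ (inv x≢0)) (sym σx≡x)) (trans (σ-inv x≢0) (sym (*-invʳ x≢0))))

    trace-fixed : ∀ x → σ (x + σ x) ≡ x + σ x
    trace-fixed x = trans (σ-+ x (σ x)) (trans (cong (σ x +_) (σσ x)) (+-comm _ _))

  trace : Carrier → Fixed
  trace x = x + σ x , trace-fixed x

  private
    fixedRawRing : RawRing 0ℓ 0ℓ
    fixedRawRing = record
      { Carrier = Fixed
      ; _≈_     = _≡_
      ; _+_     = λ (x , p) (y , q) → x + y , +-fixed p q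
      ; _*_     = λ (x , p) (y , q) → x * y , *-fixed p q
      ; -_      = λ (x , p) → - x , neg-fixed p
      ; 0#      = 0# , σ-0
      ; 1#      = 1# , σ-1
      }

    ι-monomorphism : IsRingMonomorphism fixedRawRing (CommutativeRing.rawRing commutativeRing) ι
    ι-monomorphism = record
      { isRingHomomorphism = record
        { isSemiringHomomorphism = record
          { isNearSemiringHomomorphism = record
            { +-isMonoidHomomorphism = record
              { isMagmaHomomorphism = record
                { isRelHomomorphism = record { cong = cong ι } ; homo = λ _ _ → refl }
              ; ε-homo = refl }
            ; *-homo = λ _ _ → refl }
          ; 1#-homo = refl }
        ; -‿homo = λ _ → refl }
      ; injective = ι-injective }

    _≟F_ : DecidableEquality Fixed
    x ≟F y = map′ ι-injective (cong ι) (ι x ≟ ι y)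

    half : Carrier
    half = inv 2≢0

    2*half : ∀ x → fromℕ 2 * (half * x) ≡ x
    2*half x = trans (sym (*-assoc _ _ _)) (trans (cong (_* x) (*-invʳ 2≢0)) (*-identityˡ x))

    σ-half : σ half ≡ half
    σ-half = inv-fixed 2≢0 (σ-fromℕ 2)

    -- Half of a fixed element has that element as its trace. Hence the traces of all elements, with
    -- repetitions removed, enumerate the fixed field.
    trace-surjective : ∀ x → trace (half * ι x) ≡ x
    trace-surjective (x , σx≡x) = ι-injective (begin
      half * x + σ (half * x)      ≡⟨ cong (half * x +_) (trans (σ-* half x) (cong₂ _*_ σ-half σx≡x)) ⟩
      half * x + half * x          ≡⟨ solve 1 (λ y → y :+ y := con (ℤ.+ 2) :* y) refl (half * x) ⟩
      fromℕ 2 * (half * x)         ≡⟨ 2*half x ⟩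
      x                            ∎)
      where open ≡-Reasoning

    fixedElements : List Fixed
    fixedElements = deduplicate _≟F_ (map trace elements)

  fixedField : FiniteField
  fixedField = record
    { Carrier = Fixed
    ; _+_     = RawRing._+_ fixedRawRing
    ; _*_     = RawRing._*_ fixedRawRing
    ; -_      = RawRing.-_ fixedRawRing
    ; 0#      = RawRing.0# fixedRawRing
    ; 1#      = RawRing.1# fixedRawRing
    ; isCommutativeRing = Algebra.Morphism.RingMonomorphism.isCommutativeRing ι-monomorphism isCommutativeRing
    ; 0≢1     = 0≢1 ∘ cong ι
    ; inverse = λ (x , σx≡x) x≢0 → let x≢0′ = x≢0 ∘ ι-injective in
        (inv x≢0′ , inv-fixed x≢0′ σx≡x)
        , ι-injective (*-invʳ x≢0′)
    ; _≟_     = _≟F_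
    ; elements = fixedElements
    ; complete = λ x → ∈-deduplicate⁺ _≟F_ (subst (_∈ map trace elements) (trace-surjective x) (∈-map⁺ trace (complete _)))
    ; unique   = DecUnique.deduplicate-! _≟F_ (map trace elements)
    }

  module K = FF fixedField
  private
    module KP = FieldProperties fixedField

  K-2≢0 : K.fromℕ 2 ≢ K.0#
  K-2≢0 = 2≢0 ∘ cong ι

  abstract
    -- Both z and β change sign under σ, so their quotient is invariant. Anti-invariant equations
    -- become equations over the fixed field in this way.
    β⁻¹*-fixed : ∀ {z} → σ z ≡ - z → σ (inv β≢0 * z) ≡ inv β≢0 * z
    β⁻¹*-fixed {z} σz≡-z = *-cancelˡ (σ-≢0 β≢0) (begin
      σ β * σ (inv β≢0 * z)          ≡⟨ cong (σ β *_) (σ-* _ _) ⟩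
      σ β * (σ (inv β≢0) * σ z)      ≡⟨ *-assoc _ _ _ ⟨
      σ β * σ (inv β≢0) * σ z        ≡⟨ cong₂ _*_ (trans (σ-inv β≢0) (sym (*-invʳ β≢0))) σz≡-z ⟩
      β * inv β≢0 * (- z)            ≡⟨ solve 3 (λ b i z → b :* i :* (:- z) := :- b :* (i :* z)) refl β (inv β≢0) z ⟩
      - β * (inv β≢0 * z)            ≡⟨ cong (_* (inv β≢0 * z)) σβ ⟨
      σ β * (inv β≢0 * z)            ∎)
      where open ≡-Reasoning

  toFixed : ∀ {z} → σ z ≡ - z → Fixed
  toFixed {z} σz≡-z = inv β≢0 * z , β⁻¹*-fixed σz≡-z

  β*toFixed : ∀ {z} (p : σ z ≡ - z) → β * ι (toFixed p) ≡ z
  β*toFixed {z} p = trans (sym (*-assoc _ _ _)) (trans (cong (_* z) (*-invʳ β≢0)) (*-identityˡ z))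

  σ-difference : ∀ x → σ (σ x - x) ≡ - (σ x - x)
  σ-difference x = trans (σ-- (σ x) x) (trans (cong (_- σ x) (σσ x)) (solve 2 (λ x y → x :- y := :- (y :- x)) refl x (σ x)))

  difference : Carrier → Fixed
  difference x = toFixed (σ-difference x)

  β*difference : ∀ x → β * ι (difference x) ≡ σ x - x
  β*difference x = β*toFixed (σ-difference x)

  -- The elements w and w β form a basis over the fixed field: for y = x / w the coordinates come
  -- from (y + σ y) / 2 and (y - σ y) / 2. The scaling w is a parameter, because counting uses w = 1
  -- and the quadratic form another value.
  module Coordinates {w : Carrier} (w≢0 : w ≢ 0#) where

    point : Fixed → Fixed → Carrier
    point u v = w * (ι u + β * ι v)

    private
      ½ : Fixed
      ½ = half , σ-half

      left right : Carrier → Fixed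
      left  x = ½ K.* trace (inv w≢0 * x)
      -- The minus sign corrects the orientation of `difference`, which is (σ y - y) / β.
      right x = K.- (½ K.* difference (inv w≢0 * x))

      unscale : ∀ x → inv w≢0 * (w * x) ≡ x
      unscale x = trans (sym (*-assoc _ _ _)) (trans (cong (_* x) (*-invˡ w≢0)) (*-identityˡ x))

      σ-linear : ∀ u v → σ (ι u + β * ι v) ≡ ι u - β * ι v
      σ-linear (u , p) (v , q) = trans (σ-+ u (β * v)) (trans
        (cong₂ _+_ p (trans (σ-* β v) (cong₂ _*_ σβ q)))
        (solve 3 (λ u b v → u :+ :- b :* v := u :- b :* v) refl u β v))

    σ-point : ∀ u v → σ (point u v) ≡ σ w * (ι u - β * ι v)
    σ-point u v = trans (σ-* w _) (cong (σ w *_) (σ-linear u v))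

    coordinates : Carrier → Fixed × Fixed
    coordinates x = left x , right x

    point-coordinates : ∀ x → point (left x) (right x) ≡ x
    point-coordinates x = begin
      w * (half * (y + σ y) + β * (- (half * d)))
        ≡⟨ cong (w *_) (solve 5 (λ h y s b d → h :* (y :+ s) :+ b :* (:- (h :* d)) := h :* (y :+ s :- b :* d)) refl half y (σ y) β d) ⟩
      w * (half * (y + σ y - β * d))
        ≡⟨ cong (λ z → w * (half * (y + σ y - z))) (β*difference y) ⟩
      w * (half * (y + σ y - (σ y - y)))
        ≡⟨ cong (w *_) (trans (solve 3 (λ h y s → h :* (y :+ s :- (s :- y)) := con (ℤ.+ 2) :* (h :* y)) refl half y (σ y)) (2*half y)) ⟩
      w * (inv w≢0 * x)
        ≡⟨ trans (sym (*-assoc _ _ _)) (trans (cong (_* x) (*-invʳ w≢0)) (*-identityˡ x)) ⟩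
      x ∎
      where
      open ≡-Reasoning
      y = inv w≢0 * x
      d = ι (difference y)

    coordinates-point : ∀ uv → coordinates (point (proj₁ uv) (proj₂ uv)) ≡ uv
    coordinates-point (u , v) = cong₂ _,_
      (ι-injective (begin
        half * (inv w≢0 * point u v + σ (inv w≢0 * point u v))
          ≡⟨ cong (λ z → half * (z + σ z)) (unscale _) ⟩
        half * (ι u + β * ι v + σ (ι u + β * ι v))
          ≡⟨ cong (λ z → half * (ι u + β * ι v + z)) (σ-linear u v) ⟩
        half * (ι u + β * ι v + (ι u - β * ι v))
          ≡⟨ trans (solve 3 (λ h u y → h :* (u :+ y :+ (u :- y)) := con (ℤ.+ 2) :* (h :* u)) refl half (ι u) (β * ι v)) (2*half (ι u)) ⟩
        ι u ∎))
      (ι-injective (*-cancelˡ β≢0 (begin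
        β * - (half * ι (difference (inv w≢0 * point u v)))
          ≡⟨ solve 3 (λ b h d → b :* :- (h :* d) := :- (h :* (b :* d))) refl β half _ ⟩
        - (half * (β * ι (difference (inv w≢0 * point u v))))
          ≡⟨ cong (λ z → - (half * z)) (β*difference _) ⟩
        - (half * (σ (inv w≢0 * point u v) - inv w≢0 * point u v))
          ≡⟨ cong (λ z → - (half * (σ z - z))) (unscale _) ⟩
        - (half * (σ (ι u + β * ι v) - (ι u + β * ι v)))
          ≡⟨ cong (λ z → - (half * (z - (ι u + β * ι v)))) (σ-linear u v) ⟩
        - (half * (ι u - β * ι v - (ι u + β * ι v)))
          ≡⟨ trans (solve 3 (λ h u y → :- (h :* (u :- y :- (u :+ y))) := con (ℤ.+ 2) :* (h :* y)) refl half (ι u) (β * ι v)) (2*half (β * ι v)) ⟩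
        β * ι v ∎)))
      where open ≡-Reasoning

    ∑-coordinates : ∀ f → ∑ elements f ≡ ∑ K.elements (λ u → ∑ K.elements (λ v → f (point u v)))
    ∑-coordinates f = trans
      (∑-bijection (KP.fieldEnumeration ⊗ KP.fieldEnumeration) fieldEnumeration (λ (u , v) → point u v) coordinates
        point-coordinates coordinates-point f)
      (∑-cartesianProduct K.elements K.elements _)

  fixedField-order : order ≡ K.order *ℕ K.order
  fixedField-order = begin
    order                                            ≡⟨ ℕₚ.*-identityʳ order ⟨
    order *ℕ 1                                       ≡⟨ ∑-const elements 1 ⟨
    ∑ elements (λ _ → 1)                             ≡⟨ Coordinates.∑-coordinates (0≢1 ∘ sym) (λ _ → 1) ⟩
    ∑ K.elements (λ _ → ∑ K.elements (λ _ → 1))      ≡⟨ ∑-const K.elements _ ⟩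
    K.order *ℕ ∑ K.elements (λ _ → 1)                ≡⟨ cong (K.order *ℕ_) (trans (∑-const K.elements 1) (ℕₚ.*-identityʳ _)) ⟩
    K.order *ℕ K.order                               ∎
    where open ≡-Reasoning

  -- In the coordinates u + β v, `difference` is -2 v: the equation determines v and leaves u free.
  difference-fibre : ∀ t → ∑ elements (λ y → 𝟙 ((difference y K.+ t) K.≟ K.0#)) ≡ K.order
  difference-fibre t = begin
    ∑ elements (λ y → 𝟙 ((difference y K.+ t) K.≟ K.0#))
      ≡⟨ ∑-coordinates _ ⟩
    ∑ K.elements (λ u → ∑ K.elements (λ v → 𝟙 ((difference (point u v) K.+ t) K.≟ K.0#)))
      ≡⟨ ∑-cong K.elements (λ u → ∑-cong K.elements (λ v →
           cong (λ z → 𝟙 ((z K.+ t) K.≟ K.0#)) (difference-point u v))) ⟩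
    ∑ K.elements (λ u → ∑ K.elements (λ v → 𝟙 ((K.- K.fromℕ 2 K.* v K.+ t) K.≟ K.0#)))
      ≡⟨ ∑-cong K.elements (λ u → trans (sym (KP.∑-affine -2≢0 t (λ z → 𝟙 (z K.≟ K.0#)))) (∑-𝟙 K._≟_ KP.fieldEnumeration K.0#)) ⟩
    ∑ K.elements (λ u → 1)
      ≡⟨ trans (∑-const K.elements 1) (ℕₚ.*-identityʳ _) ⟩
    K.order ∎
    where
    open ≡-Reasoning
    open Coordinates (0≢1 ∘ sym)
    -2≢0 : K.- K.fromℕ 2 ≢ K.0#
    -2≢0 -2≡0 = 2≢0 (trans (solve 1 (λ x → x := :- :- x) refl (fromℕ 2))
      (trans (cong -_ (cong ι -2≡0)) (solve 0 (:- con (ℤ.+ 0) := con (ℤ.+ 0)) refl)))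
    difference-point : ∀ u v → difference (point u v) ≡ K.- K.fromℕ 2 K.* v
    difference-point u v = ι-injective (*-cancelˡ β≢0 (begin
      β * ι (difference (point u v))                     ≡⟨ β*difference _ ⟩
      σ (point u v) - point u v                          ≡⟨ cong (_- point u v) (trans (σ-point u v) (cong (_* (ι u - β * ι v)) σ-1)) ⟩
      1# * (ι u - β * ι v) - 1# * (ι u + β * ι v)
        ≡⟨ solve 3 (λ b u v → :1 :* (u :- b :* v) :- :1 :* (u :+ b :* v) := b :* (:- con (ℤ.+ 2) :* v)) refl β (ι u) (ι v) ⟩
      β * (- fromℕ 2 * ι v)                              ∎))

-- Affine space, hyperplanes and essential points.

⌊⌋-true : {P : Set} (d : Dec P) → P → ⌊ d ⌋ ≡ true
⌊⌋-true (yes _) _ = refl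
⌊⌋-true (no ¬p) p = ⊥-elim (¬p p)

true-⌊⌋ : {P : Set} (d : Dec P) → ⌊ d ⌋ ≡ true → P
true-⌊⌋ (yes p) _ = p

module AffineSpace (F : FiniteField) where
  open FF F
  open FieldProperties F
  open Hyperplane

  dot : ∀ {n} → Vec Carrier n → Vec Carrier n → Carrier
  dot cs xs = ΣV (zipWith _*_ cs xs)

  dot-∷ʳ : ∀ {n} (cs xs : Vec Carrier n) e y → dot (cs ∷ʳ e) (xs ∷ʳ y) ≡ dot cs xs + e * y
  dot-∷ʳ []       []       e y = +-comm _ _
  dot-∷ʳ (c ∷ cs) (x ∷ xs) e y = trans (cong (c * x +_) (dot-∷ʳ cs xs e y)) (sym (+-assoc _ _ _))

  dot-neg-scale : ∀ {n} e (ms xs : Vec Carrier n) → dot (Vec.map (λ m → - (e * m)) ms) xs ≡ - (e * dot ms xs)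
  dot-neg-scale e []       []       = solve 1 (λ e → con (ℤ.+ 0) := :- (e :* con (ℤ.+ 0))) refl e
  dot-neg-scale e (m ∷ ms) (x ∷ xs) = trans (cong (- (e * m) * x +_) (dot-neg-scale e ms xs))
    (solve 4 (λ e m x d → :- (e :* m) :* x :+ :- (e :* d) := :- (e :* (m :* x :+ d))) refl e m x (dot ms xs))

  ∑-allPoints-∷ : ∀ n f → ∑ (allPoints (suc n)) f ≡ ∑ elements (λ x → ∑ (allPoints n) (λ xs → f (x ∷ xs)))
  ∑-allPoints-∷ n f = trans (∑-concatMap _ elements f) (∑-cong elements λ x → ∑-map (x ∷_) (allPoints n) f)

  -- Points are enumerated from the first coordinate on, but the equation of the set singles out the
  -- last one; this reorders the summation.
  ∑-allPoints-∷ʳ : ∀ n f → ∑ (allPoints (suc n)) f ≡ ∑ (allPoints n) (λ xs → ∑ elements (λ y → f (xs ∷ʳ y)))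
  ∑-allPoints-∷ʳ zero    f = trans (∑-allPoints-∷ zero f)
    (trans (∑-cong elements λ x → ℕₚ.+-identityʳ _) (sym (ℕₚ.+-identityʳ _)))
  ∑-allPoints-∷ʳ (suc n) f = trans (∑-allPoints-∷ (suc n) f)
    (trans (∑-cong elements λ x → ∑-allPoints-∷ʳ n (f ∘ (x ∷_))) (sym (∑-allPoints-∷ n _)))

  ∑-allPoints-const : ∀ n c → ∑ (allPoints n) (λ _ → c) ≡ order ^ℕ n *ℕ c
  ∑-allPoints-const zero    c = refl
  ∑-allPoints-const (suc n) c = trans (∑-allPoints-∷ n (λ _ → c))
    (trans (∑-cong elements λ _ → ∑-allPoints-const n c)
      (trans (∑-const elements _) (sym (ℕₚ.*-assoc order _ c))))

  ∈-allPoints : ∀ {n} (P : Point n) → P ∈ allPoints n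
  ∈-allPoints []       = here refl
  ∈-allPoints (x ∷ xs) = ∈-concatMap⁺ _ (ListAny.map (λ where refl → ∈-map⁺ (x ∷_) (∈-allPoints xs)) (complete x))

  cardinality : ∀ {r} (S : PointSet r) → ∣ S ∣ ≡ ∑ (allPoints r) (𝟙ᵇ ∘ S)
  cardinality {r} S = length-filterᵇ S (allPoints r)

  -- A coordinate with nonzero coefficient is determined by the others. If it is not the first, then
  -- the first term moves into the constant.
  hyperplane-count : ∀ {n} (cs : Vec Carrier (suc n)) k → Any (_≢ 0#) cs →
    ∑ (allPoints (suc n)) (λ xs → 𝟙 (dot cs xs ≟ k)) ≡ order ^ℕ n
  hyperplane-count {n} (c ∷ cs) k (here c≢0) = begin
    ∑ (allPoints (suc n)) (λ xs → 𝟙 (dot (c ∷ cs) xs ≟ k))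
      ≡⟨ ∑-allPoints-∷ n _ ⟩
    ∑ elements (λ x → ∑ (allPoints n) (λ xs → 𝟙 ((c * x + dot cs xs) ≟ k)))
      ≡⟨ ∑-swap elements (allPoints n) _ ⟩
    ∑ (allPoints n) (λ xs → ∑ elements (λ x → 𝟙 ((c * x + dot cs xs) ≟ k)))
      ≡⟨ ∑-cong (allPoints n) (λ xs → ∑-affine-𝟙 (dot cs xs)) ⟩
    ∑ (allPoints n) (λ xs → 1)
      ≡⟨ trans (∑-allPoints-const n 1) (ℕₚ.*-identityʳ _) ⟩
    order ^ℕ n ∎
    where
    open ≡-Reasoning
    ∑-affine-𝟙 : ∀ d → ∑ elements (λ x → 𝟙 ((c * x + d) ≟ k)) ≡ 1
    ∑-affine-𝟙 d = trans (sym (∑-affine c≢0 d (λ z → 𝟙 (z ≟ k)))) (∑-𝟙 _≟_ fieldEnumeration k)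
  hyperplane-count {suc n} (c ∷ cs) k (there any) = begin
    ∑ (allPoints (2 +ℕ n)) (λ xs → 𝟙 (dot (c ∷ cs) xs ≟ k))
      ≡⟨ ∑-allPoints-∷ (suc n) _ ⟩
    ∑ elements (λ x → ∑ (allPoints (suc n)) (λ xs → 𝟙 ((c * x + dot cs xs) ≟ k)))
      ≡⟨ ∑-cong elements (λ x → trans (∑-cong (allPoints (suc n)) (λ xs → solve-for (c * x) (dot cs xs)))
           (hyperplane-count cs (k - c * x) any)) ⟩
    ∑ elements (λ x → order ^ℕ n)
      ≡⟨ ∑-const elements _ ⟩
    order *ℕ order ^ℕ n ∎
    where
    open ≡-Reasoning
    solve-for : ∀ x d → 𝟙 ((x + d) ≟ k) ≡ 𝟙 (d ≟ (k - x))
    solve-for x d = 𝟙-⇔ ((x + d) ≟ k) (d ≟ (k - x))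
      (λ where refl → solve 2 (λ x d → d := x :+ d :- x) refl x d)
      (λ where refl → solve 2 (λ x k → x :+ (k :- x) := k) refl x k)

  ∧-true : ∀ {x y} → x ≡ true → y ≡ true → x ∧ y ≡ true
  ∧-true refl refl = refl

  ∑-≥1 : ∀ {r} (S : PointSet r) {P} → P ∈ₛ S → 0 <ℕ ∣ S ∣
  ∑-≥1 {r} S {P} P∈S = subst₂ _<ℕ_ (trans (∑-allPoints-const r 0) (ℕₚ.*-zeroʳ (order ^ℕ r))) (sym (cardinality S))
    (∑-mono-< (allPoints r) (λ _ → z≤n) (∈-allPoints P) (subst (λ b → 0 <ℕ 𝟙ᵇ b) (sym P∈S) (s≤s z≤n)))

  nonempty : ∀ {r} (S : PointSet r) → 0 <ℕ ∣ S ∣ → ∃ λ P → P ∈ₛ S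
  nonempty {r} S 0<∣S∣ with ∑-positive (allPoints r) (subst (0 <ℕ_) (cardinality S) 0<∣S∣)
  ... | P , 0<𝟙 with S P in eq
  ...   | true = P , eq

  remove-< : ∀ {r} (T S : PointSet r) {P} → P ∈ₛ T → P ∈ₛ S → ∣ T ∩ (S ∖｛ P ｝) ∣ <ℕ ∣ T ∩ S ∣
  remove-< {r} T S {P} P∈T P∈S = subst₂ _<ℕ_ (sym (cardinality (T ∩ (S ∖｛ P ｝)))) (sym (cardinality (T ∩ S)))
    (∑-mono-< (allPoints r) shrink (∈-allPoints P) removed)
    where
    shrink : ∀ Q → 𝟙ᵇ ((T ∩ (S ∖｛ P ｝)) Q) ≤ℕ 𝟙ᵇ ((T ∩ S) Q)
    shrink Q with T Q | S Q | ⌊ VecP.≡-dec _≟_ Q P ⌋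
    ... | false | _     | _     = z≤n
    ... | true  | false | _     = z≤n
    ... | true  | true  | true  = z≤n
    ... | true  | true  | false = s≤s z≤n
    removed : 𝟙ᵇ ((T ∩ (S ∖｛ P ｝)) P) <ℕ 𝟙ᵇ ((T ∩ S) P)
    removed rewrite P∈T | P∈S | ⌊⌋-true (VecP.≡-dec _≟_ P P) refl = s≤s z≤n

  -- Removing P from S lowers the section by a hyperplane through P from t to less than t, so P is
  -- essential. Applied to any one point of S, such a hyperplane also shows that t is positive.
  minimal-criterion : ∀ {r} (S : PointSet r) t → 0 <ℕ ∣ S ∣ →
    (∀ H → t ≤ℕ ∣ hyp H ∩ S ∣) →
    (∀ P → P ∈ₛ S → ∃ λ H → P ∈ₛ hyp H × ∣ hyp H ∩ S ∣ ≡ t) →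
    IsMinimalTIntersectionSet S t
  minimal-criterion S t 0<∣S∣ t≤ through = (0<t , t≤) , essential
    where
    0<t : 0 <ℕ t
    0<t with nonempty S 0<∣S∣
    ... | P , P∈S with through P P∈S
    ...   | H , P∈H , ∣H∩S∣≡t = subst (0 <ℕ_) ∣H∩S∣≡t (∑-≥1 (hyp H ∩ S) (∧-true P∈H P∈S))
    essential : ∀ P → P ∈ₛ S → IsEssential S t P
    essential P P∈S (_ , t≤′) with through P P∈S
    ... | H , P∈H , refl = ℕₚ.<⇒≱ (remove-< (hyp H) S P∈H P∈S) (t≤′ H)

  ∈-hyp : ∀ {r} (H : Hyperplane r) P → dot (coeffs H) P ≡ const H → P ∈ₛ hyp H
  ∈-hyp H P = ⌊⌋-true (dot (coeffs H) P ≟ const H)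

  lookup-∷ʳ-nonzero : ∀ {n} (cs : Vec Carrier n) {e} → e ≢ 0# → ∃ λ i → lookup (cs ∷ʳ e) i ≢ 0#
  lookup-∷ʳ-nonzero []       e≢0 = fzero , e≢0
  lookup-∷ʳ-nonzero (_ ∷ cs) e≢0 = let i , p = lookup-∷ʳ-nonzero cs e≢0 in fsuc i , p

  ∷ʳ0-nonzero : ∀ {n} (cs : Vec Carrier n) (i : Fin (suc n)) → lookup (cs ∷ʳ 0#) i ≢ 0# → Any (_≢ 0#) cs
  ∷ʳ0-nonzero []       fzero    0≢0 = ⊥-elim (0≢0 refl)
  ∷ʳ0-nonzero (c ∷ cs) fzero    c≢0 = here c≢0
  ∷ʳ0-nonzero (c ∷ cs) (fsuc i) p   = there (∷ʳ0-nonzero cs i p)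

-- The quadratic form in coordinates and the hyperplane sections of the set.

square-power-* : ∀ {Q q} → Q ≡ q *ℕ q → ∀ n → Q ^ℕ n *ℕ q ≡ q ^ℕ (1 +ℕ n *ℕ 2)
square-power-* {q = q} refl zero    = ℕₚ.*-comm 1 q
square-power-* {q = q} refl (suc n) = begin
  q *ℕ q *ℕ (q *ℕ q) ^ℕ n *ℕ q           ≡⟨ ℕₚ.*-assoc (q *ℕ q) _ q ⟩
  q *ℕ q *ℕ ((q *ℕ q) ^ℕ n *ℕ q)         ≡⟨ cong (q *ℕ q *ℕ_) (square-power-* refl n) ⟩
  q *ℕ q *ℕ q ^ℕ (1 +ℕ n *ℕ 2)           ≡⟨ ℕₚ.*-assoc q q _ ⟩
  q ^ℕ (1 +ℕ suc n *ℕ 2)                 ∎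
  where open ≡-Reasoning

any¬-or-all : ∀ {A : Set} {P : A → Set} {n} → (∀ x → Dec (P x)) → (xs : Vec A n) → Any (λ x → ¬ P x) xs ⊎ All P xs
any¬-or-all P? []       = inj₂ []
any¬-or-all P? (x ∷ xs) with P? x | any¬-or-all P? xs
... | no ¬Px | _        = inj₁ (here ¬Px)
... | yes _  | inj₁ any = inj₁ (there any)
... | yes Px | inj₂ all = inj₂ (Px ∷ all)

record DegenerateForm (F : FiniteField) (conjugation : Conjugation F) : Set where
  open FF F
  open Conjugation conjugation
  field
    a            : Carrier
    a≢0          : a ≢ 0#
    discriminant : fromℕ 4 * (σ a * a) + β * β ≡ 0#

  form : Carrier → Carrier
  form x = σ a * (σ x * σ x) - a * (x * x) - β * (σ x * x)

module Surface (F : FiniteField) (conjugation : Conjugation F) (degenerateForm : DegenerateForm F conjugation) where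
  open FF F
  open FieldProperties F
  open Conjugation conjugation
  open FixedField F conjugation
  open DegenerateForm degenerateForm
  open AffineSpace F
  open Hyperplane

  private
    module KP = FieldProperties fixedField

    2σa≢0 : fromℕ 2 * σ a ≢ 0#
    2σa≢0 = *-≢0 2≢0 (σ-≢0 a≢0)

    -- The double root of σ a X² - β X - a, so that the form is σ a (σ x - c x)².
    c : Carrier
    c = inv 2σa≢0 * β

    2σa*c : fromℕ 2 * σ a * c ≡ β
    2σa*c = trans (sym (*-assoc _ _ _)) (trans (cong (_* β) (*-invʳ 2σa≢0)) (*-identityˡ β))

    -- After multiplication by 4 σ a this is the discriminant condition, as 2 σ a c = β.
    σa*c² : σ a * (c * c) ≡ - a
    σa*c² = *-cancelˡ (*-≢0 2≢0 2σa≢0) (begin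
      fromℕ 2 * (fromℕ 2 * σ a) * (σ a * (c * c))
        ≡⟨ solve 2 (λ s c → con (ℤ.+ 2) :* (con (ℤ.+ 2) :* s) :* (s :* (c :* c)) := con (ℤ.+ 2) :* s :* c :* (con (ℤ.+ 2) :* s :* c)) refl (σ a) c ⟩
      fromℕ 2 * σ a * c * (fromℕ 2 * σ a * c)
        ≡⟨ cong₂ _*_ 2σa*c 2σa*c ⟩
      β * β
        ≡⟨ solve 3 (λ s a b → b :* b := (con (ℤ.+ 4) :* (s :* a) :+ b :* b) :- con (ℤ.+ 4) :* (s :* a)) refl (σ a) a β ⟩
      fromℕ 4 * (σ a * a) + β * β - fromℕ 4 * (σ a * a)
        ≡⟨ cong (_- fromℕ 4 * (σ a * a)) discriminant ⟩
      0# - fromℕ 4 * (σ a * a)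
        ≡⟨ solve 2 (λ s a → con (ℤ.+ 0) :- con (ℤ.+ 4) :* (s :* a) := con (ℤ.+ 2) :* (con (ℤ.+ 2) :* s) :* :- a) refl (σ a) a ⟩
      fromℕ 2 * (fromℕ 2 * σ a) * - a ∎)
      where open ≡-Reasoning

    -- Applying σ to 2 σ a c = β gives 2 a σ c = - β; multiply the two and use the discriminant
    -- condition.
    c*σc : c * σ c ≡ 1#
    c*σc = *-cancelˡ (*-≢0 2σa≢0 (*-≢0 2≢0 a≢0)) (begin
      fromℕ 2 * σ a * (fromℕ 2 * a) * (c * σ c)
        ≡⟨ solve 4 (λ s a c d → con (ℤ.+ 2) :* s :* (con (ℤ.+ 2) :* a) :* (c :* d) := con (ℤ.+ 2) :* s :* c :* (con (ℤ.+ 2) :* a :* d)) refl (σ a) a c (σ c) ⟩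
      fromℕ 2 * σ a * c * (fromℕ 2 * a * σ c)
        ≡⟨ cong₂ _*_ 2σa*c 2a*σc ⟩
      β * - β
        ≡⟨ solve 3 (λ s a b → b :* :- b := con (ℤ.+ 2) :* s :* (con (ℤ.+ 2) :* a) :* :1 :- (con (ℤ.+ 4) :* (s :* a) :+ b :* b)) refl (σ a) a β ⟩
      fromℕ 2 * σ a * (fromℕ 2 * a) * 1# - (fromℕ 4 * (σ a * a) + β * β)
        ≡⟨ trans (cong (λ z → fromℕ 2 * σ a * (fromℕ 2 * a) * 1# - z) discriminant) (solve 1 (λ x → x :- con (ℤ.+ 0) := x) refl _) ⟩
      fromℕ 2 * σ a * (fromℕ 2 * a) * 1# ∎)
      where
      open ≡-Reasoning
      2a*σc : fromℕ 2 * a * σ c ≡ - β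
      2a*σc = begin
        fromℕ 2 * a * σ c             ≡⟨ cong₂ (λ y z → y * z * σ c) (σ-fromℕ 2) (σσ a) ⟨
        σ (fromℕ 2) * σ (σ a) * σ c   ≡⟨ cong (_* σ c) (σ-* (fromℕ 2) (σ a)) ⟨
        σ (fromℕ 2 * σ a) * σ c       ≡⟨ σ-* _ c ⟨
        σ (fromℕ 2 * σ a * c)         ≡⟨ cong σ 2σa*c ⟩
        σ β                           ≡⟨ σβ ⟩
        - β                           ∎

  -- Hilbert 90: c has norm 1, and 1 + σ c works unless σ c = -1.
  private
    hilbert-90 : ∃ λ w → w ≢ 0# × σ w ≡ c * w
    hilbert-90 with (1# + σ c) ≟ 0#
    ... | no  w≢0 = 1# + σ c , w≢0 , (begin
      σ (1# + σ c)      ≡⟨ σ-+ 1# (σ c) ⟩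
      σ 1# + σ (σ c)    ≡⟨ cong₂ _+_ σ-1 (σσ c) ⟩
      1# + c            ≡⟨ cong (_+ c) c*σc ⟨
      c * σ c + c       ≡⟨ solve 2 (λ c d → c :* d :+ c := c :* (:1 :+ d)) refl c (σ c) ⟩
      c * (1# + σ c)    ∎)
      where open ≡-Reasoning
    ... | yes 1+σc≡0 = β , β≢0 , trans σβ (trans (solve 1 (λ b → :- b := :- :1 :* b) refl β) (cong (_* β) (sym c≡-1)))
      where
      open ≡-Reasoning
      c≡-1 : c ≡ - 1#
      c≡-1 = begin
        c                       ≡⟨ solve 2 (λ c d → c := c :* (:1 :+ d) :- c :* d) refl c (σ c) ⟩
        c * (1# + σ c) - c * σ c ≡⟨ cong₂ (λ y z → c * y - z) 1+σc≡0 c*σc ⟩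
        c * 0# - 1#             ≡⟨ solve 1 (λ c → c :* con (ℤ.+ 0) :- :1 := :- :1) refl c ⟩
        - 1#                    ∎

  w : Carrier
  w = proj₁ hilbert-90

  w≢0 : w ≢ 0#
  w≢0 = proj₁ (proj₂ hilbert-90)

  σw : σ w ≡ c * w
  σw = proj₂ (proj₂ hilbert-90)

  open Coordinates w≢0

  private
    -- For z = u + β v one has σ z - z = - 2 β v, so - a w² (σ z - z)² is β times this constant
    -- times v².
    κF : Carrier
    κF = - (fromℕ 4 * (β * (a * (w * w))))

    σκF : σ κF ≡ κF
    σκF = begin
      σ κF
        ≡⟨ trans (σ-neg _) (cong -_ (trans (σ-* _ _) (cong₂ _*_ (σ-fromℕ 4) (trans (σ-* _ _)
             (cong₂ _*_ σβ (trans (σ-* _ _) (cong (σ a *_) (trans (σ-* w w) (cong₂ _*_ σw σw))))))))) ⟩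
      - (fromℕ 4 * (- β * (σ a * (c * w * (c * w)))))
        ≡⟨ solve 4 (λ b s c w → :- (con (ℤ.+ 4) :* (:- b :* (s :* (c :* w :* (c :* w))))) := con (ℤ.+ 4) :* (b :* (s :* (c :* c) :* (w :* w)))) refl β (σ a) c w ⟩
      fromℕ 4 * (β * (σ a * (c * c) * (w * w)))
        ≡⟨ cong (λ z → fromℕ 4 * (β * (z * (w * w)))) σa*c² ⟩
      fromℕ 4 * (β * (- a * (w * w)))
        ≡⟨ solve 3 (λ b a w → con (ℤ.+ 4) :* (b :* (:- a :* (w :* w))) := :- (con (ℤ.+ 4) :* (b :* (a :* (w :* w))))) refl β a w ⟩
      κF ∎
      where open ≡-Reasoning

  κ : Fixed
  κ = κF , σκF

  κ≢0 : κ ≢ K.0#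
  κ≢0 κ≡0 = *-≢0 (*-≢0 2≢0 2≢0) (*-≢0 β≢0 (*-≢0 a≢0 (*-≢0 w≢0 w≢0))) (begin
    fromℕ 2 * fromℕ 2 * (β * (a * (w * w)))
      ≡⟨ solve 1 (λ x → con (ℤ.+ 2) :* con (ℤ.+ 2) :* x := :- :- (con (ℤ.+ 4) :* x)) refl (β * (a * (w * w))) ⟩
    - κF      ≡⟨ cong -_ (cong ι κ≡0) ⟩
    - 0#      ≡⟨ solve 0 (:- con (ℤ.+ 0) := con (ℤ.+ 0)) refl ⟩
    0#        ∎)
    where open ≡-Reasoning

  open QuadraticCounting fixedField K-2≢0 κ κ≢0
  open SumsOfSquares fixedField K-2≢0 using (squareSums)

  -- With σ w = c w, σ a c² = - a and β c = - 2 a, the form is - a w² (σ z - z)² at w z.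
  form-point : ∀ u v → form (point u v) ≡ β * ι (κ K.* (v K.* v))
  form-point u v = begin
    form (point u v)
      ≡⟨ cong (λ z → σ a * (z * z) - a * (point u v * point u v) - β * (z * point u v))
           (trans (σ-point u v) (cong (_* (ι u - β * ι v)) σw)) ⟩
    σ a * (c * w * y * (c * w * y)) - a * (w * x * (w * x)) - β * (c * w * y * (w * x))
      ≡⟨ cong (λ b → σ a * (c * w * y * (c * w * y)) - a * (w * x * (w * x)) - b * (c * w * y * (w * x))) 2σa*c ⟨
    σ a * (c * w * y * (c * w * y)) - a * (w * x * (w * x)) - fromℕ 2 * σ a * c * (c * w * y * (w * x))
      ≡⟨ solve 6 (λ s c w a x y → s :* (c :* w :* y :* (c :* w :* y)) :- a :* (w :* x :* (w :* x)) :- con (ℤ.+ 2) :* s :* c :* (c :* w :* y :* (w :* x))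
            := s :* (c :* c) :* (w :* w :* (y :* y :- con (ℤ.+ 2) :* (x :* y))) :- a :* (w :* x :* (w :* x))) refl (σ a) c w a x y ⟩
    σ a * (c * c) * (w * w * (y * y - fromℕ 2 * (x * y))) - a * (w * x * (w * x))
      ≡⟨ cong (λ z → z * (w * w * (y * y - fromℕ 2 * (x * y))) - a * (w * x * (w * x))) σa*c² ⟩
    - a * (w * w * (y * y - fromℕ 2 * (x * y))) - a * (w * x * (w * x))
      ≡⟨ solve 4 (λ a w x y → :- a :* (w :* w :* (y :* y :- con (ℤ.+ 2) :* (x :* y))) :- a :* (w :* x :* (w :* x))
            := :- (a :* (w :* w) :* ((x :- y) :* (x :- y)))) refl a w x y ⟩
    - (a * (w * w) * ((x - y) * (x - y)))
      ≡⟨ cong (λ z → - (a * (w * w) * (z * z))) (solve 3 (λ u b v → u :+ b :* v :- (u :- b :* v) := con (ℤ.+ 2) :* (b :* v)) refl (ι u) β (ι v)) ⟩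
    - (a * (w * w) * (fromℕ 2 * (β * ι v) * (fromℕ 2 * (β * ι v))))
      ≡⟨ solve 4 (λ a w b v → :- (a :* (w :* w) :* (con (ℤ.+ 2) :* (b :* v) :* (con (ℤ.+ 2) :* (b :* v)))) :=
            b :* (:- (con (ℤ.+ 4) :* (b :* (a :* (w :* w)))) :* (v :* v))) refl a w β (ι v) ⟩
    β * ι (κ K.* (v K.* v)) ∎
    where
    open ≡-Reasoning
    x = ι u + β * ι v
    y = ι u - β * ι v

  -- With M = m w, expanding σ (m x) - m x at x = w (u + β v) gives β (δ u - τ v) for δ = (σ M - M)
  -- / β and τ = M + σ M.
  linearCoefficients : Carrier → Fixed × Fixed
  linearCoefficients m = difference (m * w) , trace (m * w)

  summand : Carrier → Carrier → Carrier
  summand m x = σ (m * x) - m * x + form x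

  summand-point : ∀ m u v → summand m (point u v) ≡ β * ι (value (linearCoefficients m) u v)
  summand-point m u v = begin
    σ (m * point u v) - m * point u v + form (point u v)
      ≡⟨ cong₂ _+_ (cong₂ _-_ σmx (sym (*-assoc m w _))) (form-point u v) ⟩
    σ M * (ι u - β * ι v) - M * (ι u + β * ι v) + β * k
      ≡⟨ solve 6 (λ s M b u v k → s :* (u :- b :* v) :- M :* (u :+ b :* v) :+ b :* k :=
            (s :- M) :* u :- b :* ((M :+ s) :* v) :+ b :* k) refl (σ M) M β (ι u) (ι v) k ⟩
    (σ M - M) * ι u - β * ((M + σ M) * ι v) + β * k
      ≡⟨ cong (λ z → z * ι u - β * ((M + σ M) * ι v) + β * k) (β*difference M) ⟨
    β * ι (difference M) * ι u - β * ((M + σ M) * ι v) + β * k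
      ≡⟨ solve 5 (λ b d u t k → b :* d :* u :- b :* t :+ b :* k := b :* (d :* u :- t :+ k)) refl β (ι (difference M)) (ι u) ((M + σ M) * ι v) k ⟩
    β * ι (value (linearCoefficients m) u v) ∎
    where
    open ≡-Reasoning
    M = m * w
    k = ι (κ K.* (v K.* v))
    σmx : σ (m * point u v) ≡ σ M * (ι u - β * ι v)
    σmx = begin
      σ (m * point u v)               ≡⟨ σ-* m _ ⟩
      σ m * σ (point u v)             ≡⟨ cong (σ m *_) (σ-point u v) ⟩
      σ m * (σ w * (ι u - β * ι v))   ≡⟨ *-assoc _ _ _ ⟨
      σ m * σ w * (ι u - β * ι v)     ≡⟨ cong (_* (ι u - β * ι v)) (σ-* m w) ⟨
      σ M * (ι u - β * ι v)           ∎

  ∑form : ∀ {n} → Vec Carrier n → Carrier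
  ∑form xs = ΣV (Vec.map form xs)

  equation : ∀ {n} → Vec Carrier n → Carrier → Carrier
  equation xs y = σ y - y + ∑form xs

  -- On the graph of y = d + m · x the equation is additive over the coordinates, which makes
  -- induction on their number possible.
  equation-∷ : ∀ {n} m x (xs : Vec Carrier n) d D →
    equation (x ∷ xs) (d + (m * x + D)) ≡ equation xs (d + D) + summand m x
  equation-∷ m x xs d D = trans
    (cong (λ z → z - (d + (m * x + D)) + (form x + ∑form xs)) (trans (σ-+ _ _) (cong (σ d +_) (σ-+ _ _))))
    (trans (solve 8 (λ e f g h d y D S → e :+ (f :+ g) :- (d :+ (y :+ D)) :+ (h :+ S) := e :+ g :- (d :+ D) :+ S :+ (f :- y :+ h))
       refl (σ d) (σ (m * x)) (σ D) (form x) d (m * x) D (∑form xs))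
    (cong (λ z → z - (d + D) + ∑form xs + summand m x) (sym (σ-+ d D))))

  private
    -- The constant is kept in the form β t with t fixed: each coordinate then adds its `value` to
    -- t, exactly as in the recursion of `zeroCount`.
    zeroCount-allPoints : ∀ {n} (ms : Vec Carrier n) t →
      ∑ (allPoints n) (λ xs → 𝟙 ((equation xs (dot ms xs) + β * ι t) ≟ 0#)) ≡ zeroCount (Vec.map linearCoefficients ms) t
    zeroCount-allPoints [] t = trans (ℕₚ.+-identityʳ _)
      (𝟙-⇔ ((equation [] 0# + β * ι t) ≟ 0#) (t K.≟ K.0#)
        (λ eq → ι-injective (*-zero-divisor β≢0 (trans (sym reduce) eq)))
        (λ t≡0 → trans reduce (trans (cong (λ z → β * ι z) t≡0) (zeroʳ β))))
      where
      reduce : equation [] 0# + β * ι t ≡ β * ι t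
      reduce = trans (cong (λ z → z - 0# + 0# + β * ι t) σ-0)
        (solve 1 (λ x → con (ℤ.+ 0) :- con (ℤ.+ 0) :+ con (ℤ.+ 0) :+ x := x) refl (β * ι t))
    zeroCount-allPoints {suc n} (m ∷ ms) t = begin
      ∑ (allPoints (suc n)) (λ xs → 𝟙 ((equation xs (dot (m ∷ ms) xs) + β * ι t) ≟ 0#))
        ≡⟨ ∑-allPoints-∷ n _ ⟩
      ∑ elements (λ x → ∑ (allPoints n) (λ xs → 𝟙 ((equation (x ∷ xs) (m * x + dot ms xs) + β * ι t) ≟ 0#)))
        ≡⟨ ∑-coordinates _ ⟩
      ∑ K.elements (λ u → ∑ K.elements (λ v → ∑ (allPoints n) (λ xs →
        𝟙 ((equation (point u v ∷ xs) (m * point u v + dot ms xs) + β * ι t) ≟ 0#))))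
        ≡⟨ ∑-cong K.elements (λ u → ∑-cong K.elements (λ v → trans
             (∑-cong (allPoints n) (λ xs → cong (λ z → 𝟙 (z ≟ 0#)) (peel u v xs)))
             (zeroCount-allPoints ms _))) ⟩
      zeroCount (Vec.map linearCoefficients (m ∷ ms)) t ∎
      where
      open ≡-Reasoning
      peel : ∀ u v xs → equation (point u v ∷ xs) (m * point u v + dot ms xs) + β * ι t ≡
        equation xs (dot ms xs) + β * ι (t K.+ value (linearCoefficients m) u v)
      peel u v xs = begin
        equation (x ∷ xs) (m * x + dot ms xs) + β * ι t
          ≡⟨ cong (λ z → equation (x ∷ xs) z + β * ι t) (+-identityˡ _) ⟨
        equation (x ∷ xs) (0# + (m * x + dot ms xs)) + β * ι t
          ≡⟨ cong (_+ β * ι t) (equation-∷ m x xs 0# (dot ms xs)) ⟩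
        equation xs (0# + dot ms xs) + summand m x + β * ι t
          ≡⟨ cong₂ (λ y z → equation xs y + z + β * ι t) (+-identityˡ _) (summand-point m u v) ⟩
        equation xs (dot ms xs) + β * ι (value (linearCoefficients m) u v) + β * ι t
          ≡⟨ solve 4 (λ e b g t → e :+ b :* g :+ b :* t := e :+ b :* (t :+ g)) refl _ β (ι (value (linearCoefficients m) u v)) (ι t) ⟩
        equation xs (dot ms xs) + β * ι (t K.+ value (linearCoefficients m) u v) ∎
        where x = point u v

  -- Conjugation exchanges the first two terms of the form up to sign and negates β in the third.
  σ-form : ∀ x → σ (form x) ≡ - form x
  σ-form x = begin
    σ (form x)
      ≡⟨ trans (σ-- _ _) (cong₂ _-_ (trans (σ-- _ _) (cong₂ _-_
           (trans (σ-* _ _) (cong₂ _*_ (σσ a) (trans (σ-* _ _) (cong₂ _*_ (σσ x) (σσ x)))))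
           (trans (σ-* _ _) (cong (σ a *_) (σ-* x x)))))
           (trans (σ-* _ _) (cong₂ _*_ σβ (trans (σ-* _ _) (cong (_* σ x) (σσ x)))))) ⟩
    a * (x * x) - σ a * (σ x * σ x) - - β * (x * σ x)
      ≡⟨ solve 5 (λ a s b x y → a :* (x :* x) :- s :* (y :* y) :- :- b :* (x :* y) :=
            :- (s :* (y :* y) :- a :* (x :* x) :- b :* (y :* x))) refl a (σ a) β x (σ x) ⟩
    - form x ∎
    where open ≡-Reasoning

  σ-∑form : ∀ {n} (xs : Vec Carrier n) → σ (∑form xs) ≡ - ∑form xs
  σ-∑form []       = trans σ-0 (solve 0 (con (ℤ.+ 0) := :- con (ℤ.+ 0)) refl)
  σ-∑form (x ∷ xs) = trans (σ-+ _ _) (trans (cong₂ _+_ (σ-form x) (σ-∑form xs))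
    (solve 2 (λ y z → :- y :+ :- z := :- (y :+ z)) refl (form x) (∑form xs)))

  -- Division by β leaves `difference y` + t = 0 with t in the fixed field, since the sum of the
  -- forms is anti-invariant.
  fibre-count : ∀ {n} (xs : Vec Carrier n) → ∑ elements (λ y → 𝟙 (equation xs y ≟ 0#)) ≡ K.order
  fibre-count xs = trans (∑-cong elements λ y → 𝟙-⇔ (equation xs y ≟ 0#) ((difference y K.+ t) K.≟ K.0#)
      (λ eq → ι-injective (*-zero-divisor β≢0 (trans (scaled y) eq)))
      (λ eq → trans (sym (scaled y)) (trans (cong (λ z → β * ι z) eq) (zeroʳ β))))
    (difference-fibre t)
    where
    t : Fixed
    t = toFixed (σ-∑form xs)
    scaled : ∀ y → β * ι (difference y K.+ t) ≡ equation xs y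
    scaled y = trans (distribˡ _ _ _) (cong₂ _+_ (β*difference y) (β*toFixed (σ-∑form xs)))

  equation-+ : ∀ {n} (xs : Vec Carrier n) d D → equation xs (d + D) ≡ equation xs D + β * ι (difference d)
  equation-+ xs d D = trans (cong (λ z → z - (d + D) + ∑form xs) (σ-+ d D))
    (trans (solve 5 (λ e g d D S → e :+ g :- (d :+ D) :+ S := g :- D :+ S :+ (e :- d)) refl (σ d) (σ D) d D (∑form xs))
      (cong (equation xs D +_) (sym (β*difference d))))

  order^n*K : ∀ n → order ^ℕ n *ℕ K.order ≡ K.order ^ℕ (1 +ℕ n *ℕ 2)
  order^n*K = square-power-* fixedField-order

  linear-or-square : ∀ {n} (ms : Vec Carrier n) →
    Any (λ c → proj₁ c ≢ K.0#) (Vec.map linearCoefficients ms) ⊎ All (λ c → proj₁ c ≡ K.0#) (Vec.map linearCoefficients ms)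
  linear-or-square ms = any¬-or-all (λ c → proj₁ c K.≟ K.0#) (Vec.map linearCoefficients ms)

  -- The hyperplane x_r = d + m · x, written with the coefficient e on x_r.
  IsGraph : ∀ {n} → Hyperplane (suc n) → Vec Carrier n → Carrier → Carrier → Set
  IsGraph H ms d e = coeffs H ≡ Vec.map (λ m → - (e * m)) ms ∷ʳ e × const H ≡ e * d

  graph-form : ∀ {n} (H : Hyperplane (suc n)) cs {e} (e≢0 : e ≢ 0#) → coeffs H ≡ cs ∷ʳ e →
    IsGraph H (Vec.map (λ c → - (inv e≢0 * c)) cs) (inv e≢0 * const H) e
  graph-form H cs {e} e≢0 eq = trans eq (cong (_∷ʳ e) (sym (unmap cs))) , sym (e*e⁻¹* (const H))
    where
    e*e⁻¹* : ∀ x → e * (inv e≢0 * x) ≡ x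
    e*e⁻¹* x = trans (sym (*-assoc _ _ _)) (trans (cong (_* x) (*-invʳ e≢0)) (*-identityˡ x))
    unmap : ∀ {n} (cs : Vec Carrier n) → Vec.map (λ m → - (e * m)) (Vec.map (λ c → - (inv e≢0 * c)) cs) ≡ cs
    unmap []       = refl
    unmap (c ∷ cs) = cong₂ _∷_
      (trans (solve 3 (λ e i c → :- (e :* :- (i :* c)) := e :* (i :* c)) refl e (inv e≢0) c) (e*e⁻¹* c)) (unmap cs)

  withConst : ∀ {r} → Hyperplane r → Carrier → Hyperplane r
  withConst H k = record { coeffs = coeffs H ; nonzero = nonzero H ; const = k }

  module _ {n} (S : PointSet (suc n)) (S-spec : ∀ xs y → S (xs ∷ʳ y) ≡ ⌊ equation xs y ≟ 0# ⌋) where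

    surface-cardinality : ∣ S ∣ ≡ K.order ^ℕ (1 +ℕ n *ℕ 2)
    surface-cardinality = begin
      ∣ S ∣
        ≡⟨ trans (cardinality S) (∑-allPoints-∷ʳ n _) ⟩
      ∑ (allPoints n) (λ xs → ∑ elements (λ y → 𝟙ᵇ (S (xs ∷ʳ y))))
        ≡⟨ ∑-cong (allPoints n) (λ xs → trans (∑-cong elements (λ y → cong 𝟙ᵇ (S-spec xs y))) (fibre-count xs)) ⟩
      ∑ (allPoints n) (λ xs → K.order)
        ≡⟨ ∑-allPoints-const n K.order ⟩
      order ^ℕ n *ℕ K.order
        ≡⟨ order^n*K n ⟩
      K.order ^ℕ (1 +ℕ n *ℕ 2) ∎
      where open ≡-Reasoning

    section-cardinality : ∀ H → ∣ hyp H ∩ S ∣ ≡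
      ∑ (allPoints n) (λ xs → ∑ elements (λ y → 𝟙 (dot (coeffs H) (xs ∷ʳ y) ≟ const H) *ℕ 𝟙 (equation xs y ≟ 0#)))
    section-cardinality H = trans (cardinality (hyp H ∩ S)) (trans (∑-allPoints-∷ʳ n _)
      (∑-cong (allPoints n) λ xs → ∑-cong elements λ y → trans (𝟙ᵇ-∧ (hyp H (xs ∷ʳ y)) _)
        (cong (λ b → 𝟙ᵇ (hyp H (xs ∷ʳ y)) *ℕ 𝟙ᵇ b) (S-spec xs y))))

    -- On the hyperplane y is determined by the other coordinates, and d enters the equation only
    -- through the constant `difference d`.
    graph-section : ∀ H {ms d e} → e ≢ 0# → IsGraph H ms d e →
      ∣ hyp H ∩ S ∣ ≡ zeroCount (Vec.map linearCoefficients ms) (difference d)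
    graph-section H {ms} {d} {e} e≢0 (coeffs≡ , const≡) = begin
      ∣ hyp H ∩ S ∣
        ≡⟨ section-cardinality H ⟩
      ∑ (allPoints n) (λ xs → ∑ elements (λ y → 𝟙 (dot (coeffs H) (xs ∷ʳ y) ≟ const H) *ℕ 𝟙 (equation xs y ≟ 0#)))
        ≡⟨ ∑-cong (allPoints n) (λ xs → trans
             (∑-cong elements (λ y → cong (_*ℕ 𝟙 (equation xs y ≟ 0#)) (on-graph xs y)))
             (∑-select _≟_ fieldEnumeration (d + dot ms xs) _)) ⟩
      ∑ (allPoints n) (λ xs → 𝟙 (equation xs (d + dot ms xs) ≟ 0#))
        ≡⟨ ∑-cong (allPoints n) (λ xs → cong (λ z → 𝟙 (z ≟ 0#)) (equation-+ xs d (dot ms xs))) ⟩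
      ∑ (allPoints n) (λ xs → 𝟙 ((equation xs (dot ms xs) + β * ι (difference d)) ≟ 0#))
        ≡⟨ zeroCount-allPoints ms (difference d) ⟩
      zeroCount (Vec.map linearCoefficients ms) (difference d) ∎
      where
      open ≡-Reasoning
      dot≡ : ∀ xs y → dot (coeffs H) (xs ∷ʳ y) ≡ - (e * dot ms xs) + e * y
      dot≡ xs y = trans (cong (λ cs → dot cs (xs ∷ʳ y)) coeffs≡)
        (trans (dot-∷ʳ (Vec.map (λ m → - (e * m)) ms) xs e y) (cong (_+ e * y) (dot-neg-scale e ms xs)))
      on-graph : ∀ xs y → 𝟙 (dot (coeffs H) (xs ∷ʳ y) ≟ const H) ≡ 𝟙 (y ≟ (d + dot ms xs))
      on-graph xs y = 𝟙-⇔ (dot (coeffs H) (xs ∷ʳ y) ≟ const H) (y ≟ (d + dot ms xs))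
        (λ eq → *-cancelˡ e≢0 (begin
          e * y                                      ≡⟨ solve 3 (λ e y D → e :* y := :- (e :* D) :+ e :* y :+ e :* D) refl e y (dot ms xs) ⟩
          - (e * dot ms xs) + e * y + e * dot ms xs  ≡⟨ cong (_+ e * dot ms xs) (trans (sym (dot≡ xs y)) (trans eq const≡)) ⟩
          e * d + e * dot ms xs                      ≡⟨ distribˡ _ _ _ ⟨
          e * (d + dot ms xs)                        ∎))
        (λ where refl → trans (dot≡ xs y) (trans
                   (solve 3 (λ e d D → :- (e :* D) :+ e :* (d :+ D) := e :* d) refl e d (dot ms xs)) (sym const≡)))

  module _ {n} (S : PointSet (2 +ℕ n)) (S-spec : ∀ xs y → S (xs ∷ʳ y) ≡ ⌊ equation xs y ≟ 0# ⌋) where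

    -- The hyperplane is a cylinder over a hyperplane of the first r - 1 coordinates, and every
    -- fibre of the set has the same size.
    vertical-section : ∀ H cs → coeffs H ≡ cs ∷ʳ 0# → ∣ hyp H ∩ S ∣ ≡ K.order ^ℕ (1 +ℕ n *ℕ 2)
    vertical-section H cs coeffs≡ = begin
      ∣ hyp H ∩ S ∣
        ≡⟨ section-cardinality S S-spec H ⟩
      ∑ (allPoints (suc n)) (λ xs → ∑ elements (λ y → 𝟙 (dot (coeffs H) (xs ∷ʳ y) ≟ const H) *ℕ 𝟙 (equation xs y ≟ 0#)))
        ≡⟨ ∑-cong (allPoints (suc n)) (λ xs → trans
             (∑-cong elements (λ y → cong (λ z → 𝟙 (z ≟ const H) *ℕ 𝟙 (equation xs y ≟ 0#)) (dot≡ xs y)))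
             (trans (∑-*ˡ elements (𝟙 (dot cs xs ≟ const H)) _) (cong (𝟙 (dot cs xs ≟ const H) *ℕ_) (fibre-count xs)))) ⟩
      ∑ (allPoints (suc n)) (λ xs → 𝟙 (dot cs xs ≟ const H) *ℕ K.order)
        ≡⟨ trans (∑-*ʳ (allPoints (suc n)) K.order _)
             (cong (_*ℕ K.order) (hyperplane-count cs (const H) cs≢0)) ⟩
      order ^ℕ n *ℕ K.order
        ≡⟨ order^n*K n ⟩
      K.order ^ℕ (1 +ℕ n *ℕ 2) ∎
      where
      open ≡-Reasoning
      dot≡ : ∀ xs y → dot (coeffs H) (xs ∷ʳ y) ≡ dot cs xs
      dot≡ xs y = trans (cong (λ cs → dot cs (xs ∷ʳ y)) coeffs≡)
        (trans (dot-∷ʳ cs xs 0# y) (solve 2 (λ D y → D :+ con (ℤ.+ 0) :* y := D) refl (dot cs xs) y))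
      cs≢0 : Any (_≢ 0#) cs
      cs≢0 = ∷ʳ0-nonzero cs (proj₁ (nonzero H)) (subst (λ cs → lookup cs (proj₁ (nonzero H)) ≢ 0#) coeffs≡ (proj₂ (nonzero H)))

    -- The first alternative speaks of all hyperplanes parallel to H, because minimality will move H
    -- to a parallel one through a given point.
    section-cases : ∀ H →
      (∀ k → ∣ hyp (withConst H k) ∩ S ∣ ≡ K.order ^ℕ (1 +ℕ n *ℕ 2))
      ⊎ (∃ λ s → ∣ hyp H ∩ S ∣ ≡ K.order ^ℕ suc n *ℕ squareSums (suc n) s)
    section-cases H = cases (proj₁ split) (proj₁ (proj₂ split)) (proj₂ (proj₂ split)) (_ ≟ 0#)
      where
      split = initLast (coeffs H)
      cases : ∀ cs e → coeffs H ≡ cs ∷ʳ e → Dec (e ≡ 0#) →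
        (∀ k → ∣ hyp (withConst H k) ∩ S ∣ ≡ K.order ^ℕ (1 +ℕ n *ℕ 2))
        ⊎ (∃ λ s → ∣ hyp H ∩ S ∣ ≡ K.order ^ℕ suc n *ℕ squareSums (suc n) s)
      cases cs e coeffs≡ (yes refl) = inj₁ λ k → vertical-section (withConst H k) cs coeffs≡
      cases cs e coeffs≡ (no e≢0)   = Sum.map
        (λ linear k → trans
          (graph-section S S-spec (withConst H k) e≢0 (graph-form (withConst H k) cs e≢0 coeffs≡))
          (zeroCount-linear (Vec.map linearCoefficients ms) (difference (inv e≢0 * k)) linear))
        (λ square → _ , trans
          (graph-section S S-spec H e≢0 (graph-form H cs e≢0 coeffs≡))
          (zeroCount-square (Vec.map linearCoefficients ms) (difference (inv e≢0 * const H)) square))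
        (linear-or-square ms)
        where
        ms : Vec Carrier (suc n)
        ms = Vec.map (λ c → - (inv e≢0 * c)) cs

-- Hyperplanes through a given point with a prescribed section; minimality.

module Tangents (F : FiniteField) (conjugation : Conjugation F) (degenerateForm : DegenerateForm F conjugation) where
  open FF F
  open FieldProperties F
  open Conjugation conjugation
  open FixedField F conjugation
  open AffineSpace F
  open Hyperplane
  open Surface F conjugation degenerateForm
  open Coordinates w≢0
  open QuadraticCounting fixedField K-2≢0 κ κ≢0
  open SumsOfSquares fixedField K-2≢0 using (squareSums)
  open ClosedForms fixedField K-2≢0 using (sum-of-squares; every-element-is-sum-of-squares)

  private
    module KP = FieldProperties fixedField

  -- Chosen so that m w = κ (v + z) lies in the fixed field, with v the second coordinate of x. Then
  -- δ = 0 and the completed square is centred at v + z, at distance z from the given point.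
  slope : Carrier → Fixed → Carrier
  slope x z = ι (κ K.* (proj₂ (coordinates x) K.+ z)) * inv w≢0

  slope-w : ∀ x z → slope x z * w ≡ ι (κ K.* (proj₂ (coordinates x) K.+ z))
  slope-w x z = trans (*-assoc _ _ _) (trans (cong (ι (κ K.* (proj₂ (coordinates x) K.+ z)) *_) (*-invˡ w≢0))
    (trans (*-comm _ _) (*-identityˡ _)))

  difference-ι : ∀ k → difference (ι k) ≡ K.0#
  difference-ι k = ι-injective (*-cancelˡ β≢0 (trans (β*difference (ι k))
    (trans (x≡y⇒x-y≡0 (proj₂ k)) (sym (zeroʳ β)))))

  trace-ι : ∀ k → trace (ι k) ≡ K.fromℕ 2 K.* k
  trace-ι k = ι-injective (trans (cong (ι k +_) (proj₂ k))
    (solve 1 (λ k → k :+ k := con (ℤ.+ 2) :* k) refl (ι k)))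

  difference-slope : ∀ x z → difference (slope x z * w) ≡ K.0#
  difference-slope x z = trans (cong difference (slope-w x z)) (difference-ι (κ K.* (proj₂ (coordinates x) K.+ z)))

  trace-slope : ∀ x z → trace (slope x z * w) ≡ K.fromℕ 2 K.* (κ K.* (proj₂ (coordinates x) K.+ z))
  trace-slope x z = trans (cong trace (slope-w x z)) (trace-ι (κ K.* (proj₂ (coordinates x) K.+ z)))

  μ-slope : ∀ x z → μ (linearCoefficients (slope x z)) ≡ proj₂ (coordinates x) K.+ z
  μ-slope x z = KP.*-cancelˡ 2κ≢0 (trans (sym (τ≡2κμ (linearCoefficients (slope x z))))
    (trans (trace-slope x z) (sym (KP.*-assoc (K.fromℕ 2) κ (proj₂ (coordinates x) K.+ z)))))

  value-slope : ∀ u x z → value (linearCoefficients (slope x z)) u (proj₂ (coordinates x))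
      K.+ κ K.* (μ (linearCoefficients (slope x z)) K.* μ (linearCoefficients (slope x z))) ≡ κ K.* (z K.* z)
  value-slope u x z = trans
    (cong₂ (λ c m → value c u v K.+ κ K.* (m K.* m)) (cong₂ _,_ (difference-slope x z) (trace-slope x z)) (μ-slope x z))
    (value-at-μ u v z)
    where
    v = proj₂ (coordinates x)

  slopes : ∀ {n} → Vec Carrier n → Vec Fixed n → Vec Carrier n
  slopes = zipWith slope

  -- Each coordinate contributes one instance of `value-slope`, so the point enters only through the
  -- value of the equation there.
  equation-slopes : ∀ {n} (xs : Vec Carrier n) zs d →
    equation xs (d + dot (slopes xs zs) xs) + β * ι (κ K.* ∑μ² (Vec.map linearCoefficients (slopes xs zs))) ≡
    β * ι (difference d) + β * ι (κ K.* sum-of-squares zs)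
  equation-slopes [] [] d = cong₂ _+_
    (trans (cong₂ (λ x y → x - y + 0#) (cong σ (+-identityʳ d)) (+-identityʳ d)) (trans (+-identityʳ _) (sym (β*difference d)))) refl
  equation-slopes (x ∷ xs) (z ∷ zs) d = begin
    equation (x ∷ xs) (d + (m * x + D)) + β * (ι κ * (ι μm * ι μm + S))
      ≡⟨ cong (_+ β * (ι κ * (ι μm * ι μm + S))) (equation-∷ m x xs d D) ⟩
    equation xs (d + D) + summand m x + β * (ι κ * (ι μm * ι μm + S))
      ≡⟨ cong (λ y → equation xs (d + D) + y + β * (ι κ * (ι μm * ι μm + S))) summand≡ ⟩
    equation xs (d + D) + β * ι g + β * (ι κ * (ι μm * ι μm + S))
      ≡⟨ solve 6 (λ e b g k m S → e :+ b :* g :+ b :* (k :* (m :* m :+ S)) := (e :+ b :* (k :* S)) :+ b :* (g :+ k :* (m :* m)))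
           refl (equation xs (d + D)) β (ι g) (ι κ) (ι μm) S ⟩
    equation xs (d + D) + β * (ι κ * S) + β * ι (g K.+ κ K.* (μm K.* μm))
      ≡⟨ cong₂ (λ y k → y + β * ι k) (equation-slopes xs zs d) (value-slope u x z) ⟩
    β * ι (difference d) + β * (ι κ * Z) + β * (ι κ * (ι z * ι z))
      ≡⟨ solve 5 (λ d b k Z z → d :+ b :* (k :* Z) :+ b :* (k :* (z :* z)) := d :+ b :* (k :* (z :* z :+ Z)))
           refl (β * ι (difference d)) β (ι κ) Z (ι z) ⟩
    β * ι (difference d) + β * (ι κ * (ι z * ι z + Z)) ∎
    where
    open ≡-Reasoning
    m D S Z : Carrier
    m = slope x z
    D = dot (slopes xs zs) xs
    S = ι (∑μ² (Vec.map linearCoefficients (slopes xs zs)))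
    Z = ι (sum-of-squares zs)
    u v μm g : Fixed
    u = proj₁ (coordinates x)
    v = proj₂ (coordinates x)
    μm = μ (linearCoefficients m)
    g = value (linearCoefficients m) u v
    summand≡ : summand m x ≡ β * ι g
    summand≡ = trans (cong (summand m) (sym (point-coordinates x))) (summand-point m u v)

  -- The left side is the s of `zeroCount-square` for the hyperplane through (xs, y) with these
  -- slopes. As the equation vanishes at that point, `equation-slopes` reduces to this after
  -- cancelling β and κ.
  ∑μ²-slopes : ∀ {n} (xs : Vec Carrier n) y zs → equation xs y ≡ 0# →
    ∑μ² (Vec.map linearCoefficients (slopes xs zs)) K.- KP.inv κ≢0 K.* difference (y - dot (slopes xs zs) xs) ≡ sum-of-squares zs
  ∑μ²-slopes xs y zs equation≡0 = KP.*-cancelˡ κ≢0 (ι-injective (*-cancelˡ β≢0 (begin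
    β * (ι κ * (ι S - ι (KP.inv κ≢0) * ι δ))
      ≡⟨ solve 5 (λ b k S i d → b :* (k :* (S :- i :* d)) := con (ℤ.+ 0) :+ b :* (k :* S) :- b :* ((k :* i) :* d)) refl β (ι κ) (ι S) (ι (KP.inv κ≢0)) (ι δ) ⟩
    0# + β * (ι κ * ι S) - β * (ι κ * ι (KP.inv κ≢0) * ι δ)
      ≡⟨ cong₂ (λ e k → e + β * (ι κ * ι S) - β * (k * ι δ)) (trans (sym equation≡0) (cong (equation xs) y≡)) (cong ι (KP.*-invʳ κ≢0)) ⟩
    equation xs (d + dot (slopes xs zs) xs) + β * (ι κ * ι S) - β * (1# * ι δ)
      ≡⟨ cong (_- β * (1# * ι δ)) (equation-slopes xs zs d) ⟩
    β * ι δ + β * (ι κ * ι (sum-of-squares zs)) - β * (1# * ι δ)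
      ≡⟨ solve 3 (λ b d z → b :* d :+ z :- b :* (:1 :* d) := z) refl β (ι δ) (β * (ι κ * ι (sum-of-squares zs))) ⟩
    β * (ι κ * ι (sum-of-squares zs)) ∎)))
    where
    open ≡-Reasoning
    d : Carrier
    d = y - dot (slopes xs zs) xs
    S δ : Fixed
    S = ∑μ² (Vec.map linearCoefficients (slopes xs zs))
    δ = difference d
    y≡ : y ≡ d + dot (slopes xs zs) xs
    y≡ = solve 2 (λ y D → y := y :- D :+ D) refl y (dot (slopes xs zs) xs)

  slopes-square : ∀ {n} (xs : Vec Carrier n) zs → All (λ c → proj₁ c ≡ K.0#) (Vec.map linearCoefficients (slopes xs zs))
  slopes-square []       []       = []
  slopes-square (x ∷ xs) (z ∷ zs) = difference-slope x z ∷ slopes-square xs zs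

  graph : ∀ {n} → Vec Carrier n → Carrier → Hyperplane (suc n)
  graph ms d = record
    { coeffs  = Vec.map (λ m → - (1# * m)) ms ∷ʳ 1#
    ; nonzero = lookup-∷ʳ-nonzero (Vec.map (λ m → - (1# * m)) ms) (0≢1 ∘ sym)
    ; const   = 1# * d
    }

  ∈-graph : ∀ {n} (ms xs : Vec Carrier n) y → (xs ∷ʳ y) ∈ₛ hyp (graph ms (y - dot ms xs))
  ∈-graph ms xs y = ∈-hyp (graph ms (y - dot ms xs)) (xs ∷ʳ y) (begin
    dot (Vec.map (λ m → - (1# * m)) ms ∷ʳ 1#) (xs ∷ʳ y)      ≡⟨ dot-∷ʳ (Vec.map (λ m → - (1# * m)) ms) xs 1# y ⟩
    dot (Vec.map (λ m → - (1# * m)) ms) xs + 1# * y          ≡⟨ cong (_+ 1# * y) (dot-neg-scale 1# ms xs) ⟩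
    - (1# * dot ms xs) + 1# * y                          ≡⟨ solve 2 (λ D y → :- (:1 :* D) :+ :1 :* y := :1 :* (y :- D)) refl (dot ms xs) y ⟩
    1# * (y - dot ms xs)                                 ∎)
    where open ≡-Reasoning

  module _ {n} (S : PointSet (3 +ℕ n)) (S-spec : ∀ xs y → S (xs ∷ʳ y) ≡ ⌊ equation xs y ≟ 0# ⌋) where

    Through : Point (3 +ℕ n) → ℕ → Set
    Through P k = ∃ λ H → P ∈ₛ hyp H × ∣ hyp H ∩ S ∣ ≡ k

    -- Write s as a sum of r - 1 ≥ 2 squares and take their roots as the offsets z.
    square-through : ∀ xs y s → (xs ∷ʳ y) ∈ₛ S → Through (xs ∷ʳ y) (K.order ^ℕ (2 +ℕ n) *ℕ squareSums (2 +ℕ n) s)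
    square-through xs y s P∈S = graph ms d , ∈-graph ms xs y ,
      trans (graph-section S S-spec (graph ms d) {ms} {d} (0≢1 ∘ sym) (refl , refl))
        (trans (zeroCount-square (Vec.map linearCoefficients ms) (difference d) (slopes-square xs zs))
          (cong (λ s → K.order ^ℕ (2 +ℕ n) *ℕ squareSums (2 +ℕ n) s)
            (trans (∑μ²-slopes xs y zs (true-⌊⌋ (equation xs y ≟ 0#) (trans (sym (S-spec xs y)) P∈S))) ∑zs²≡s)))
      where
      zs : Vec Fixed (2 +ℕ n)
      zs = proj₁ (every-element-is-sum-of-squares n s)
      ∑zs²≡s : sum-of-squares zs ≡ s
      ∑zs²≡s = proj₂ (every-element-is-sum-of-squares n s)
      ms : Vec Carrier (2 +ℕ n)
      ms = slopes xs zs
      d : Carrier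
      d = y - dot ms xs

    -- A section of constant size is carried through P by a parallel hyperplane; any other has the
    -- form treated in `square-through`.
    through : ∀ H P → P ∈ₛ S → Through P ∣ hyp H ∩ S ∣
    through H P P∈S = cases (section-cases S S-spec H)
      where
      cases : ((∀ k → ∣ hyp (withConst H k) ∩ S ∣ ≡ K.order ^ℕ (1 +ℕ suc n *ℕ 2))
        ⊎ (∃ λ s → ∣ hyp H ∩ S ∣ ≡ K.order ^ℕ (2 +ℕ n) *ℕ squareSums (2 +ℕ n) s)) → Through P ∣ hyp H ∩ S ∣
      cases (inj₁ constant) = withConst H (dot (coeffs H) P) , ∈-hyp (withConst H (dot (coeffs H) P)) P refl ,
        trans (constant (dot (coeffs H) P)) (sym (constant (const H)))
      cases (inj₂ (s , ∣H∩S∣≡)) = subst₂ Through (sym P≡) (sym ∣H∩S∣≡)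
        (square-through (proj₁ (initLast P)) (proj₁ (proj₂ (initLast P))) s (subst (_∈ₛ S) P≡ P∈S))
        where
        P≡ : P ≡ proj₁ (initLast P) ∷ʳ proj₁ (proj₂ (initLast P))
        P≡ = proj₂ (proj₂ (initLast P))

    surface-minimal : ∀ t → (∃ λ H → ∣ hyp H ∩ S ∣ ≡ t) → (∀ H → t ≤ℕ ∣ hyp H ∩ S ∣) → IsMinimalTIntersectionSet S t
    surface-minimal t (H , ∣H∩S∣≡t) t≤ = minimal-criterion S t
      (subst (0 <ℕ_) (sym (surface-cardinality S S-spec)) (ℕₚ.m^n>0 K.order {{ℕ.>-nonZero KP.order-positive}} (1 +ℕ (2 +ℕ n) *ℕ 2)))
      t≤ (λ P P∈S → subst (Through P) ∣H∩S∣≡t (through H P P∈S))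

-- From representation numbers to the characters of the set.

module ScaledForms (K : FiniteField) (2≢0 : FF.fromℕ K 2 ≢ FF.0# K) where
  open FF K
  open SumsOfSquares K 2≢0
  open SquareSumLaw squareSumLaw
  open ClosedForms K 2≢0

  private
    scale : ∀ i j l (N : ℕ) (x : ℤ.ℤ) → ℤ.+ N ≡ ℤ.+ (order ^ℕ j) ℤ.+ x ℤ.* ℤ.+ (order ^ℕ l) →
      ℤ.+ (order ^ℕ i *ℕ N) ≡ ℤ.+ (order ^ℕ (i +ℕ j)) ℤ.+ x ℤ.* ℤ.+ (order ^ℕ (i +ℕ l))
    scale i j l N x eq = begin
      ℤ.+ (order ^ℕ i *ℕ N)
        ≡⟨ trans (ℤₚ.pos-* (order ^ℕ i) N) (cong (λ z → ℤ.+ (order ^ℕ i) ℤ.* z) eq) ⟩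
      ℤ.+ (order ^ℕ i) ℤ.* (ℤ.+ (order ^ℕ j) ℤ.+ x ℤ.* ℤ.+ (order ^ℕ l))
        ≡⟨ lemma (ℤ.+ (order ^ℕ i)) (ℤ.+ (order ^ℕ j)) x (ℤ.+ (order ^ℕ l)) ⟩
      ℤ.+ (order ^ℕ i) ℤ.* ℤ.+ (order ^ℕ j) ℤ.+ x ℤ.* (ℤ.+ (order ^ℕ i) ℤ.* ℤ.+ (order ^ℕ l))
        ≡⟨ cong₂ (λ y z → y ℤ.+ x ℤ.* z) (power j) (power l) ⟩
      ℤ.+ (order ^ℕ (i +ℕ j)) ℤ.+ x ℤ.* ℤ.+ (order ^ℕ (i +ℕ l)) ∎
      where
      open ≡-Reasoning
      lemma : ∀ a b x c → a ℤ.* (b ℤ.+ x ℤ.* c) ≡ a ℤ.* b ℤ.+ x ℤ.* (a ℤ.* c)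
      lemma = ℤ-solve-∀
      power : ∀ j → ℤ.+ (order ^ℕ i) ℤ.* ℤ.+ (order ^ℕ j) ≡ ℤ.+ (order ^ℕ (i +ℕ j))
      power j = trans (sym (ℤₚ.pos-* (order ^ℕ i) _)) (cong (λ k → ℤ.+ k) (sym (ℕₚ.^-distribˡ-+-* order i j)))

  scaled-odd : ∀ m s → ∃ λ e → Trichotomy e ×
    ℤ.+ (order ^ℕ (1 +ℕ m *ℕ 2) *ℕ squareSums (1 +ℕ m *ℕ 2) s) ≡
    ℤ.+ (order ^ℕ (1 +ℕ m *ℕ 2 *ℕ 2)) ℤ.+ e ℤ.* ℤ.+ (order ^ℕ (1 +ℕ m *ℕ 2 +ℕ m))
  scaled-odd m s = let e , e∈ , eq = squareSums-odd m s in e , e∈ ,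
    trans (scale (1 +ℕ m *ℕ 2) (m *ℕ 2) m _ e eq)
      (cong (λ i → ℤ.+ (order ^ℕ i) ℤ.+ e ℤ.* ℤ.+ (order ^ℕ (1 +ℕ m *ℕ 2 +ℕ m))) (lemma m))
    where
    lemma : ∀ m → 1 +ℕ m *ℕ 2 +ℕ m *ℕ 2 ≡ 1 +ℕ m *ℕ 2 *ℕ 2
    lemma = solve-∀

  -- The decision of s = 0 is handed on, because `corrections` branches on it.
  scaled-even : ∀ m s → ∃ λ (d : Dec (s ≡ 0#)) →
    ℤ.+ (order ^ℕ (2 +ℕ m *ℕ 2) *ℕ squareSums (2 +ℕ m *ℕ 2) s) ≡
    ℤ.+ (order ^ℕ (1 +ℕ (1 +ℕ m *ℕ 2) *ℕ 2)) ℤ.+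
      ε ℤ.^ suc m ℤ.* (ℤ.+ (order *ℕ 𝟙 d) ℤ.- ℤ.1ℤ) ℤ.* ℤ.+ (order ^ℕ (2 +ℕ m *ℕ 2 +ℕ m))
  scaled-even m s = s ≟ 0# ,
    trans (scale (2 +ℕ m *ℕ 2) (1 +ℕ m *ℕ 2) m _ (ε ℤ.^ suc m ℤ.* (ℤ.+ (order *ℕ 𝟙 (s ≟ 0#)) ℤ.- ℤ.1ℤ)) (squareSums-even m s))
      (cong (λ i → ℤ.+ (order ^ℕ i) ℤ.+ ε ℤ.^ suc m ℤ.* (ℤ.+ (order *ℕ 𝟙 (s ≟ 0#)) ℤ.- ℤ.1ℤ) ℤ.* ℤ.+ (order ^ℕ (2 +ℕ m *ℕ 2 +ℕ m))) (lemma m))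
    where
    lemma : ∀ m → 2 +ℕ m *ℕ 2 +ℕ (1 +ℕ m *ℕ 2) ≡ 1 +ℕ (1 +ℕ m *ℕ 2) *ℕ 2
    lemma = solve-∀

parity : ∀ n → (∃ λ j → n ≡ j *ℕ 2) ⊎ (∃ λ j → n ≡ 1 +ℕ j *ℕ 2)
parity zero    = inj₁ (0 , refl)
parity (suc n) with parity n
... | inj₁ (j , refl) = inj₂ (j , refl)
... | inj₂ (j , refl) = inj₁ (suc j , refl)

-1^2j : ∀ j → ℤ.-1ℤ ℤ.^ (j *ℕ 2) ≡ ℤ.1ℤ
-1^2j zero    = refl
-1^2j (suc j) = trans (lemma (ℤ.-1ℤ ℤ.^ (j *ℕ 2))) (-1^2j j)
  where
  lemma : ∀ x → ℤ.-1ℤ ℤ.* (ℤ.-1ℤ ℤ.* x) ≡ x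
  lemma = ℤ-solve-∀

twoSided : ∀ {N z x e} → e ≡ ℤ.-1ℤ ⊎ e ≡ ℤ.0ℤ ⊎ e ≡ ℤ.1ℤ → N ≡ z ℤ.+ e ℤ.* x → N ≡ z ℤ.- x ⊎ N ≡ z ⊎ N ≡ z ℤ.+ x
twoSided {z = z} {x} (inj₁ refl) eq = inj₁ (trans eq (lemma z x))
  where
  lemma : ∀ z x → z ℤ.+ ℤ.-1ℤ ℤ.* x ≡ z ℤ.- x
  lemma = ℤ-solve-∀
twoSided {z = z} {x} (inj₂ (inj₁ refl)) eq = inj₂ (inj₁ (trans eq (lemma z x)))
  where
  lemma : ∀ z x → z ℤ.+ ℤ.0ℤ ℤ.* x ≡ z
  lemma = ℤ-solve-∀
twoSided {z = z} {x} (inj₂ (inj₂ refl)) eq = inj₂ (inj₂ (trans eq (lemma z x)))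
  where
  lemma : ∀ z x → z ℤ.+ ℤ.1ℤ ℤ.* x ≡ z ℤ.+ x
  lemma = ℤ-solve-∀

-- The negative answer, s ≠ 0, gives the first value and the positive one the second; E will be a
-- power of ε.
corrections : ∀ {P : Set} (d : Dec P) E q z x (N : ℤ.ℤ) → N ≡ z ℤ.+ E ℤ.* (ℤ.+ (q *ℕ 𝟙 d) ℤ.- ℤ.1ℤ) ℤ.* x →
  N ≡ z ℤ.- E ℤ.* x ⊎ N ≡ z ℤ.- E ℤ.* x ℤ.+ E ℤ.* (ℤ.+ q ℤ.* x)
corrections (no _)  E q z x N eq rewrite ℕₚ.*-zeroʳ q = inj₁ (trans eq (lemma E z x))
  where
  lemma : ∀ E z x → z ℤ.+ E ℤ.* (ℤ.0ℤ ℤ.- ℤ.1ℤ) ℤ.* x ≡ z ℤ.- E ℤ.* x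
  lemma = ℤ-solve-∀
corrections (yes _) E q z x N eq rewrite ℕₚ.*-identityʳ q = inj₂ (trans eq (lemma E (ℤ.+ q) z x))
  where
  lemma : ∀ E q z x → z ℤ.+ E ℤ.* (q ℤ.- ℤ.1ℤ) ℤ.* x ≡ z ℤ.- E ℤ.* x ℤ.+ E ℤ.* (q ℤ.* x)
  lemma = ℤ-solve-∀

-- The middle value z does not arise here: it is the size of the vertical and the linear sections.
lowPlus : ∀ {E N q z x} → E ≡ ℤ.1ℤ → N ≡ z ℤ.- E ℤ.* x ⊎ N ≡ z ℤ.- E ℤ.* x ℤ.+ E ℤ.* (q ℤ.* x) →
  N ≡ z ℤ.- x ⊎ N ≡ z ⊎ N ≡ z ℤ.- x ℤ.+ q ℤ.* x
lowPlus {q = q} {z} {x} refl = λ where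
    (inj₁ eq) → inj₁ (trans eq (lemma₁ z x))
    (inj₂ eq) → inj₂ (inj₂ (trans eq (lemma₂ q z x)))
  where
  lemma₁ : ∀ z x → z ℤ.- ℤ.1ℤ ℤ.* x ≡ z ℤ.- x
  lemma₁ = ℤ-solve-∀
  lemma₂ : ∀ q z x → z ℤ.- ℤ.1ℤ ℤ.* x ℤ.+ ℤ.1ℤ ℤ.* (q ℤ.* x) ≡ z ℤ.- x ℤ.+ q ℤ.* x
  lemma₂ = ℤ-solve-∀

lowMinus : ∀ {E N q z x} → E ≡ ℤ.-1ℤ → N ≡ z ℤ.- E ℤ.* x ⊎ N ≡ z ℤ.- E ℤ.* x ℤ.+ E ℤ.* (q ℤ.* x) →
  N ≡ z ℤ.+ x ℤ.- q ℤ.* x ⊎ N ≡ z ⊎ N ≡ z ℤ.+ x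
lowMinus {q = q} {z} {x} refl = λ where
    (inj₁ eq) → inj₂ (inj₂ (trans eq (lemma₁ z x)))
    (inj₂ eq) → inj₁ (trans eq (lemma₂ q z x))
  where
  lemma₁ : ∀ z x → z ℤ.- ℤ.-1ℤ ℤ.* x ≡ z ℤ.+ x
  lemma₁ = ℤ-solve-∀
  lemma₂ : ∀ q z x → z ℤ.- ℤ.-1ℤ ℤ.* x ℤ.+ ℤ.-1ℤ ℤ.* (q ℤ.* x) ≡ z ℤ.+ x ℤ.- q ℤ.* x
  lemma₂ = ℤ-solve-∀

3≢1 : 3 ≢ 1
3≢1 ()

square-injective : ∀ {m n} → m *ℕ m ≡ n *ℕ n → m ≡ n
square-injective {m} {n} eq with ℕₚ.<-cmp m n
... | tri< m<n _ _ = ⊥-elim (ℕₚ.<⇒≢ (ℕₚ.*-mono-< m<n m<n) eq)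
... | tri≈ _ m≡n _ = m≡n
... | tri> _ _ n<m = ⊥-elim (ℕₚ.<⇒≢ (ℕₚ.*-mono-< n<m n<m) (sym eq))

-- In this and the next lemmas the truncated subtractions and divisions of the statement are exact
-- once r is written as a sum.
double-∸3 : ∀ n → 2 *ℕ (2 +ℕ n) ∸ℕ 3 ≡ 1 +ℕ n *ℕ 2
double-∸3 n = trans (cong (_∸ℕ 3) (lemma n)) (ℕₚ.m+n∸m≡n 3 (1 +ℕ n *ℕ 2))
  where
  lemma : ∀ n → 2 *ℕ (2 +ℕ n) ≡ 3 +ℕ (1 +ℕ n *ℕ 2)
  lemma = solve-∀

double-∸1 : ∀ n → 2 *ℕ (2 +ℕ n) ∸ℕ 1 ≡ 1 +ℕ (1 +ℕ n) *ℕ 2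
double-∸1 n = trans (cong (_∸ℕ 1) (lemma n)) (ℕₚ.m+n∸m≡n 1 (1 +ℕ (1 +ℕ n) *ℕ 2))
  where
  lemma : ∀ n → 2 *ℕ (2 +ℕ n) ≡ 1 +ℕ (1 +ℕ (1 +ℕ n) *ℕ 2)
  lemma = solve-∀

even-exponent : ∀ m → (3 *ℕ (2 +ℕ m *ℕ 2) ∸ℕ 4) / 2 ≡ 1 +ℕ m *ℕ 2 +ℕ m
even-exponent m = trans (cong (λ x → (x ∸ℕ 4) / 2) (lemma m))
  (trans (cong (_/ 2) (ℕₚ.m+n∸m≡n 4 ((1 +ℕ m *ℕ 2 +ℕ m) *ℕ 2))) (m*n/n≡m (1 +ℕ m *ℕ 2 +ℕ m) 2))
  where
  lemma : ∀ m → 3 *ℕ (2 +ℕ m *ℕ 2) ≡ 4 +ℕ (1 +ℕ m *ℕ 2 +ℕ m) *ℕ 2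
  lemma = solve-∀

odd-exponent : ∀ m → (3 *ℕ (3 +ℕ m *ℕ 2) ∸ℕ 5) / 2 ≡ 2 +ℕ m *ℕ 2 +ℕ m
odd-exponent m = trans (cong (λ x → (x ∸ℕ 5) / 2) (lemma m))
  (trans (cong (_/ 2) (ℕₚ.m+n∸m≡n 5 ((2 +ℕ m *ℕ 2 +ℕ m) *ℕ 2))) (m*n/n≡m (2 +ℕ m *ℕ 2 +ℕ m) 2))
  where
  lemma : ∀ m → 3 *ℕ (3 +ℕ m *ℕ 2) ≡ 5 +ℕ (2 +ℕ m *ℕ 2 +ℕ m) *ℕ 2
  lemma = solve-∀

odd-exponent-suc : ∀ m → (3 *ℕ (2 +ℕ m *ℕ 2)) / 2 ≡ suc (2 +ℕ m *ℕ 2 +ℕ m)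
odd-exponent-suc m = trans (cong (_/ 2) (lemma m)) (m*n/n≡m (suc (2 +ℕ m *ℕ 2 +ℕ m)) 2)
  where
  lemma : ∀ m → 3 *ℕ (2 +ℕ m *ℕ 2) ≡ suc (2 +ℕ m *ℕ 2 +ℕ m) *ℕ 2
  lemma = solve-∀

module SectionCardinalities (F : FiniteField) (conjugation : Conjugation F) (degenerateForm : DegenerateForm F conjugation) where
  open FF F
  open FixedField F conjugation
  open Surface F conjugation degenerateForm
  open SumsOfSquares fixedField K-2≢0 using (squareSums; squareSumLaw)
  open SumsOfSquares.SquareSumLaw squareSumLaw using (ε; ε-cases)
  open ScaledForms fixedField K-2≢0
  open Hyperplane

  private
    -- Here r = 3 + 2 m, so r ≡ 1 modulo 4 means that m is odd and the exponent even; q ≡ 1 modulo 4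
    -- forces ε = 1.
    ε^-plus : ∀ m → (3 +ℕ m *ℕ 2) % 4 ≡ 1 ⊎ K.order % 4 ≡ 1 → ε ℤ.^ suc m ≡ ℤ.1ℤ
    ε^-plus m cond with ε-cases
    ... | inj₁ (ε≡1 , _) = trans (cong (ℤ._^ suc m) ε≡1) (ℤₚ.^-zeroˡ (suc m))
    ... | inj₂ (ε≡-1 , q%4≡3) = trans (cong (ℤ._^ suc m) ε≡-1) (odd-case cond (parity m))
      where
      odd-case : (3 +ℕ m *ℕ 2) % 4 ≡ 1 ⊎ K.order % 4 ≡ 1 → (∃ λ j → m ≡ j *ℕ 2) ⊎ (∃ λ j → m ≡ 1 +ℕ j *ℕ 2) → ℤ.-1ℤ ℤ.^ suc m ≡ ℤ.1ℤ
      odd-case (inj₂ q%4≡1) _                 = ⊥-elim (3≢1 (trans (sym q%4≡3) q%4≡1))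
      odd-case (inj₁ _)     (inj₂ (j , refl)) = -1^2j (suc j)
      odd-case (inj₁ r%4≡1) (inj₁ (j , refl)) = ⊥-elim (3≢1 (trans (sym r%4≡3) r%4≡1))
        where
        r%4≡3 : (3 +ℕ j *ℕ 2 *ℕ 2) % 4 ≡ 3
        r%4≡3 = trans (cong (λ x → (3 +ℕ x) % 4) (ℕₚ.*-assoc j 2 2)) ([m+kn]%n≡m%n 3 j 4)

    -- Now ε = -1, and r = 3 + 2 m ≡ 3 modulo 4 means that m is even, so the exponent is odd.
    ε^-minus : ∀ m → (3 +ℕ m *ℕ 2) % 4 ≡ 3 → K.order % 4 ≡ 3 → ε ℤ.^ suc m ≡ ℤ.-1ℤ
    ε^-minus m r%4≡3 q%4≡3 with ε-cases
    ... | inj₁ (_ , q%4≡1)  = ⊥-elim (3≢1 (trans (sym q%4≡3) q%4≡1))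
    ... | inj₂ (ε≡-1 , _) = trans (cong (ℤ._^ suc m) ε≡-1) (even-case (parity m))
      where
      even-case : (∃ λ j → m ≡ j *ℕ 2) ⊎ (∃ λ j → m ≡ 1 +ℕ j *ℕ 2) → ℤ.-1ℤ ℤ.^ suc m ≡ ℤ.-1ℤ
      even-case (inj₁ (j , refl)) = cong (λ x → ℤ.-1ℤ ℤ.* x) (-1^2j j)
      even-case (inj₂ (j , refl)) = ⊥-elim (3≢1 (trans (sym r%4≡3) r%4≡1))
        where
        r%4≡1 : (5 +ℕ j *ℕ 2 *ℕ 2) % 4 ≡ 1
        r%4≡1 = trans (cong (λ x → (5 +ℕ x) % 4) (ℕₚ.*-assoc j 2 2)) ([m+kn]%n≡m%n 5 j 4)

  module _ {n} (S : PointSet (2 +ℕ n)) (S-spec : ∀ xs y → S (xs ∷ʳ y) ≡ ⌊ equation xs y ≟ 0# ⌋) where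

    section-split : ∀ H → ∣ hyp H ∩ S ∣ ≡ K.order ^ℕ (1 +ℕ n *ℕ 2)
      ⊎ (∃ λ s → ∣ hyp H ∩ S ∣ ≡ K.order ^ℕ suc n *ℕ squareSums (suc n) s)
    section-split H = Sum.map₁ (λ constant → constant (const H)) (section-cases S S-spec H)

  power : ℕ → ℤ.ℤ
  power i = ℤ.+ (K.order ^ℕ i)

  even-sections : ∀ m (S : PointSet (2 +ℕ m *ℕ 2)) → (∀ xs y → S (xs ∷ʳ y) ≡ ⌊ equation xs y ≟ 0# ⌋) → ∀ H →
    let N = ℤ.+ ∣ hyp H ∩ S ∣
        z = power (1 +ℕ m *ℕ 2 *ℕ 2)
        x = power (1 +ℕ m *ℕ 2 +ℕ m)
    in N ≡ z ℤ.- x ⊎ N ≡ z ⊎ N ≡ z ℤ.+ x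
  even-sections m S S-spec H = Sum.[ (λ eq → inj₂ (inj₁ (cong (λ k → ℤ.+ k) eq))) , square ]′ (section-split S S-spec H)
    where
    square = λ (s , eq) → let e , e∈ , eq′ = scaled-odd m s in twoSided e∈ (trans (cong (λ k → ℤ.+ k) eq) eq′)

  odd-sections : ∀ m (S : PointSet (3 +ℕ m *ℕ 2)) → (∀ xs y → S (xs ∷ʳ y) ≡ ⌊ equation xs y ≟ 0# ⌋) → ∀ H →
    let N = ℤ.+ ∣ hyp H ∩ S ∣
        z = power (1 +ℕ (1 +ℕ m *ℕ 2) *ℕ 2)
        x = power (2 +ℕ m *ℕ 2 +ℕ m)
        E = ε ℤ.^ suc m
    in N ≡ z ⊎ (N ≡ z ℤ.- E ℤ.* x ⊎ N ≡ z ℤ.- E ℤ.* x ℤ.+ E ℤ.* (ℤ.+ K.order ℤ.* x))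
  odd-sections m S S-spec H = Sum.map (cong (λ k → ℤ.+ k)) square (section-split S S-spec H)
    where
    square = λ (s , eq) → let d , eq′ = scaled-even m s in
      corrections d (ε ℤ.^ suc m) K.order (power (1 +ℕ (1 +ℕ m *ℕ 2) *ℕ 2)) (power (2 +ℕ m *ℕ 2 +ℕ m)) _ (trans (cong (λ k → ℤ.+ k) eq) eq′)

  odd-sections-plus : ∀ m (S : PointSet (3 +ℕ m *ℕ 2)) → (∀ xs y → S (xs ∷ʳ y) ≡ ⌊ equation xs y ≟ 0# ⌋) →
    (3 +ℕ m *ℕ 2) % 4 ≡ 1 ⊎ K.order % 4 ≡ 1 → ∀ H →
    let N = ℤ.+ ∣ hyp H ∩ S ∣
        z = power (1 +ℕ (1 +ℕ m *ℕ 2) *ℕ 2)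
        x = power (2 +ℕ m *ℕ 2 +ℕ m)
    in N ≡ z ℤ.- x ⊎ N ≡ z ⊎ N ≡ z ℤ.- x ℤ.+ power (suc (2 +ℕ m *ℕ 2 +ℕ m))
  odd-sections-plus m S S-spec cond H = subst
    (λ y → ℤ.+ ∣ hyp H ∩ S ∣ ≡ z ℤ.- x ⊎ ℤ.+ ∣ hyp H ∩ S ∣ ≡ z ⊎ ℤ.+ ∣ hyp H ∩ S ∣ ≡ z ℤ.- x ℤ.+ y)
    (sym (ℤₚ.pos-* K.order (K.order ^ℕ (2 +ℕ m *ℕ 2 +ℕ m))))
    (Sum.[ inj₂ ∘ inj₁ , lowPlus {q = ℤ.+ K.order} {z} {x} (ε^-plus m cond) ]′ (odd-sections m S S-spec H))
    where
    z = power (1 +ℕ (1 +ℕ m *ℕ 2) *ℕ 2)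
    x = power (2 +ℕ m *ℕ 2 +ℕ m)

  odd-sections-minus : ∀ m (S : PointSet (3 +ℕ m *ℕ 2)) → (∀ xs y → S (xs ∷ʳ y) ≡ ⌊ equation xs y ≟ 0# ⌋) →
    (3 +ℕ m *ℕ 2) % 4 ≡ 3 → K.order % 4 ≡ 3 → ∀ H →
    let N = ℤ.+ ∣ hyp H ∩ S ∣
        z = power (1 +ℕ (1 +ℕ m *ℕ 2) *ℕ 2)
        x = power (2 +ℕ m *ℕ 2 +ℕ m)
    in N ≡ z ℤ.+ x ℤ.- power (suc (2 +ℕ m *ℕ 2 +ℕ m)) ⊎ N ≡ z ⊎ N ≡ z ℤ.+ x
  odd-sections-minus m S S-spec r%4≡3 q%4≡3 H = subst
    (λ y → ℤ.+ ∣ hyp H ∩ S ∣ ≡ z ℤ.+ x ℤ.- y ⊎ ℤ.+ ∣ hyp H ∩ S ∣ ≡ z ⊎ ℤ.+ ∣ hyp H ∩ S ∣ ≡ z ℤ.+ x)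
    (sym (ℤₚ.pos-* K.order (K.order ^ℕ (2 +ℕ m *ℕ 2 +ℕ m))))
    (Sum.[ inj₂ ∘ inj₁ , lowMinus {q = ℤ.+ K.order} {z} {x} (ε^-minus m r%4≡3 q%4≡3) ]′ (odd-sections m S S-spec H))
    where
    z = power (1 +ℕ (1 +ℕ m *ℕ 2) *ℕ 2)
    x = power (2 +ℕ m *ℕ 2 +ℕ m)

-- The set of the theorem as an instance.

⌊⌋-⇔ : {P Q : Set} (d : Dec P) (e : Dec Q) → (P → Q) → (Q → P) → ⌊ d ⌋ ≡ ⌊ e ⌋
⌊⌋-⇔ (yes p) e to from = sym (⌊⌋-true e (to p))
⌊⌋-⇔ (no ¬p) (yes q) to from = ⊥-elim (¬p (from q))
⌊⌋-⇔ (no ¬p) (no _) to from = refl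

%4⇒%2 : ∀ r c → r % 4 ≡ c → r % 2 ≡ c % 2
%4⇒%2 r c r%4≡c = begin
  r % 2                            ≡⟨ cong (_% 2) (m≡m%n+[m/n]*n r 4) ⟩
  (r % 4 +ℕ r / 4 *ℕ 4) % 2        ≡⟨ cong₂ (λ x y → (x +ℕ y) % 2) r%4≡c (sym (ℕₚ.*-assoc (r / 4) 2 2)) ⟩
  (c +ℕ r / 4 *ℕ 2 *ℕ 2) % 2       ≡⟨ [m+kn]%n≡m%n c (r / 4 *ℕ 2) 2 ⟩
  c % 2                            ∎
  where open ≡-Reasoning

module Variety (p k : ℕ) (p-prime : Prime p) (p-odd : p % 2 ≡ 1)
               (F : FiniteField) (order≡q² : FiniteField.order F ≡ (p ^ℕ k) ^ℕ 2)
               (a b : FF.Carrier F) (a≢0 : a ≢ FF.0# F) (b^q≢b : FF._^_ F b (p ^ℕ k) ≢ b)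
               (discriminant : FF._+_ F (FF._*_ F (FF.fromℕ F 4) (FF._^_ F a (p ^ℕ k +ℕ 1)))
                                        (FF._^_ F (FF._-_ F (FF._^_ F b (p ^ℕ k)) b) 2) ≡ FF.0# F) where
  open FF F
  open FieldProperties F

  private
    q : ℕ
    q = p ^ℕ k

    p≡0 : fromℕ p ≡ 0#
    p≡0 = characteristic {p} {k *ℕ 2} (trans order≡q² (ℕₚ.^-*-assoc p k 2))

    conjugate-involutive : ∀ x → (x ^ q) ^ q ≡ x
    conjugate-involutive x = begin
      (x ^ q) ^ q     ≡⟨ ^-* x q q ⟨
      x ^ (q *ℕ q)    ≡⟨ cong (x ^_) (trans (cong (q *ℕ_) (sym (ℕₚ.*-identityʳ q))) (sym order≡q²)) ⟩
      x ^ order       ≡⟨ x^order≡x x ⟩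
      x               ∎
      where open ≡-Reasoning

    conjugate-+ : ∀ x y → (x + y) ^ q ≡ x ^ q + y ^ q
    conjugate-+ = frobenius-iterate-+ p-prime p≡0 k

    -- Adding the conjugate of b to both sides leaves only additivity and involutivity to be used.
    conjugate-β : (b ^ q - b) ^ q ≡ - (b ^ q - b)
    conjugate-β = +-cancelʳ _ _ (b ^ q) (begin
      (b ^ q - b) ^ q + b ^ q      ≡⟨ conjugate-+ (b ^ q - b) b ⟨
      (b ^ q - b + b) ^ q          ≡⟨ cong (_^ q) (solve 2 (λ x b → x :- b :+ b := x) refl (b ^ q) b) ⟩
      (b ^ q) ^ q                  ≡⟨ conjugate-involutive b ⟩
      b                            ≡⟨ solve 2 (λ x b → b := :- (x :- b) :+ x) refl (b ^ q) b ⟩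
      - (b ^ q - b) + b ^ q        ∎)
      where open ≡-Reasoning

  conjugation : Conjugation F
  conjugation = record
    { σ   = _^ q
    ; σ-+ = conjugate-+
    ; σ-* = λ x y → *-^ x y q
    ; σσ  = conjugate-involutive
    ; β   = b ^ q - b
    ; σβ  = conjugate-β
    ; β≢0 = b^q≢b ∘ x-y≡0⇒x≡y
    ; 2≢0 = odd-characteristic {p} p-odd p≡0
    }

  degenerateForm : DegenerateForm F conjugation
  degenerateForm = record
    { a            = a
    ; a≢0          = a≢0
    ; discriminant = trans (cong₂ (λ x y → fromℕ 4 * x + y)
        (trans (cong (a ^ q *_) (sym (*-identityʳ a))) (sym (^-+ a q 1)))
        (cong ((b ^ q - b) *_) (sym (*-identityʳ (b ^ q - b))))) discriminant
    }

  open FixedField F conjugation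
  open AffineSpace F
  open Surface F conjugation degenerateForm
  open Tangents F conjugation degenerateForm using (surface-minimal)
  open SectionCardinalities F conjugation degenerateForm
  open DegenerateForm degenerateForm using (form)

  -- Both numbers have the order of F as their square.
  fixedField-order≡q : K.order ≡ q
  fixedField-order≡q = square-injective (trans (sym fixedField-order)
    (trans order≡q² (cong (q *ℕ_) (ℕₚ.*-identityʳ q))))

  private
    B-sums : ∀ {n} (xs : Vec Carrier n) →
      a ^ q * ΣV (Vec.map (λ y → y ^ (2 *ℕ q)) xs) - a * ΣV (Vec.map (λ y → y ^ 2) xs)
        - (b ^ q - b) * ΣV (Vec.map (λ y → y ^ (q +ℕ 1)) xs) ≡ ∑form xs
    B-sums [] = solve 3 (λ s a c → s :* con (ℤ.+ 0) :- a :* con (ℤ.+ 0) :- c :* con (ℤ.+ 0) := con (ℤ.+ 0)) refl (a ^ q) a (b ^ q - b)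
    B-sums (x ∷ xs) = begin
      a ^ q * (x ^ (2 *ℕ q) + X) - a * (x ^ 2 + Y) - β * (x ^ (q +ℕ 1) + Z)
        ≡⟨ cong₂ (λ u v → a ^ q * (u + X) - a * (x ^ 2 + Y) - β * (v + Z)) x^2q (^-+ x q 1) ⟩
      a ^ q * (x ^ q * x ^ q + X) - a * (x * (x * 1#) + Y) - β * (x ^ q * (x * 1#) + Z)
        ≡⟨ solve 8 (λ s a b x y X Y Z → s :* (y :* y :+ X) :- a :* (x :* (x :* :1) :+ Y) :- b :* (y :* (x :* :1) :+ Z) :=
              (s :* (y :* y) :- a :* (x :* x) :- b :* (y :* x)) :+ (s :* X :- a :* Y :- b :* Z)) refl (a ^ q) a β x (x ^ q) X Y Z ⟩
      form x + (a ^ q * X - a * Y - β * Z)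
        ≡⟨ cong (form x +_) (B-sums xs) ⟩
      form x + ∑form xs ∎
      where
      open ≡-Reasoning
      β X Y Z : Carrier
      β = b ^ q - b
      X = ΣV (Vec.map (λ y → y ^ (2 *ℕ q)) xs)
      Y = ΣV (Vec.map (λ y → y ^ 2) xs)
      Z = ΣV (Vec.map (λ y → y ^ (q +ℕ 1)) xs)
      x^2q : x ^ (2 *ℕ q) ≡ x ^ q * x ^ q
      x^2q = trans (cong (λ m → x ^ (q +ℕ m)) (ℕₚ.+-identityʳ q)) (^-+ x q q)

  𝓑-equation : ∀ {n} (xs : Vec Carrier n) y → 𝓑 {n} a b q (xs ∷ʳ y) ≡ ⌊ equation xs y ≟ 0# ⌋
  𝓑-equation {n} xs y = ⌊⌋-⇔ (B-lhs a b q (xs ∷ʳ y) ≟ B-rhs a b q (xs ∷ʳ y)) (equation xs y ≟ 0#)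
      (λ eq → trans (sym B≡) (x≡y⇒x-y≡0 eq)) (λ eq → x-y≡0⇒x≡y (trans B≡ eq))
    where
    B≡ : B-lhs a b q (xs ∷ʳ y) - B-rhs a b q (xs ∷ʳ y) ≡ equation xs y
    B≡ rewrite VecP.last-∷ʳ y xs | VecP.init-∷ʳ y xs = trans
      (solve 5 (λ z y X Y Z → z :- y :+ X :- Y :- Z := z :- y :+ (X :- Y :- Z)) refl (y ^ q) y _ _ _)
      (cong (λ z → y ^ q - y + z) (B-sums xs))

  private
    power-cong : ∀ {i j} → j ≡ i → K.order ^ℕ i ≡ q ^ℕ j
    power-cong j≡i = cong₂ _^ℕ_ fixedField-order≡q (sym j≡i)

  B-cardinality : ∀ n → ∣ 𝓑 {suc n} a b q ∣ ≡ q ^ℕ (2 *ℕ (2 +ℕ n) ∸ℕ 1)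
  B-cardinality n = trans (surface-cardinality (𝓑 {suc n} a b q) 𝓑-equation) (power-cong (double-∸1 n))

  B-even : ∀ m (H : Hyperplane (2 +ℕ m *ℕ 2)) →
    let r = 2 +ℕ m *ℕ 2
        N = ℤ.+ ∣ hyp H ∩ 𝓑 a b q ∣
        z = ℤ.+ (q ^ℕ (2 *ℕ r ∸ℕ 3))
        x = ℤ.+ (q ^ℕ ((3 *ℕ r ∸ℕ 4) / 2))
    in N ≡ z ℤ.- x ⊎ N ≡ z ⊎ N ≡ z ℤ.+ x
  B-even m H = subst₂ (λ z x → let N = ℤ.+ ∣ hyp H ∩ 𝓑 a b q ∣ in N ≡ ℤ.+ z ℤ.- ℤ.+ x ⊎ N ≡ ℤ.+ z ⊎ N ≡ ℤ.+ z ℤ.+ ℤ.+ x)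
    (power-cong (double-∸3 (m *ℕ 2))) (power-cong (even-exponent m))
    (even-sections m (𝓑 a b q) 𝓑-equation H)

  B-odd-plus : ∀ m → let r = 3 +ℕ m *ℕ 2 in r % 4 ≡ 1 ⊎ q % 4 ≡ 1 → ∀ (H : Hyperplane r) →
    let N = ℤ.+ ∣ hyp H ∩ 𝓑 a b q ∣
        z = ℤ.+ (q ^ℕ (2 *ℕ r ∸ℕ 3))
        x = ℤ.+ (q ^ℕ ((3 *ℕ r ∸ℕ 5) / 2))
        y = ℤ.+ (q ^ℕ ((3 *ℕ (r ∸ℕ 1)) / 2))
    in N ≡ z ℤ.- x ⊎ N ≡ z ⊎ N ≡ z ℤ.- x ℤ.+ y
  B-odd-plus m cond H = subst
    (λ y → N ≡ z ℤ.- x ⊎ N ≡ z ⊎ N ≡ z ℤ.- x ℤ.+ ℤ.+ y) (power-cong (odd-exponent-suc m))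
    (subst₂ (λ z x → N ≡ ℤ.+ z ℤ.- ℤ.+ x ⊎ N ≡ ℤ.+ z ⊎ N ≡ ℤ.+ z ℤ.- ℤ.+ x ℤ.+ power (suc (2 +ℕ m *ℕ 2 +ℕ m)))
      (power-cong (double-∸3 (1 +ℕ m *ℕ 2))) (power-cong (odd-exponent m))
      (odd-sections-plus m (𝓑 a b q) 𝓑-equation (Sum.map₂ (trans (cong (_% 4) fixedField-order≡q)) cond) H))
    where
    N = ℤ.+ ∣ hyp H ∩ 𝓑 a b q ∣
    z = ℤ.+ (q ^ℕ (2 *ℕ (3 +ℕ m *ℕ 2) ∸ℕ 3))
    x = ℤ.+ (q ^ℕ ((3 *ℕ (3 +ℕ m *ℕ 2) ∸ℕ 5) / 2))

  B-odd-minus : ∀ m → let r = 3 +ℕ m *ℕ 2 in r % 4 ≡ 3 → q % 4 ≡ 3 → ∀ (H : Hyperplane r) →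
    let N = ℤ.+ ∣ hyp H ∩ 𝓑 a b q ∣
        z = ℤ.+ (q ^ℕ (2 *ℕ r ∸ℕ 3))
        x = ℤ.+ (q ^ℕ ((3 *ℕ r ∸ℕ 5) / 2))
        y = ℤ.+ (q ^ℕ ((3 *ℕ (r ∸ℕ 1)) / 2))
    in N ≡ z ℤ.+ x ℤ.- y ⊎ N ≡ z ⊎ N ≡ z ℤ.+ x
  B-odd-minus m r%4≡3 q%4≡3 H = subst
    (λ y → N ≡ z ℤ.+ x ℤ.- ℤ.+ y ⊎ N ≡ z ⊎ N ≡ z ℤ.+ x) (power-cong (odd-exponent-suc m))
    (subst₂ (λ z x → N ≡ ℤ.+ z ℤ.+ ℤ.+ x ℤ.- power (suc (2 +ℕ m *ℕ 2 +ℕ m)) ⊎ N ≡ ℤ.+ z ⊎ N ≡ ℤ.+ z ℤ.+ ℤ.+ x)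
      (power-cong (double-∸3 (1 +ℕ m *ℕ 2))) (power-cong (odd-exponent m))
      (odd-sections-minus m (𝓑 a b q) 𝓑-equation r%4≡3 (trans (cong (_% 4) fixedField-order≡q) q%4≡3) H))
    where
    N = ℤ.+ ∣ hyp H ∩ 𝓑 a b q ∣
    z = ℤ.+ (q ^ℕ (2 *ℕ (3 +ℕ m *ℕ 2) ∸ℕ 3))
    x = ℤ.+ (q ^ℕ ((3 *ℕ (3 +ℕ m *ℕ 2) ∸ℕ 5) / 2))

  B-minimal : ∀ n → 2 <ℕ 2 +ℕ n → (t : ℕ) →
    (∃ λ (H : Hyperplane (2 +ℕ n)) → ∣ hyp H ∩ 𝓑 {1 +ℕ n} a b q ∣ ≡ t) →
    (∀ (H : Hyperplane (2 +ℕ n)) → t ≤ℕ ∣ hyp H ∩ 𝓑 {1 +ℕ n} a b q ∣) →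
    IsMinimalTIntersectionSet (𝓑 {1 +ℕ n} a b q) t
  B-minimal zero    (s≤s (s≤s ()))
  B-minimal (suc n) _ = surface-minimal (𝓑 {2 +ℕ n} a b q) 𝓑-equation

-- The theorem, by the parity of r.

open import Data.Integer using (ℤ; +_) renaming (_+_ to _+ℤ_; _-_ to _-ℤ_)

theorem3p1 : (p k : ℕ) → Prime p → p % 2 ≡ 1 → 1 ≤ℕ k →
  (F : FiniteField) → FiniteField.order F ≡ (p ^ℕ k) ^ℕ 2 →
  (n : ℕ) → 1 ≤ℕ n →
  let q = p ^ℕ k
      r = suc n
      open FF F
      e₀ = (2 *ℕ r) ∸ℕ 3
  in
  (a b : Carrier) → a ≢ 0# → b ^ q ≢ b →
  fromℕ 4 * a ^ (q +ℕ 1) + (b ^ q - b) ^ 2 ≡ 0# →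
  (∣ 𝓑 {n} a b q ∣ ≡ q ^ℕ ((2 *ℕ r) ∸ℕ 1))
  × (((r % 4 ≡ 1) ⊎ ((r % 2 ≡ 1) × (q % 4 ≡ 1))) →
      ∀ (H : Hyperplane r) → let N = + ∣ hyp H ∩ 𝓑 {n} a b q ∣ in
        (N ≡ + (q ^ℕ e₀) -ℤ + (q ^ℕ (((3 *ℕ r) ∸ℕ 5) / 2)))
        ⊎ (N ≡ + (q ^ℕ e₀))
        ⊎ (N ≡ + (q ^ℕ e₀) -ℤ + (q ^ℕ (((3 *ℕ r) ∸ℕ 5) / 2))
                +ℤ + (q ^ℕ ((3 *ℕ (r ∸ℕ 1)) / 2))))
  × (((r % 4 ≡ 3) × (q % 4 ≡ 3)) →
      ∀ (H : Hyperplane r) → let N = + ∣ hyp H ∩ 𝓑 {n} a b q ∣ in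
        (N ≡ + (q ^ℕ e₀) +ℤ + (q ^ℕ (((3 *ℕ r) ∸ℕ 5) / 2))
                -ℤ + (q ^ℕ ((3 *ℕ (r ∸ℕ 1)) / 2)))
        ⊎ (N ≡ + (q ^ℕ e₀))
        ⊎ (N ≡ + (q ^ℕ e₀) +ℤ + (q ^ℕ (((3 *ℕ r) ∸ℕ 5) / 2))))
  × ((r % 2 ≡ 0) →
      ∀ (H : Hyperplane r) → let N = + ∣ hyp H ∩ 𝓑 {n} a b q ∣ in
        (N ≡ + (q ^ℕ e₀) -ℤ + (q ^ℕ (((3 *ℕ r) ∸ℕ 4) / 2)))
        ⊎ (N ≡ + (q ^ℕ e₀))
        ⊎ (N ≡ + (q ^ℕ e₀) +ℤ + (q ^ℕ (((3 *ℕ r) ∸ℕ 4) / 2))))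
  × (2 <ℕ r → (t : ℕ) →
      (∃ λ (H : Hyperplane r) → ∣ hyp H ∩ 𝓑 {n} a b q ∣ ≡ t) →
      (∀ (H : Hyperplane r) → t ≤ℕ ∣ hyp H ∩ 𝓑 {n} a b q ∣) →
      IsMinimalTIntersectionSet (𝓑 {n} a b q) t)
theorem3p1 p k p-prime p-odd 1≤k F order≡ (suc n) 1≤n a b a≢0 b^q≢b discriminant with parity n
-- Here r = 2 + 2 m is even, so the two clauses for odd r are vacuous.
... | inj₁ (m , refl) =
    B-cardinality (m *ℕ 2)
  , (λ r-odd → contradiction (Sum.[ %4⇒%2 (2 +ℕ m *ℕ 2) 1 , proj₁ ]′ r-odd))
  , (λ r-odd → contradiction (%4⇒%2 (2 +ℕ m *ℕ 2) 3 (proj₁ r-odd)))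
  , (λ _ → B-even m)
  , B-minimal (m *ℕ 2)
  where
  open Variety p k p-prime p-odd F order≡ a b a≢0 b^q≢b discriminant
  contradiction : ∀ {A : Set} → (2 +ℕ m *ℕ 2) % 2 ≡ 1 → A
  contradiction r%2≡1 with () ← trans (sym ([m+kn]%n≡m%n 2 m 2)) r%2≡1
-- Here r = 3 + 2 m is odd, and the clause for even r is vacuous.
... | inj₂ (m , refl) =
    B-cardinality (1 +ℕ m *ℕ 2)
  , (λ r-odd → B-odd-plus m (Sum.map₂ proj₂ r-odd))
  , (λ cond → B-odd-minus m (proj₁ cond) (proj₂ cond))
  , (λ r-even → contradiction r-even)
  , B-minimal (1 +ℕ m *ℕ 2)
  where
  open Variety p k p-prime p-odd F order≡ a b a≢0 b^q≢b discriminant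
  contradiction : ∀ {A : Set} → (3 +ℕ m *ℕ 2) % 2 ≡ 0 → A
  contradiction r%2≡0 with () ← trans (sym ([m+kn]%n≡m%n 3 m 2)) r%2≡0
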